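{- Let $\lambda$ be a partition with at most $n$ parts. (i) If $\eta\in UGC_\lambda(n)$, then $\pi:=\Pi_\lambda[\Delta_\lambda(\eta)]\in S_n^{\lambda\text{ - }312}$ and $s_\lambda(\eta;x)\equiv d_\lambda(\pi;x)$ (i.e. $\mathcal{S}_\lambda(\eta)=\mathcal{D}_\lambda(\pi)$). (ii) If $\pi\in S_n^{\lambda\text{ - }312}$, then $\gamma:=\Psi_\lambda(\pi)\in UG_\lambda(n)$ and $d_\lambda(\pi;x)\equiv s_\lambda(\gamma;x)$. (iii) Every flag Schur polynomial $s_\lambda(\varphi;x)$, $\varphi\in UF_\lambda(n)$, is identical (as a generating function) to a uniquely determined Demazure polynomial $d_\lambda(\pi;x)$, $\pi\in S_n^\lambda$, and every Demazure polynomial $d_\lambda(\pi;x)$ with $\pi\in S_n^{\lambda\text{ - }312}$ is identical to a uniquely determined flag Schur polynomial.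
   Context: Fix $n\ge1$, $[n]=\{1,\dots,n\}$, variables $x_1,\dots,x_n$. A partition $\lambda=(\lambda_1\ge\dots\ge\lambda_n\ge0)$; box $(j,i)$ of its shape is in column $j$, row $i$. $R_\lambda\subseteq[n-1]$ is the set of distinct column lengths of $\lambda$ less than $n$, written $q_1<\dots<q_r$, $q_0:=0$, $q_{r+1}:=n$; carrels are $(q_{h-1},q_h]$, $h\in[r+1]$. $\lambda$-tuples: $n$-tuples with entries in $[n]$; upper if $\beta_i\ge i$. $U_\lambda(n)$ upper ones; $UF_\lambda(n)$ weakly increasing upper ones; $UI_\lambda(n)$ upper ones strictly increasing on each carrel. Critical indices of $\beta\in U_\lambda(n)$: in carrel $h$ put $x_1:=q_h$; recursively $x_u$ is the largest index with $q_{h-1}<x_u<x_{u-1}$ and $\beta_{x_{u-1}}-\beta_{x_u}>x_{u-1}-x_u$, stopping when none exists; critical entries $\beta_{x_u}$. $\Delta_\lambda(\beta)_i:=\beta_x-(x-i)$, $x$ the smallest critical index $\ge i$ in the carrel of $i$. $UGC_\lambda(n)$: $\beta$ whose critical entries, listed by increasing critical index, weakly increase; $UG_\lambda(n):=UGC_\lambda(n)\cap UI_\lambda(n)$. $S_n^\lambda$: permutations $\pi$ of $[n]$ increasing on each carrel; $B_h:=\{\pi_1,\dots,\pi_{q_h}\}$. $\pi\in S_n^{\lambda\text{ - }312}$ if there are no $h\in[r-1]$ and $a\le q_h<b\le q_{h+1}<c$ with $\pi_a>\pi_c>\pi_b$. $\Psi_\lambda(\pi)=\psi$: for $i$ in carrel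 $h$, $\psi_i$ is the $(q_h-i+1)$-th largest element of $B_h$. For $\gamma\in UG_\lambda(n)$, $\Pi_\lambda(\gamma)=\pi$: $\pi_i:=\gamma_i$ on $(0,q_1]$; for $h=1,\dots,r$ in turn, $s:=\gamma_{q_h}-\gamma_{q_h+1}+1$ if $\gamma_{q_h}>\gamma_{q_h+1}$, else $s:=0$; $\pi_i:=\gamma_i$ for $i\in(q_h+s,q_{h+1}]$; for $i\in(q_h,q_h+s]$, $\pi_i$ is the $(q_h+s-i+1)$-th largest element of $\{1,\dots,\gamma_{q_h}\}\setminus\{\pi_1,\dots,\pi_{q_h}\}$. $\mathcal{T}_\lambda$: semistandard tableaux of shape $\lambda$ with entries in $[n]$, ordered entrywise; content $\Theta(T)$ counts entries equal to each $i$; weight $x^{\Theta(T)}$. $\mathcal{S}_\lambda(\beta):=\{T:T_j(i)\le\beta_i\ \forall (j,i)\}$, $s_\lambda(\beta;x):=\sum_{T\in\mathcal{S}_\lambda(\beta)}x^{\Theta(T)}$; flag Schur polynomial when $\beta\in UF_\lambda(n)$. $\lambda$-key $Y_\lambda(\pi)$: tableau of shape $\lambda$ whose columns of length $q_h$ have entry set $B_h$ and columns of length $n$ have entry set $[n]$. $\mathcal{D}_\lambda(\pi):=\{T:K_+(T)\le Y_\lambda(\pi)\}$, $K_+(T)$ the Lascoux–Schützenberger right key; $d_\lambda(\pi;x):=\sum_{T\in\mathcal{D}_\lambda(\pi)}x^{\Theta(T)}$. Two weight-sum polynomials are identical ($\equiv$) if their underlying tableau sets are equal.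
   Formalization: In Π_λ, s := γ_{q_h} − γ_{q_h+1} + 1 is used when γ_{q_h} ≥ γ_{q_h+1}, not only when >; with the strict rule (i) fails: for n=4, λ=(2,2,0,0), η=(1,3,3,4) it gives π=(1,3,3,4), which is not a permutation. -}

module Defs where

-- Conventions: an n-tuple / permutation (one-line notation) / partition is a
-- `Vec ℕ n`; all indices are 1-based and accessed with `at` (default 0 outside
-- [1,n]).  A tableau is a function `T j i` (column j, row i), only its values
-- on the boxes of the shape matter.

open import Data.Nat using (ℕ; zero; suc; _+_; _∸_; _≤_; _<_; _≤ᵇ_; _<ᵇ_; _≡ᵇ_)
open import Data.Bool using (Bool; true; false; if_then_else_; _∧_; not; T)
open import Data.List using (List; []; _∷_; length; map; concat; reverse; last; foldr; take; _++_)
open import Data.Bool.ListAction using (any)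
open import Data.List.Relation.Unary.All using (All)
open import Data.List.Relation.Unary.Linked using (Linked)
open import Data.List.Relation.Binary.Permutation.Propositional using (_↭_)
import Data.Vec as V
open V using (Vec)
open import Data.Fin using (Fin; toℕ)
open import Data.Maybe using (Maybe; just; nothing)
open import Data.Product using (Σ; _×_; _,_; proj₂)
open import Relation.Binary.PropositionalEquality using (_≡_; _≢_)
open import Relation.Nullary using (¬_)

at : ∀ {n} → Vec ℕ n → ℕ → ℕ
at V.[] _ = 0
at (x V.∷ xs) zero = 0
at (x V.∷ xs) (suc zero) = x
at (x V.∷ xs) (suc (suc i)) = at xs (suc i)

nth : List ℕ → ℕ → ℕ
nth [] _ = 0
nth (x ∷ xs) zero = 0
nth (x ∷ xs) (suc zero) = x
nth (x ∷ xs) (suc (suc i)) = nth xs (suc i)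

range : ℕ → List ℕ
range zero = []
range (suc m) = range m ++ (suc m ∷ [])

tab : (n : ℕ) → (ℕ → ℕ) → Vec ℕ n
tab n f = V.tabulate (λ (k : Fin n) → f (suc (toℕ k)))

countB : (ℕ → Bool) → List ℕ → ℕ
countB p = foldr (λ x acc → if p x then suc acc else acc) 0

filterB : (ℕ → Bool) → List ℕ → List ℕ
filterB p = foldr (λ x acc → if p x then x ∷ acc else acc) []

memb : ℕ → List ℕ → Bool
memb v xs = any (λ y → y ≡ᵇ v) xs

prefix : ∀ {n} → Vec ℕ n → ℕ → List ℕ
prefix π q = map (at π) (range q)

setOf : (n : ℕ) → List ℕ → List ℕ
setOf n xs = filterB (λ v → memb v xs) (range n)

-- k-th largest element of an increasingly sorted list (1-based)
kthLargest : ℕ → List ℕ → ℕ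
kthLargest k xs = nth (reverse xs) k

IsPartition : ∀ {n} → Vec ℕ n → Set
IsPartition {n} lam = ∀ i → 1 ≤ i → i < n → at lam (suc i) ≤ at lam i

lam₁ : ∀ {n} → Vec ℕ n → ℕ
lam₁ lam = at lam 1

colLen : ∀ {n} → Vec ℕ n → ℕ → ℕ
colLen {n} lam j = countB (λ i → j ≤ᵇ at lam i) (range n)

isR : ∀ {n} → Vec ℕ n → ℕ → Bool
isR {n} lam q = (1 ≤ᵇ q) ∧ ((q <ᵇ n) ∧ any (λ j → colLen lam j ≡ᵇ q) (range (lam₁ lam)))

topGo : ∀ {n} → Vec ℕ n → ℕ → ℕ → ℕ
topGo lam zero c = c
topGo lam (suc f) c = if isR lam c then c else topGo lam f (suc c)

-- for i in carrel h : top i = q_h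
top : ∀ {n} → Vec ℕ n → ℕ → ℕ
top {n} lam i = topGo lam (n ∸ i) i

botGo : ∀ {n} → Vec ℕ n → ℕ → ℕ
botGo lam zero = 0
botGo lam (suc c) = if isR lam (suc c) then suc c else botGo lam c

-- for i in carrel h : bot i = q_{h-1}
bot : ∀ {n} → Vec ℕ n → ℕ → ℕ
bot lam i = botGo lam (i ∸ 1)

IsTuple : ∀ {n} → Vec ℕ n → Set
IsTuple {n} β = ∀ i → 1 ≤ i → i ≤ n → (1 ≤ at β i) × (at β i ≤ n)

Upper : ∀ {n} → Vec ℕ n → Set
Upper {n} β = IsTuple β × (∀ i → 1 ≤ i → i ≤ n → i ≤ at β i)

UF : ∀ {n} → Vec ℕ n → Vec ℕ n → Set
UF {n} lam β = Upper β × (∀ i → 1 ≤ i → i < n → at β i ≤ at β (suc i))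

-- UI_λ(n): strictly increasing on each carrel (i, i+1 in the same carrel iff i ∉ R_λ)
UI : ∀ {n} → Vec ℕ n → Vec ℕ n → Set
UI {n} lam β = Upper β × (∀ i → 1 ≤ i → i < n → isR lam i ≡ false → at β i < at β (suc i))

findDown : (ℕ → Bool) → ℕ → ℕ → Maybe ℕ
findDown p lo zero = nothing
findDown p lo (suc k) = if lo <ᵇ suc k then (if p (suc k) then just (suc k) else findDown p lo k) else nothing

-- next critical index after x : largest y with lo < y < x and β_x - β_y > x - y
nextCrit : ∀ {n} → Vec ℕ n → ℕ → ℕ → Maybe ℕ
nextCrit β lo x = findDown (λ y → (at β y + x) <ᵇ (at β x + y)) lo (x ∸ 1)

critsGo : ∀ {n} → Vec ℕ n → ℕ → ℕ → ℕ → List ℕ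
critsGoM : ∀ {n} → Vec ℕ n → ℕ → ℕ → Maybe ℕ → List ℕ
critsGo β lo zero x = x ∷ []
critsGo β lo (suc f) x = x ∷ critsGoM β lo f (nextCrit β lo x)
critsGoM β lo f nothing = []
critsGoM β lo f (just y) = critsGo β lo f y

critList : ∀ {n} → Vec ℕ n → Vec ℕ n → ℕ → List ℕ
critList lam β i = critsGo β (bot lam i) (top lam i) (top lam i)

isCrit : ∀ {n} → Vec ℕ n → Vec ℕ n → ℕ → Bool
isCrit lam β i = memb i (critList lam β i)

UGC : ∀ {n} → Vec ℕ n → Vec ℕ n → Set
UGC {n} lam β = Upper β × (∀ i j → 1 ≤ i → i < j → j ≤ n →
  T (isCrit lam β i) → T (isCrit lam β j) → at β i ≤ at β j)

UG : ∀ {n} → Vec ℕ n → Vec ℕ n → Set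
UG lam β = UGC lam β × UI lam β

upGo : (ℕ → Bool) → ℕ → ℕ → ℕ
upGo p zero c = c
upGo p (suc f) c = if p c then c else upGo p f (suc c)

Delta : ∀ {n} → Vec ℕ n → Vec ℕ n → Vec ℕ n
Delta {n} lam β = tab n (λ i → let x = upGo (isCrit lam β) (top lam i ∸ i) i in at β x ∸ (x ∸ i))

IsPerm : ∀ {n} → Vec ℕ n → Set
IsPerm {n} π = IsTuple π × (∀ i j → 1 ≤ i → i < j → j ≤ n → at π i ≢ at π j)

Sλ : ∀ {n} → Vec ℕ n → Vec ℕ n → Set
Sλ {n} lam π = IsPerm π × (∀ i → 1 ≤ i → i < n → isR lam i ≡ false → at π i < at π (suc i))

-- S_n^{λ-312}: q = q_h, top (q+1) = q_{h+1}, both in R_λ (so h ∈ [r-1])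
S312 : ∀ {n} → Vec ℕ n → Vec ℕ n → Set
S312 {n} lam π = Sλ lam π × (∀ q a b c → T (isR lam q) → T (isR lam (top lam (suc q))) →
  1 ≤ a → a ≤ q → q < b → b ≤ top lam (suc q) → top lam (suc q) < c → c ≤ n →
  ¬ ((at π c < at π a) × (at π b < at π c)))

Psi : ∀ {n} → Vec ℕ n → Vec ℕ n → Vec ℕ n
Psi {n} lam π = tab n (λ i → kthLargest (suc (top lam i ∸ i)) (setOf n (prefix π (top lam i))))

-- Π_λ(γ), computed entry by entry; pre = (π_1, ..., π_{i-1})
-- NB: s := γ_{q_h} - γ_{q_h+1} + 1 when γ_{q_h} ≥ γ_{q_h+1}
piEntry : ∀ {n} → Vec ℕ n → Vec ℕ n → List ℕ → ℕ → ℕ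
piEntry lam γ pre i =
  let b = bot lam i
      s = if at γ (suc b) ≤ᵇ at γ b then suc (at γ b ∸ at γ (suc b)) else 0
  in if b ≡ᵇ 0 then at γ i
     else (if i ≤ᵇ b + s
           then kthLargest (suc (b + s ∸ i))
                  (filterB (λ v → not (memb v (take b pre))) (range (at γ b)))
           else at γ i)

piList : ∀ {n} → Vec ℕ n → Vec ℕ n → ℕ → List ℕ
piList lam γ zero = []
piList lam γ (suc i) = piList lam γ i ++ (piEntry lam γ (piList lam γ i) (suc i) ∷ [])

Pi : ∀ {n} → Vec ℕ n → Vec ℕ n → Vec ℕ n
Pi {n} lam γ = tab n (λ i → nth (piList lam γ n) i)

Tab : Set
Tab = ℕ → ℕ → ℕ

InShape : ∀ {n} → Vec ℕ n → ℕ → ℕ → Set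
InShape {n} lam j i = (1 ≤ i) × (i ≤ n) × (1 ≤ j) × (j ≤ at lam i)

IsSSYT : ∀ {n} → Vec ℕ n → Tab → Set
IsSSYT {n} lam t =
  (∀ j i → InShape lam j i → (1 ≤ t j i) × (t j i ≤ n)) ×
  (∀ j i → InShape lam j i → InShape lam (suc j) i → t j i ≤ t (suc j) i) ×
  (∀ j i → InShape lam j i → InShape lam j (suc i) → t j i < t j (suc i))

Sset : ∀ {n} → Vec ℕ n → Vec ℕ n → Tab → Set
Sset lam β t = IsSSYT lam t × (∀ j i → InShape lam j i → t j i ≤ at β i)

Ykey : ∀ {n} → Vec ℕ n → Vec ℕ n → ℕ → ℕ → ℕ
Ykey {n} lam π j i = if colLen lam j ≡ᵇ n then i else nth (setOf n (prefix π (colLen lam j))) i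

data _≈K_ : List ℕ → List ℕ → Set where
  krefl  : ∀ {w} → w ≈K w
  ksym   : ∀ {u w} → u ≈K w → w ≈K u
  ktrans : ∀ {u v w} → u ≈K v → v ≈K w → u ≈K w
  kK1 : ∀ u v x y z → x ≤ y → y < z →
        (u ++ x ∷ z ∷ y ∷ v) ≈K (u ++ z ∷ x ∷ y ∷ v)
  kK2 : ∀ u v x y z → x < y → y ≤ z →
        (u ++ y ∷ x ∷ z ∷ v) ≈K (u ++ y ∷ z ∷ x ∷ v)

colWord : ∀ {n} → Vec ℕ n → Tab → List ℕ
colWord lam t = concat (map (λ j → map (λ i → t j i) (reverse (range (colLen lam j)))) (range (lam₁ lam)))

-- skew tableaux, as a list of columns (left to right); a column (o , es)
-- occupies rows o+1, ..., o + length es, with entries es from top to bottom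
SkewCol : Set
SkewCol = ℕ × List ℕ

ColOK : SkewCol → Set
ColOK (o , es) = (1 ≤ length es) × Linked _<_ es

AdjOK : SkewCol → SkewCol → Set
AdjOK (o , es) (o' , es') =
  (o' ≤ o) × (o' + length es' ≤ o + length es) ×
  (∀ r → o < r → r ≤ o' + length es' → nth es (r ∸ o) ≤ nth es' (r ∸ o'))

IsSkewTab : List SkewCol → Set
IsSkewTab s = All ColOK s × Linked AdjOK s

skewWord : List SkewCol → List ℕ
skewWord s = concat (map (λ c → reverse (proj₂ c)) s)

colLens : ∀ {n} → Vec ℕ n → List ℕ
colLens lam = map (colLen lam) (range (lam₁ lam))

-- C is the column of length c of the right key K_+(T): the last column of a
-- frank skew tableau Knuth equivalent to T whose last column has length c
-- (Lascoux–Schützenberger)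
RightKeyCol : ∀ {n} → Vec ℕ n → Tab → ℕ → List ℕ → Set
RightKeyCol lam t c C = Σ (List SkewCol) λ s →
  IsSkewTab s × (map (λ col → length (proj₂ col)) s ↭ colLens lam) ×
  (skewWord s ≈K colWord lam t) × (Σ ℕ λ o → last s ≡ just (o , C)) × (length C ≡ c)

Dset : ∀ {n} → Vec ℕ n → Vec ℕ n → Tab → Set
Dset lam π t = IsSSYT lam t × (∀ j → 1 ≤ j → j ≤ lam₁ lam →
  Σ (List ℕ) λ C → RightKeyCol lam t (colLen lam j) C ×
    (∀ i → 1 ≤ i → i ≤ colLen lam j → nth C i ≤ Ykey lam π j i))

-- equality of tableau sets (≡ of weight-sum polynomials)
SameSet : (Tab → Set) → (Tab → Set) → Set
SameSet A B = ∀ t → (A t → B t) × (B t → A t)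

{-# OPTIONS --safe #-}
module Submission where

-- A tableau T is compared with a key column by column, in terms of the counts cnt v C = #{x ∈ C : x ≤ v}.
--
-- Every column T_j lies entrywise below the right key: if the columns of a skew tableau have, up to order, the
-- lengths of the columns of T and its word is Knuth equivalent to T, sort them into T by rectifying adjacent
-- pairs.  By uniqueness of the tableau in a Knuth class no rectification can spread the column lengths, so the
-- last column C merely moves to the left, past shorter columns, and its entries weakly decrease.
--
-- Conversely, exchange T_j with the columns to its right, one after the other.  If π avoids λ-312, then B_q arises
-- from B_q' (q' < q) by adding elements above max B_q' and filling up an interval that ends at max B_q'.  Hence if
-- the moving column is bounded by B_q and the column it passes by B_q', then the moving column remains bounded by
-- B_q.  So K_+(T) ≤ Y_λ(π) as soon as T ≤ Y_λ(π), and T ≤ Y_λ(π) if T_j(i) ≤ Ψ_λ(π)_i.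
--
-- Finally Δ_λ(η)_i is the minimum of η_x − (x − i) over the x ≥ i in the carrel of i, which replaces the row bound η
-- by an equivalent one, Π_λ inverts Ψ_λ, and Y_λ(π) ∈ 𝒟_λ(π) shows that 𝒟_λ(π) determines π.

open import Defs
open import Data.Bool using (Bool; true; false; if_then_else_; not; T)
open import Data.Bool.Properties using (T-≡; T-∧)
open import Data.Empty using (⊥)
open import Data.List using (List; []; _∷_; [_]; length; map; concat; reverse; last; take; _++_)
open import Data.List.Membership.Propositional using (_∈_; _∉_; find)
open import Data.List.Membership.Propositional.Properties using (∈-++⁺ˡ; ∈-++⁺ʳ; ∈-++⁻; ∈-map⁺; ∈-map⁻; ∈-∃++)
open import Data.List.Membership.Propositional.Properties.WithK using (unique∧set⇒bag)
open import Data.List.Properties using (++-assoc; ++-identityʳ; map-++; concat-++; length-++; length-map; length-reverse; reverse-involutive; unfold-reverse; map-∘; map-cong; reverse-map; ∷-injective)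
open import Data.List.Relation.Binary.BagAndSetEquality using (∼bag⇒↭)
open import Data.List.Relation.Binary.Permutation.Propositional as Perm using (_↭_; ↭-refl; ↭-sym; ↭-trans; prep; swap; ↭-reflexive)
open import Data.List.Relation.Binary.Permutation.Propositional.Properties using (↭-length; ∈-resp-↭; ↭-reverse; ++⁺ˡ; All-resp-↭; ∷↭∷ʳ)
open import Data.List.Relation.Binary.Pointwise using (Pointwise-≡⇒≡)
open import Data.List.Relation.Binary.Sublist.Heterogeneous.Properties using (toPointwise)
open import Data.List.Relation.Binary.Sublist.Propositional using (_⊆_; []; _∷_; _∷ʳ_; minimum)
open import Data.List.Relation.Binary.Sublist.Propositional.Properties using (length-mono-≤)
open import Data.List.Relation.Unary.All as All using (All; []; _∷_)
import Data.List.Relation.Unary.All.Properties as All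
open import Data.List.Relation.Unary.AllPairs as AllPairs using (AllPairs; []; _∷_)
import Data.List.Relation.Unary.AllPairs.Properties as AllPairs
open import Data.List.Relation.Unary.Any as Any using (here; there)
open import Data.List.Relation.Unary.Any.Properties using (any⁺; any⁻)
open import Data.List.Relation.Unary.Linked using (Linked; []; [-]; _∷_)
import Data.List.Relation.Unary.Linked.Properties as Linked
open import Data.Maybe using (just; nothing)
open import Data.Maybe.Properties using (just-injective)
open import Data.Nat
open import Data.Nat.Properties
open import Data.Nat.Tactic.RingSolver using (solve-∀)
open import Data.List.Membership.DecPropositional _≟_ using (_∈?_)
open import Data.Product using (Σ; ∃; _×_; _,_; proj₁; proj₂)
open import Data.Sum using (_⊎_; inj₁; inj₂)
open import Data.Unit using (tt)
open import Data.Vec as V using (Vec)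
open import Function using (_∘_)
open import Function.Bundles using (Equivalence; mk⇔)
open import Relation.Binary.Definitions using (tri<; tri≈; tri>)
open import Relation.Binary.PropositionalEquality using (_≡_; _≢_; refl; sym; trans; cong; cong₂; subst; subst₂; module ≡-Reasoning)
open import Relation.Nullary using (¬_; Dec; yes; no; contradiction)

-- A column of the right key is given only through some skew tableau that displays it. Membership in
-- 𝒟_λ(π) is therefore treated from two sides: every such witness bounds T_j from above, and one
-- witness is built explicitly.
--
-- Counts replace entries because they ignore the order of a word, compare columns of different
-- lengths, and admit a slope argument: for a duplicate-free list, `cnt v` grows by at most one per
-- step of v, and by exactly one per step across an interval contained in the list. An inequality
-- known at the right end of a filled interval therefore descends to the whole interval. This
-- carries the passage from row bounds to column bounds, the stability of a bound under exchanges,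
-- and the inversion of Ψ_λ by Π_λ.
--
-- That no rectification spreads the column lengths is read off from the sum of their squares: a
-- rectification never lowers it, and keeps it only if the two lengths are merely exchanged. The
-- lengths at the beginning and at the end agree up to order, so the sum is constant throughout.

Inc Decr : List ℕ → Set
Inc = AllPairs _<_
Decr = AllPairs _>_

-- Counting the entries of a list up to a bound

ind : ℕ → ℕ → ℕ
ind x v with x ≤? v
... | yes _ = 1
... | no _ = 0

ind-≤ : ∀ {x v} → x ≤ v → ind x v ≡ 1
ind-≤ {x} {v} p with x ≤? v
... | yes _ = refl
... | no q = contradiction p q

ind-> : ∀ {x v} → v < x → ind x v ≡ 0
ind-> {x} {v} p with x ≤? v
... | yes q = contradiction p (≤⇒≯ q)
... | no _ = refl

ind≤1 : ∀ x v → ind x v ≤ 1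
ind≤1 x v with x ≤? v
... | yes _ = ≤-refl
... | no _ = z≤n

ind-anti : ∀ {x y} v → x ≤ y → ind y v ≤ ind x v
ind-anti {x} {y} v p with y ≤? v
... | yes q = ≤-reflexive (sym (ind-≤ (≤-trans p q)))
... | no _ = z≤n

cnt : ℕ → List ℕ → ℕ
cnt v [] = 0
cnt v (x ∷ xs) = ind x v + cnt v xs

cnt-++ : ∀ v xs ys → cnt v (xs ++ ys) ≡ cnt v xs + cnt v ys
cnt-++ v [] ys = refl
cnt-++ v (x ∷ xs) ys = trans (cong (ind x v +_) (cnt-++ v xs ys)) (sym (+-assoc (ind x v) _ _))

cnt-↭ : ∀ v {xs ys} → xs ↭ ys → cnt v xs ≡ cnt v ys
cnt-↭ v Perm.refl = refl
cnt-↭ v (prep x p) = cong (ind x v +_) (cnt-↭ v p)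
cnt-↭ v (swap x y p) rewrite cnt-↭ v p = lem (ind x v) (ind y v) _
  where lem : ∀ a b c → a + (b + c) ≡ b + (a + c)
        lem = solve-∀
cnt-↭ v (Perm.trans p q) = trans (cnt-↭ v p) (cnt-↭ v q)

cnt-none : ∀ v {xs} → All (v <_) xs → cnt v xs ≡ 0
cnt-none v [] = refl
cnt-none v (p ∷ ps) = cong₂ _+_ (ind-> p) (cnt-none v ps)

cnt-all : ∀ v {xs} → All (_≤ v) xs → cnt v xs ≡ length xs
cnt-all v [] = refl
cnt-all v (p ∷ ps) = cong₂ _+_ (ind-≤ p) (cnt-all v ps)

cnt≤length : ∀ v xs → cnt v xs ≤ length xs
cnt≤length v [] = z≤n
cnt≤length v (x ∷ xs) = +-mono-≤ (ind≤1 x v) (cnt≤length v xs)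

ind-mono : ∀ x {u v} → u ≤ v → ind x u ≤ ind x v
ind-mono x {u} {v} p with x ≤? u
... | yes q = ≤-reflexive (sym (ind-≤ (≤-trans q p)))
... | no _ = z≤n

cnt-mono : ∀ xs {u v} → u ≤ v → cnt u xs ≤ cnt v xs
cnt-mono [] p = z≤n
cnt-mono (x ∷ xs) p = +-mono-≤ (ind-mono x p) (cnt-mono xs p)

cnt-jump : ∀ {w xs} → suc w ∈ xs → suc (cnt w xs) ≤ cnt (suc w) xs
cnt-jump {w} {x ∷ xs} (here refl) rewrite ind-≤ (≤-refl {suc w}) | ind-> (n<1+n w) = s≤s (cnt-mono xs (n≤1+n w))
cnt-jump {w} {x ∷ xs} (there p) = ≤-trans (≤-reflexive (sym (+-suc (ind x w) _)))
  (+-mono-≤ (ind-mono x (n≤1+n w)) (cnt-jump p))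

cnt-pos : ∀ {x v xs} → x ∈ xs → x ≤ v → 1 ≤ cnt v xs
cnt-pos {x} {v} {y ∷ xs} (here refl) q rewrite ind-≤ q = s≤s z≤n
cnt-pos {x} {v} {y ∷ xs} (there p) q = ≤-trans (cnt-pos p q) (m≤n+m _ (ind y v))

cnt-interval : ∀ {u v xs} → u ≤ v → (∀ w → u < w → w ≤ v → w ∈ xs) → cnt u xs + (v ∸ u) ≤ cnt v xs
cnt-interval {u} {v} {xs} u≤v f = subst (λ z → cnt u xs + (v ∸ u) ≤ cnt z xs) (m+[n∸m]≡n u≤v)
    (go (v ∸ u) (λ w p q → f w p (≤-trans q (≤-reflexive (m+[n∸m]≡n u≤v)))))
  where
  go : ∀ k → (∀ w → u < w → w ≤ u + k → w ∈ xs) → cnt u xs + k ≤ cnt (u + k) xs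
  go zero f rewrite +-identityʳ u | +-identityʳ (cnt u xs) = ≤-refl
  go (suc k) f rewrite +-suc u k | +-suc (cnt u xs) k =
    ≤-trans (s≤s (go k (λ w p q → f w p (m≤n⇒m≤1+n q)))) (cnt-jump (f _ (s≤s (m≤m+n u k)) ≤-refl))

cnt-Lip : ∀ {xs} → AllPairs _≢_ xs → ∀ {u v} → u ≤ v → cnt v xs ≤ cnt u xs + (v ∸ u)
cnt-Lip {xs} un {u} {v} u≤v = subst (λ z → cnt z xs ≤ cnt u xs + (v ∸ u)) (m+[n∸m]≡n u≤v) (go (v ∸ u))
  where
  ind-≢ : ∀ {x w} → suc w ≢ x → ind x (suc w) ≡ ind x w
  ind-≢ {x} {w} ne with x ≤? w
  ... | yes p = ind-≤ (m≤n⇒m≤1+n p)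
  ... | no p = ind-> (≤∧≢⇒< (≰⇒> p) ne)
  none : ∀ {w ys} → All (suc w ≢_) ys → cnt (suc w) ys ≡ cnt w ys
  none [] = refl
  none (p ∷ ps) = cong₂ _+_ (ind-≢ p) (none ps)
  one : ∀ w {ys} → AllPairs _≢_ ys → cnt (suc w) ys ≤ suc (cnt w ys)
  one w [] = z≤n
  one w {y ∷ ys} (p ∷ ps) with y ≟ suc w
  ... | yes refl rewrite none p = +-mono-≤ (ind≤1 (suc w) (suc w)) (m≤n+m (cnt w ys) (ind (suc w) w))
  ... | no ne rewrite ind-≢ (ne ∘ sym) = ≤-trans (+-monoʳ-≤ (ind y w) (one w ps)) (≤-reflexive (+-suc (ind y w) _))
  go : ∀ k → cnt (u + k) xs ≤ cnt u xs + k
  go zero rewrite +-identityʳ u | +-identityʳ (cnt u xs) = ≤-refl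
  go (suc k) rewrite +-suc u k | +-suc (cnt u xs) k = ≤-trans (one (u + k) un) (s≤s (go k))

Inc⇒Unique : ∀ {xs} → Inc xs → AllPairs _≢_ xs
Inc⇒Unique = AllPairs.map <⇒≢

Decr⇒Unique : ∀ {xs} → Decr xs → AllPairs _≢_ xs
Decr⇒Unique = AllPairs.map >⇒≢

nth-∈ : ∀ xs i → 1 ≤ i → i ≤ length xs → nth xs i ∈ xs
nth-∈ (x ∷ xs) (suc zero) p q = here refl
nth-∈ (x ∷ xs) (suc (suc i)) p (s≤s q) = there (nth-∈ xs (suc i) (s≤s z≤n) q)

∈-nth : ∀ {x xs} → x ∈ xs → ∃ λ i → 1 ≤ i × i ≤ length xs × nth xs i ≡ x
∈-nth (here refl) = 1 , s≤s z≤n , s≤s z≤n , refl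
∈-nth (there p) with ∈-nth p
... | suc i , _ , q , e = suc (suc i) , s≤s z≤n , s≤s q , e

-- With `nth⇒cnt` this is the dictionary nth xs i ≤ v ⇔ i ≤ cnt v xs, for 1 ≤ i ≤ length xs, by
-- which entrywise bounds become inequalities of counts and conversely.
cnt⇒nth : ∀ {xs} → Inc xs → ∀ {i v} → 1 ≤ i → i ≤ cnt v xs → nth xs i ≤ v
cnt⇒nth [] {suc i} p ()
cnt⇒nth {x ∷ xs} (a ∷ as) {suc zero} {v} p q with x ≤? v
... | yes r = r
... | no r rewrite cnt-none v (All.map (<-trans (≰⇒> r)) a) = contradiction q λ ()
cnt⇒nth {x ∷ xs} (a ∷ as) {suc (suc i)} {v} p q = cnt⇒nth as (s≤s z≤n)
  (s≤s⁻¹ (≤-trans q (+-monoˡ-≤ (cnt v xs) (ind≤1 x v))))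

nth⇒cnt : ∀ {xs} → Inc xs → ∀ {i v} → 1 ≤ i → i ≤ length xs → nth xs i ≤ v → i ≤ cnt v xs
nth⇒cnt {x ∷ xs} (a ∷ as) {suc zero} p q r rewrite ind-≤ r = s≤s z≤n
nth⇒cnt {x ∷ xs} (a ∷ as) {suc (suc i)} p (s≤s q) r
  rewrite ind-≤ (≤-trans (<⇒≤ (All.lookup a (nth-∈ xs (suc i) (s≤s z≤n) q))) r) = s≤s (nth⇒cnt as (s≤s z≤n) q r)

cnt-nth : ∀ {xs} → Inc xs → ∀ {i} → 1 ≤ i → i ≤ length xs → cnt (nth xs i) xs ≡ i
cnt-nth {xs} inc {i} p q = ≤-antisym (≮⇒≥ λ i<c → lem (<-≤-trans i<c (cnt≤length _ xs)) i<c) (nth⇒cnt inc p q ≤-refl)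
  where
  mono : ∀ {ys} → Inc ys → ∀ j → 1 ≤ j → j < length ys → nth ys j < nth ys (suc j)
  mono {y ∷ ys} (a ∷ as) (suc zero) p (s≤s q) = All.lookup a (nth-∈ ys 1 (s≤s z≤n) q)
  mono {y ∷ ys} (a ∷ as) (suc (suc j)) p (s≤s q) = mono as (suc j) (s≤s z≤n) q
  lem : i < length xs → i < cnt (nth xs i) xs → ⊥
  lem i<l i<c = <⇒≱ (mono inc i p i<l) (cnt⇒nth inc (s≤s z≤n) i<c)

nth-mono : ∀ {xs} → Inc xs → ∀ {i j} → 1 ≤ i → i < j → j ≤ length xs → nth xs i < nth xs j
nth-mono {xs} inc {i} {j} p q r = ≰⇒> λ le → <⇒≱ q (≤-trans (nth⇒cnt inc (≤-trans p (<⇒≤ q)) r le)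
  (≤-reflexive (cnt-nth inc p (≤-trans (<⇒≤ q) r))))

nth-cnt : ∀ {xs x} → Inc xs → x ∈ xs → nth xs (cnt x xs) ≡ x
nth-cnt {xs} inc x∈ with ∈-nth x∈
... | i , p , q , refl = cong (nth xs) (cnt-nth inc p q)

nth-++ˡ : ∀ xs ys i → i ≤ length xs → nth (xs ++ ys) i ≡ nth xs i
nth-++ˡ [] [] i z≤n = refl
nth-++ˡ [] (y ∷ ys) .0 z≤n = refl
nth-++ˡ (x ∷ xs) ys zero p = refl
nth-++ˡ (x ∷ xs) ys (suc zero) p = refl
nth-++ˡ (x ∷ xs) ys (suc (suc i)) (s≤s p) = nth-++ˡ xs ys (suc i) p

nth-++ʳ : ∀ xs ys i → 1 ≤ i → nth (xs ++ ys) (length xs + i) ≡ nth ys i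
nth-++ʳ [] ys i p = refl
nth-++ʳ (x ∷ []) ys (suc i) p = refl
nth-++ʳ (x ∷ x' ∷ xs) ys i p = nth-++ʳ (x' ∷ xs) ys i p

nth-∷ʳ : ∀ xs x → nth (xs ++ [ x ]) (suc (length xs)) ≡ x
nth-∷ʳ xs x = trans (cong (nth (xs ++ [ x ])) (+-comm 1 (length xs))) (nth-++ʳ xs [ x ] 1 (s≤s z≤n))

nth-reverse : ∀ xs i k → 1 ≤ i → i + k ≡ suc (length xs) → 1 ≤ k → nth (reverse xs) k ≡ nth xs i
nth-reverse [] (suc zero) (suc k) p () k≥1
nth-reverse (x ∷ xs) (suc zero) k p e k≥1 with suc-injective e
... | refl rewrite unfold-reverse x xs | sym (length-reverse xs) = nth-∷ʳ (reverse xs) x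
nth-reverse (x ∷ xs) (suc (suc i)) k p e k≥1 rewrite unfold-reverse x xs =
  trans (nth-++ˡ (reverse xs) [ x ] k
      (≤-trans (≤-trans (m≤n+m k i) (≤-reflexive (suc-injective (suc-injective e)))) (≤-reflexive (sym (length-reverse xs)))))
    (nth-reverse xs (suc i) k (s≤s z≤n) (suc-injective e) k≥1)

length-range : ∀ m → length (range m) ≡ m
length-range zero = refl
length-range (suc m) = trans (length-++ (range m)) (trans (+-comm _ 1) (cong suc (length-range m)))

∈-range⁺ : ∀ {v m} → 1 ≤ v → v ≤ m → v ∈ range m
∈-range⁺ {suc v} {suc m} p q with v ≟ m
... | yes refl = ∈-++⁺ʳ (range m) (here refl)
... | no ne = ∈-++⁺ˡ (∈-range⁺ p (≤∧≢⇒< (s≤s⁻¹ q) ne))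
∈-range⁺ {suc v} {zero} p ()

∈-range⁻ : ∀ {v m} → v ∈ range m → 1 ≤ v × v ≤ m
∈-range⁻ {v} {suc m} p with ∈-++⁻ (range m) p
... | inj₁ q = proj₁ (∈-range⁻ {m = m} q) , m≤n⇒m≤1+n (proj₂ (∈-range⁻ {m = m} q))
... | inj₂ (here refl) = s≤s z≤n , ≤-refl

Inc-∷ʳ : ∀ {xs x} → Inc xs → (∀ {y} → y ∈ xs → y < x) → Inc (xs ++ [ x ])
Inc-∷ʳ inc f = AllPairs.++⁺ inc ([] ∷ []) (All.tabulate (λ y∈ → f y∈ ∷ []))

Inc-range : ∀ m → Inc (range m)
Inc-range zero = []
Inc-range (suc m) = Inc-∷ʳ (Inc-range m) (λ y∈ → s≤s (proj₂ (∈-range⁻ {m = m} y∈)))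

nth-range : ∀ m i → 1 ≤ i → i ≤ m → nth (range m) i ≡ i
nth-range zero (suc i) p ()
nth-range (suc m) i p q with i ≟ suc m
... | yes refl = trans (cong (λ k → nth (range m ++ [ suc m ]) (suc k)) (sym (length-range m))) (nth-∷ʳ (range m) (suc m))
... | no ne = let le = s≤s⁻¹ (≤∧≢⇒< q ne) in
  trans (nth-++ˡ (range m) _ i (subst (i ≤_) (sym (length-range m)) le)) (nth-range m i p le)

nth-map : ∀ (f : ℕ → ℕ) xs i → 1 ≤ i → i ≤ length xs → nth (map f xs) i ≡ f (nth xs i)
nth-map f (x ∷ xs) (suc zero) p q = refl
nth-map f (x ∷ xs) (suc (suc i)) p (s≤s q) = nth-map f xs (suc i) (s≤s z≤n) q

nth-map-range : ∀ (f : ℕ → ℕ) m i → 1 ≤ i → i ≤ m → nth (map f (range m)) i ≡ f i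
nth-map-range f m i p q = trans (nth-map f (range m) i p (subst (i ≤_) (sym (length-range m)) q)) (cong f (nth-range m i p q))

length-map-range : ∀ (f : ℕ → ℕ) m → length (map f (range m)) ≡ m
length-map-range f m = trans (length-map f (range m)) (length-range m)

map-range-suc : ∀ {A : Set} (f : ℕ → A) m → map f (range (suc m)) ≡ map f (range m) ++ [ f (suc m) ]
map-range-suc f m = map-++ f (range m) [ suc m ]

Inc-map-range : ∀ (f : ℕ → ℕ) m → (∀ i → 1 ≤ i → i < m → f i < f (suc i)) → Inc (map f (range m))
Inc-map-range f zero h = []
Inc-map-range f (suc m) h rewrite map-range-suc f m = Inc-∷ʳ (Inc-map-range f m (λ i p q → h i p (m≤n⇒m≤1+n q))) lt
  where
  mono : ∀ k i → 1 ≤ i → i + suc k ≤ suc m → f i < f (i + suc k)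
  mono zero i p q rewrite +-comm i 1 = h i p q
  mono (suc k) i p q = <-≤-trans
    (h i p (≤-trans (s≤s (m≤m+n i k)) (≤-trans (≤-reflexive (sym (+-suc i k))) (≤-trans (+-monoʳ-≤ i (n≤1+n _)) q))))
    (<⇒≤ (subst (λ z → f (suc i) < f z) (sym (+-suc i (suc k))) (mono k (suc i) (s≤s z≤n) (≤-trans (≤-reflexive (sym (+-suc i (suc k)))) q))))
  lt : ∀ {y} → y ∈ map f (range m) → y < f (suc m)
  lt y∈ with ∈-map⁻ f y∈
  ... | i , i∈ , refl with ∈-range⁻ {m = m} i∈
  ... | p , q = subst (λ z → f i < f z) (trans (+-suc i (m ∸ i)) (cong suc (m+[n∸m]≡n q)))
        (mono (m ∸ i) i p (≤-reflexive (trans (+-suc i (m ∸ i)) (cong suc (m+[n∸m]≡n q)))))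

AllPairs-reverse : ∀ {R : ℕ → ℕ → Set} {xs} → AllPairs R xs → AllPairs (λ x y → R y x) (reverse xs)
AllPairs-reverse [] = []
AllPairs-reverse {R} {x ∷ xs} (a ∷ as) rewrite unfold-reverse x xs =
  AllPairs.++⁺ (AllPairs-reverse as) ([] ∷ []) (All.tabulate λ y∈ → All.lookup a (∈-resp-↭ (↭-reverse xs) y∈) ∷ [])

cnt-reverse : ∀ v xs → cnt v (reverse xs) ≡ cnt v xs
cnt-reverse v xs = cnt-↭ v (↭-reverse xs)

-- Knuth equivalence as a congruence that preserves content

≡⇒≈K : ∀ {u v} → u ≡ v → u ≈K v
≡⇒≈K refl = krefl

≈K-∷ : ∀ a {u v} → u ≈K v → (a ∷ u) ≈K (a ∷ v)
≈K-∷ a krefl = krefl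
≈K-∷ a (ksym p) = ksym (≈K-∷ a p)
≈K-∷ a (ktrans p q) = ktrans (≈K-∷ a p) (≈K-∷ a q)
≈K-∷ a (kK1 u v x y z p q) = kK1 (a ∷ u) v x y z p q
≈K-∷ a (kK2 u v x y z p q) = kK2 (a ∷ u) v x y z p q

≈K-++ˡ : ∀ w {u v} → u ≈K v → (w ++ u) ≈K (w ++ v)
≈K-++ˡ [] p = p
≈K-++ˡ (a ∷ w) p = ≈K-∷ a (≈K-++ˡ w p)

≈K-++ʳ : ∀ w {u v} → u ≈K v → (u ++ w) ≈K (v ++ w)
≈K-++ʳ w krefl = krefl
≈K-++ʳ w (ksym p) = ksym (≈K-++ʳ w p)
≈K-++ʳ w (ktrans p q) = ktrans (≈K-++ʳ w p) (≈K-++ʳ w q)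
≈K-++ʳ w (kK1 u v x y z p q) rewrite ++-assoc u (x ∷ z ∷ y ∷ v) w | ++-assoc u (z ∷ x ∷ y ∷ v) w = kK1 u (v ++ w) x y z p q
≈K-++ʳ w (kK2 u v x y z p q) rewrite ++-assoc u (y ∷ x ∷ z ∷ v) w | ++-assoc u (y ∷ z ∷ x ∷ v) w = kK2 u (v ++ w) x y z p q

≈K⇒↭ : ∀ {u v} → u ≈K v → u ↭ v
≈K⇒↭ krefl = ↭-refl
≈K⇒↭ (ksym p) = ↭-sym (≈K⇒↭ p)
≈K⇒↭ (ktrans p q) = ↭-trans (≈K⇒↭ p) (≈K⇒↭ q)
≈K⇒↭ (kK1 u v x y z p q) = ++⁺ˡ u (swap x z ↭-refl)
≈K⇒↭ (kK2 u v x y z p q) = ++⁺ˡ u (prep y (swap x z ↭-refl))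

-- Row insertion

rowIns : ℕ → List ℕ → List ℕ
rowIns x [] = [ x ]
rowIns x (a ∷ r) with x <? a
... | yes _ = x ∷ r
... | no _ = a ∷ rowIns x r

bumped : ℕ → List ℕ → List ℕ
bumped x [] = []
bumped x (a ∷ r) with x <? a
... | yes _ = [ a ]
... | no _ = bumped x r

-- Only the first row of the insertion tableau is computed; `bumpedW` collects the letters it
-- expels, which form the word to be inserted into the rows below.
rowInsW : List ℕ → List ℕ → List ℕ
rowInsW r [] = r
rowInsW r (x ∷ w) = rowInsW (rowIns x r) w

bumpedW : List ℕ → List ℕ → List ℕ
bumpedW r [] = []
bumpedW r (x ∷ w) = bumped x r ++ bumpedW (rowIns x r) w

rowIns-< : ∀ {x a} r → x < a → rowIns x (a ∷ r) ≡ x ∷ r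
rowIns-< {x} {a} r p with x <? a
... | yes _ = refl
... | no q = contradiction p q

rowIns-≥ : ∀ {x a} r → a ≤ x → rowIns x (a ∷ r) ≡ a ∷ rowIns x r
rowIns-≥ {x} {a} r p with x <? a
... | yes q = contradiction p (<⇒≱ q)
... | no _ = refl

bumped-< : ∀ {x a} r → x < a → bumped x (a ∷ r) ≡ [ a ]
bumped-< {x} {a} r p with x <? a
... | yes _ = refl
... | no q = contradiction p q

bumped-≥ : ∀ {x a} r → a ≤ x → bumped x (a ∷ r) ≡ bumped x r
bumped-≥ {x} {a} r p with x <? a
... | yes q = contradiction p (<⇒≱ q)
... | no _ = refl

rowInsW-pass : ∀ {a} r {w} → All (a ≤_) w → rowInsW (a ∷ r) w ≡ a ∷ rowInsW r w
rowInsW-pass r [] = refl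
rowInsW-pass r {x ∷ w} (p ∷ ps) rewrite rowIns-≥ r p = rowInsW-pass (rowIns x r) ps

bumpedW-pass : ∀ {a} r {w} → All (a ≤_) w → bumpedW (a ∷ r) w ≡ bumpedW r w
bumpedW-pass r [] = refl
bumpedW-pass r {x ∷ w} (p ∷ ps) rewrite rowIns-≥ r p | bumped-≥ r p = cong (bumped x r ++_) (bumpedW-pass (rowIns x r) ps)

rowInsW-++ : ∀ r u w → rowInsW r (u ++ w) ≡ rowInsW (rowInsW r u) w
rowInsW-++ r [] w = refl
rowInsW-++ r (x ∷ u) w = rowInsW-++ (rowIns x r) u w

bumpedW-++ : ∀ r u w → bumpedW r (u ++ w) ≡ bumpedW r u ++ bumpedW (rowInsW r u) w
bumpedW-++ r [] w = refl
bumpedW-++ r (x ∷ u) w rewrite bumpedW-++ (rowIns x r) u w = sym (++-assoc (bumped x r) _ _)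

Row : List ℕ → Set
Row = AllPairs _≤_

All-rowIns : ∀ {P : ℕ → Set} x r → P x → All P r → All P (rowIns x r)
All-rowIns x [] px [] = px ∷ []
All-rowIns x (a ∷ r) px (pa ∷ pr) with x <? a
... | yes _ = px ∷ pr
... | no _ = pa ∷ All-rowIns x r px pr

Row-rowIns : ∀ x {r} → Row r → Row (rowIns x r)
Row-rowIns x [] = [] ∷ []
Row-rowIns x {a ∷ r} (p ∷ ps) with x <? a
... | yes q = All.map (≤-trans (<⇒≤ q)) p ∷ ps
... | no q = All-rowIns x r (≮⇒≥ q) p ∷ Row-rowIns x ps

Row-rowInsW : ∀ {r} w → Row r → Row (rowInsW r w)
Row-rowInsW [] s = s
Row-rowInsW (x ∷ w) s = Row-rowInsW w (Row-rowIns x s)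

bumped-> : ∀ {x p} r → bumped x r ≡ [ p ] → x < p
bumped-> {x} (a ∷ r) e with x <? a
... | yes q with refl ← e = q
... | no q = bumped-> r e

All-bumped : ∀ {P : ℕ → Set} {x p} r → All P r → bumped x r ≡ [ p ] → P p
All-bumped {x = x} (a ∷ r) (pa ∷ pr) e with x <? a
... | yes _ with refl ← e = pa
... | no _ = All-bumped r pr e

bumped-shape : ∀ x r → bumped x r ≡ [] ⊎ ∃ λ p → bumped x r ≡ [ p ]
bumped-shape x [] = inj₁ refl
bumped-shape x (a ∷ r) with x <? a
... | yes _ = inj₂ (a , refl)
... | no _ = bumped-shape x r

-- The letter y finds an entry larger than itself at the latest at the place now occupied by z, and
-- all entries up to that place are at most z < p.
bumped-smaller-after : ∀ {y z p a} r → All (a ≤_) r → a ≤ z → y < z → bumped z r ≡ [ p ] →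
  ∃ λ q → bumped y (rowIns z r) ≡ [ q ] × a ≤ q × q < p
bumped-smaller-after {y} {z} (b ∷ r) (ab ∷ as) az yz e with z <? b
... | yes zb with refl ← e = z , bumped-< r yz , az , zb
... | no zb with y <? b
...   | yes yb = b , refl , ab , ≤-<-trans (≮⇒≥ zb) (bumped-> r e)
...   | no _ = bumped-smaller-after r as az yz e

-- Since z ≥ y, it acts to the right of the place that y takes, so p is at least the entry expelled
-- by y in a weakly increasing row. Had y been appended at the end, z would be appended too and
-- would expel nothing.
bumped-before : ∀ {y z p} r → Row r → y ≤ z → bumped z (rowIns y r) ≡ [ p ] →
  ∃ λ q → bumped y r ≡ [ q ] × y < q × q ≤ p
bumped-before {y} {z} [] s yz e with z <? y
... | yes zy = contradiction yz (<⇒≱ zy)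
bumped-before {y} {z} {p} (b ∷ r) (bs ∷ s) yz e with y <? b
... | yes yb = b , refl , yb , All-bumped r bs (trans (sym (bumped-≥ r yz)) e)
... | no yb = bumped-before r s yz (trans (sym (bumped-≥ (rowIns y r) (≤-trans (≮⇒≥ yb) yz))) e)

-- Split by the head a. If a ≤ x, all three letters pass it. If x < a ≤ z, then x expels a in both
-- orders while z and y act on the tail, and the expelled words are related as in `kK1`. If z < a,
-- the kind of the relation changes.
Knuth1-row : ∀ {r} → Row r → ∀ {x y z} → x ≤ y → y < z →
  rowInsW r (x ∷ z ∷ y ∷ []) ≡ rowInsW r (z ∷ x ∷ y ∷ []) ×
  bumpedW r (x ∷ z ∷ y ∷ []) ≈K bumpedW r (z ∷ x ∷ y ∷ [])
Knuth1-row [] {x} {y} {z} xy yz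
  rewrite rowIns-≥ {z} {x} [] (<⇒≤ (≤-<-trans xy yz)) | rowIns-< {x} {z} [] (≤-<-trans xy yz)
        | rowIns-≥ {y} {x} [ z ] xy | rowIns-≥ {y} {x} [] xy | rowIns-< {y} {z} [] yz
        | bumped-≥ {z} {x} [] (<⇒≤ (≤-<-trans xy yz)) | bumped-< {x} {z} [] (≤-<-trans xy yz)
        | bumped-≥ {y} {x} [ z ] xy | bumped-< {y} {z} [] yz | bumped-≥ {y} {x} [] xy = refl , krefl
Knuth1-row {a ∷ r} (as ∷ s) {x} {y} {z} xy yz with x <? a
... | no xa rewrite rowInsW-pass {a} (rowIns x r) {z ∷ y ∷ []} (≤-trans (≮⇒≥ xa) (<⇒≤ (≤-<-trans xy yz)) ∷ ≤-trans (≮⇒≥ xa) xy ∷ [])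
     | bumpedW-pass {a} (rowIns x r) {z ∷ y ∷ []} (≤-trans (≮⇒≥ xa) (<⇒≤ (≤-<-trans xy yz)) ∷ ≤-trans (≮⇒≥ xa) xy ∷ [])
     | rowIns-≥ {z} {a} r (≤-trans (≮⇒≥ xa) (<⇒≤ (≤-<-trans xy yz))) | bumped-≥ {z} {a} r (≤-trans (≮⇒≥ xa) (<⇒≤ (≤-<-trans xy yz)))
     | rowInsW-pass {a} (rowIns z r) {x ∷ y ∷ []} (≮⇒≥ xa ∷ ≤-trans (≮⇒≥ xa) xy ∷ [])
     | bumpedW-pass {a} (rowIns z r) {x ∷ y ∷ []} (≮⇒≥ xa ∷ ≤-trans (≮⇒≥ xa) xy ∷ []) =
       cong (a ∷_) (proj₁ (Knuth1-row s xy yz)) , proj₂ (Knuth1-row s xy yz)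
... | yes xa with z <? a
Knuth1-row {a ∷ r} (as ∷ s) {x} {y} {z} xy yz | yes xa | no za
  rewrite rowIns-≥ {z} {x} r (<⇒≤ (≤-<-trans xy yz)) | bumped-≥ {z} {x} r (<⇒≤ (≤-<-trans xy yz))
        | rowIns-≥ {y} {x} (rowIns z r) xy | bumped-≥ {y} {x} (rowIns z r) xy
        | rowIns-< {x} {a} (rowIns z r) xa | bumped-< {x} {a} (rowIns z r) xa
        | rowIns-≥ {y} {x} (rowIns z r) xy | bumped-≥ {y} {x} (rowIns z r) xy
  = refl , lem (bumped-shape z r)
  where
  lem : bumped z r ≡ [] ⊎ (∃ λ p → bumped z r ≡ [ p ]) →
    (a ∷ bumped z r ++ bumped y (rowIns z r) ++ []) ≈K (bumped z r ++ a ∷ bumped y (rowIns z r) ++ [])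
  lem (inj₁ e) rewrite e = krefl
  lem (inj₂ (p , e)) with bumped-smaller-after r as (≮⇒≥ za) yz e
  ... | q , e' , aq , qp rewrite e | e' = kK1 [] [] a q p aq qp
Knuth1-row {a ∷ []} (as ∷ s) {x} {y} {z} xy yz | yes xa | yes za
  rewrite rowIns-< {x} {z} [] (≤-<-trans xy yz) | bumped-< {x} {z} [] (≤-<-trans xy yz)
        | rowIns-≥ {z} {x} [] (<⇒≤ (≤-<-trans xy yz)) | bumped-≥ {z} {x} [] (<⇒≤ (≤-<-trans xy yz))
        | rowIns-≥ {y} {x} [ z ] xy | bumped-≥ {y} {x} [ z ] xy
        | rowIns-≥ {y} {x} [] xy | bumped-≥ {y} {x} [] xy
        | rowIns-< {y} {z} [] yz | bumped-< {y} {z} [] yz = refl , krefl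
Knuth1-row {a ∷ b ∷ r} ((ab ∷ as) ∷ s) {x} {y} {z} xy yz | yes xa | yes za
  rewrite rowIns-< {x} {z} (b ∷ r) (≤-<-trans xy yz) | bumped-< {x} {z} (b ∷ r) (≤-<-trans xy yz)
        | rowIns-≥ {z} {x} (b ∷ r) (<⇒≤ (≤-<-trans xy yz)) | bumped-≥ {z} {x} (b ∷ r) (<⇒≤ (≤-<-trans xy yz))
        | rowIns-< {z} {b} r (<-≤-trans za ab) | bumped-< {z} {b} r (<-≤-trans za ab)
        | rowIns-≥ {y} {x} (z ∷ r) xy | bumped-≥ {y} {x} (z ∷ r) xy
        | rowIns-≥ {y} {x} (b ∷ r) xy | bumped-≥ {y} {x} (b ∷ r) xy
        | rowIns-< {y} {z} r yz | bumped-< {y} {z} r yz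
        | rowIns-< {y} {b} r (<-trans yz (<-≤-trans za ab)) | bumped-< {y} {b} r (<-trans yz (<-≤-trans za ab))
  -- The two orders expel a b z and a z b. As z < a ≤ b, these words are related by `kK2`.
  = refl , ksym (kK2 [] [] z a b za ab)

Knuth2-row : ∀ {r} → Row r → ∀ {x y z} → x < y → y ≤ z →
  rowInsW r (y ∷ x ∷ z ∷ []) ≡ rowInsW r (y ∷ z ∷ x ∷ []) ×
  bumpedW r (y ∷ x ∷ z ∷ []) ≈K bumpedW r (y ∷ z ∷ x ∷ [])
Knuth2-row [] {x} {y} {z} xy yz
  rewrite rowIns-< {x} {y} [] xy | bumped-< {x} {y} [] xy
        | rowIns-≥ {z} {x} [] (<⇒≤ (<-≤-trans xy yz)) | bumped-≥ {z} {x} [] (<⇒≤ (<-≤-trans xy yz))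
        | rowIns-≥ {z} {y} [] yz | bumped-≥ {z} {y} [] yz
        | rowIns-< {x} {y} [ z ] xy | bumped-< {x} {y} [ z ] xy = refl , krefl
Knuth2-row {a ∷ r} (as ∷ s) {x} {y} {z} xy yz with x <? a
... | no xa rewrite rowIns-≥ {y} {a} r (≤-trans (≮⇒≥ xa) (<⇒≤ xy)) | bumped-≥ {y} {a} r (≤-trans (≮⇒≥ xa) (<⇒≤ xy))
     | rowInsW-pass {a} (rowIns y r) {x ∷ z ∷ []} (≮⇒≥ xa ∷ ≤-trans (≮⇒≥ xa) (<⇒≤ (<-≤-trans xy yz)) ∷ [])
     | bumpedW-pass {a} (rowIns y r) {x ∷ z ∷ []} (≮⇒≥ xa ∷ ≤-trans (≮⇒≥ xa) (<⇒≤ (<-≤-trans xy yz)) ∷ [])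
     | rowInsW-pass {a} (rowIns y r) {z ∷ x ∷ []} (≤-trans (≮⇒≥ xa) (<⇒≤ (<-≤-trans xy yz)) ∷ ≮⇒≥ xa ∷ [])
     | bumpedW-pass {a} (rowIns y r) {z ∷ x ∷ []} (≤-trans (≮⇒≥ xa) (<⇒≤ (<-≤-trans xy yz)) ∷ ≮⇒≥ xa ∷ []) =
       cong (a ∷_) (proj₁ (Knuth2-row s xy yz)) , proj₂ (Knuth2-row s xy yz)
... | yes xa with y <? a
Knuth2-row {a ∷ r} (as ∷ s) {x} {y} {z} xy yz | yes xa | yes ya
  rewrite rowIns-< {x} {y} r xy | bumped-< {x} {y} r xy
        | rowIns-≥ {z} {x} r (<⇒≤ (<-≤-trans xy yz)) | bumped-≥ {z} {x} r (<⇒≤ (<-≤-trans xy yz))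
        | rowIns-≥ {z} {y} r yz | bumped-≥ {z} {y} r yz
        | rowIns-< {x} {y} (rowIns z r) xy | bumped-< {x} {y} (rowIns z r) xy
  = refl , lem (bumped-shape z r)
  where
  lem : bumped z r ≡ [] ⊎ (∃ λ p → bumped z r ≡ [ p ]) →
    (a ∷ y ∷ bumped z r ++ []) ≈K (a ∷ bumped z r ++ y ∷ [])
  lem (inj₁ e) rewrite e = krefl
  lem (inj₂ (p , e)) rewrite e = kK2 [] [] y a p ya (All-bumped r as e)
Knuth2-row {a ∷ r} (as ∷ s) {x} {y} {z} xy yz | yes xa | no ya
  rewrite rowIns-< {x} {a} (rowIns y r) xa | bumped-< {x} {a} (rowIns y r) xa
        | rowIns-≥ {z} {x} (rowIns y r) (<⇒≤ (<-≤-trans xy yz)) | bumped-≥ {z} {x} (rowIns y r) (<⇒≤ (<-≤-trans xy yz))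
        | rowIns-≥ {z} {a} (rowIns y r) (≤-trans (≮⇒≥ ya) yz) | bumped-≥ {z} {a} (rowIns y r) (≤-trans (≮⇒≥ ya) yz)
        | rowIns-< {x} {a} (rowIns z (rowIns y r)) xa | bumped-< {x} {a} (rowIns z (rowIns y r)) xa
  = refl , lem (bumped-shape z (rowIns y r))
  where
  lem : bumped z (rowIns y r) ≡ [] ⊎ (∃ λ p → bumped z (rowIns y r) ≡ [ p ]) →
    (bumped y r ++ a ∷ bumped z (rowIns y r) ++ []) ≈K (bumped y r ++ bumped z (rowIns y r) ++ a ∷ [])
  lem (inj₁ e) rewrite e = krefl
  lem (inj₂ (p , e)) with bumped-before r s yz e
  ... | q , e' , yq , qp rewrite e | e' = kK2 [] [] a q p (≤-<-trans (≮⇒≥ ya) yq) qp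

-- Invariance of the insertion tableau in the form suited to an induction on rows: the first row
-- agrees, and the words handed to the rows below remain equivalent. The local relations act on the
-- row reached after the common prefix, which must be weakly increasing.
Knuth-row : ∀ {u v} → u ≈K v → ∀ {r} → Row r →
  rowInsW r u ≡ rowInsW r v × bumpedW r u ≈K bumpedW r v
Knuth-row krefl s = refl , krefl
Knuth-row (ksym p) s = sym (proj₁ (Knuth-row p s)) , ksym (proj₂ (Knuth-row p s))
Knuth-row (ktrans p q) s = trans (proj₁ (Knuth-row p s)) (proj₁ (Knuth-row q s)) ,
  ktrans (proj₂ (Knuth-row p s)) (proj₂ (Knuth-row q s))
Knuth-row (kK1 u v x y z p q) {r} s
  rewrite rowInsW-++ r u (x ∷ z ∷ y ∷ v) | rowInsW-++ r u (z ∷ x ∷ y ∷ v)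
        | bumpedW-++ r u (x ∷ z ∷ y ∷ v) | bumpedW-++ r u (z ∷ x ∷ y ∷ v)
        | bumpedW-++ (rowInsW r u) (x ∷ z ∷ y ∷ []) v | bumpedW-++ (rowInsW r u) (z ∷ x ∷ y ∷ []) v
  with Knuth1-row (Row-rowInsW u s) p q
... | e , k rewrite e = refl , ≈K-++ˡ (bumpedW r u) (≈K-++ʳ _ k)
Knuth-row (kK2 u v x y z p q) {r} s
  rewrite rowInsW-++ r u (y ∷ x ∷ z ∷ v) | rowInsW-++ r u (y ∷ z ∷ x ∷ v)
        | bumpedW-++ r u (y ∷ x ∷ z ∷ v) | bumpedW-++ r u (y ∷ z ∷ x ∷ v)
        | bumpedW-++ (rowInsW r u) (y ∷ x ∷ z ∷ []) v | bumpedW-++ (rowInsW r u) (y ∷ z ∷ x ∷ []) v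
  with Knuth2-row (Row-rowInsW u s) p q
... | e , k rewrite e = refl , ≈K-++ˡ (bumpedW r u) (≈K-++ʳ _ k)

-- For increasing columns with |A| ≥ |B| this says that A is entrywise at most B.
record _≼_ (A B : List ℕ) : Set where
  constructor ≼-intro
  field ≼-cnt : ∀ v → cnt v B ≤ cnt v A
open _≼_ public

≼-trans : ∀ {A B C} → A ≼ B → B ≼ C → A ≼ C
≼-trans p q = ≼-intro λ v → ≤-trans (≼-cnt q v) (≼-cnt p v)

upperBound : ∀ xs → ∃ λ v → All (_≤ v) xs
upperBound [] = 0 , []
upperBound (x ∷ xs) with upperBound xs
... | v , ps = x ⊔ v , m≤m⊔n x v ∷ All.map (λ p → ≤-trans p (m≤n⊔m x v)) ps

≼-length : ∀ {A B} → A ≼ B → length B ≤ length A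
≼-length {A} {B} p with upperBound B
... | v , ps = subst (_≤ length A) (cnt-all v ps) (≤-trans (≼-cnt p v) (cnt≤length v A))

[]≼ : ∀ {B} → [] ≼ B → B ≡ []
[]≼ {[]} p = refl
[]≼ {x ∷ B} p = contradiction (≤-trans (cnt-pos {x} {x} {x ∷ B} (here refl) ≤-refl) (≼-cnt p x)) λ ()

-- Tableaux as lists of columns, and their uniqueness in a Knuth class

record Tableau (cs : List (List ℕ)) : Set where
  constructor tableau
  field
    columns : All Decr cs
    rows : AllPairs _≼_ cs

-- Columns are listed in the order of the column word, largest entry first. The last element, here
-- called `bottom`, is thus the smallest one and stands in the first row.
bottom : ℕ → List ℕ → ℕ
bottom a [] = a
bottom a (b ∷ A) = bottom b A

init : ℕ → List ℕ → List ℕ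
init a [] = []
init a (b ∷ A) = a ∷ init b A

firstRowEntry : List ℕ → List ℕ
firstRowEntry [] = []
firstRowEntry (a ∷ A) = [ bottom a A ]

belowFirstRow : List ℕ → List ℕ
belowFirstRow [] = []
belowFirstRow (a ∷ A) = init a A

init-bottom : ∀ a A → init a A ++ [ bottom a A ] ≡ a ∷ A
init-bottom a [] = refl
init-bottom a (b ∷ A) = cong (a ∷_) (init-bottom b A)

cnt-init : ∀ v a A → cnt v (a ∷ A) ≡ cnt v (init a A) + ind (bottom a A) v
cnt-init v a A = trans (cong (cnt v) (sym (init-bottom a A)))
  (trans (cnt-++ v (init a A) [ bottom a A ]) (cong (cnt v (init a A) +_) (+-identityʳ _)))

All-init : ∀ {P : ℕ → Set} {a A} → All P (a ∷ A) → All P (init a A)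
All-init {A = []} _ = []
All-init {A = b ∷ A} (p ∷ ps) = p ∷ All-init ps

Decr-init : ∀ {a A} → Decr (a ∷ A) → Decr (init a A)
Decr-init {A = []} _ = []
Decr-init {A = b ∷ A} (p ∷ ps) = All-init p ∷ Decr-init ps

bottom-∈ : ∀ a A → bottom a A ∈ a ∷ A
bottom-∈ a [] = here refl
bottom-∈ a (b ∷ A) = there (bottom-∈ b A)

bottom-min : ∀ {a A} → Decr (a ∷ A) → All (bottom a A ≤_) (a ∷ A)
bottom-min {A = []} _ = ≤-refl ∷ []
bottom-min {a} {b ∷ A} (p ∷ ps) = <⇒≤ (All.lookup p (bottom-∈ b A)) ∷ bottom-min ps

cnt-bottom : ∀ {v a A} → Decr (a ∷ A) → 1 ≤ cnt v (a ∷ A) → bottom a A ≤ v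
cnt-bottom {v} {a} {A} d p with bottom a A ≤? v
... | yes q = q
... | no q = contradiction (≤-trans p (≤-reflexive (cnt-none v (All.map (<-≤-trans (≰⇒> q)) (bottom-min d))))) λ ()

-- Once v reaches the minimum of d, removing the minima lowers the count of d by exactly one and
-- that of c by at most one; before that, nothing of d is counted.
belowFirstRow-≼ : ∀ {c d} → Decr c → Decr d → c ≼ d → belowFirstRow c ≼ belowFirstRow d
belowFirstRow-≼ {[]} {d} dc dd p rewrite []≼ p = ≼-intro λ v → z≤n
belowFirstRow-≼ {a ∷ A} {[]} dc dd p = ≼-intro λ v → z≤n
belowFirstRow-≼ {a ∷ A} {b ∷ B} dc dd p = ≼-intro le
  where
  open ≤-Reasoning
  le : ∀ v → cnt v (init b B) ≤ cnt v (init a A)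
  le v with bottom b B ≤? v
  ... | yes q = +-cancelʳ-≤ 1 _ _ (begin
        cnt v (init b B) + 1                  ≡⟨ cong (cnt v (init b B) +_) (ind-≤ q) ⟨
        cnt v (init b B) + ind (bottom b B) v ≡⟨ cnt-init v b B ⟨
        cnt v (b ∷ B)                         ≤⟨ ≼-cnt p v ⟩
        cnt v (a ∷ A)                         ≡⟨ cnt-init v a A ⟩
        cnt v (init a A) + ind (bottom a A) v ≤⟨ +-monoʳ-≤ _ (ind≤1 (bottom a A) v) ⟩
        cnt v (init a A) + 1 ∎)
  ... | no q rewrite cnt-none v (All-init (All.map (<-≤-trans (≰⇒> q)) (bottom-min dd))) = z≤n

Tableau-below : ∀ {cs} → Tableau cs → Tableau (map belowFirstRow cs)
Tableau-below (tableau [] []) = tableau [] []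
Tableau-below {c ∷ cs} (tableau (d ∷ ds) (p ∷ ps)) with Tableau-below (tableau ds ps)
... | tableau ds' ps' = tableau (decr c d ∷ ds') (below ds p ∷ ps')
  where
  decr : ∀ c → Decr c → Decr (belowFirstRow c)
  decr [] d = d
  decr (a ∷ A) d = Decr-init d
  below : ∀ {xs} → All Decr xs → All (c ≼_) xs → All (belowFirstRow c ≼_) (map belowFirstRow xs)
  below [] [] = []
  below (e ∷ es) (q ∷ qs) = belowFirstRow-≼ d e q ∷ below es qs

rowIns-end : ∀ {x} r → All (_≤ x) r → rowIns x r ≡ r ++ [ x ] × bumped x r ≡ []
rowIns-end [] [] = refl , refl
rowIns-end {x} (a ∷ r) (p ∷ ps) rewrite rowIns-≥ r p | bumped-≥ r p | proj₁ (rowIns-end r ps) = refl , proj₂ (rowIns-end r ps)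

rowIns-last : ∀ {x a} r → All (_≤ x) r → x < a → rowIns x (r ++ [ a ]) ≡ r ++ [ x ] × bumped x (r ++ [ a ]) ≡ [ a ]
rowIns-last [] [] q = rowIns-< [] q , bumped-< [] q
rowIns-last {x} {a} (b ∷ r) (p ∷ ps) q rewrite rowIns-≥ (r ++ [ a ]) p | bumped-≥ (r ++ [ a ]) p
  | proj₁ (rowIns-last r ps q) = refl , proj₂ (rowIns-last r ps q)

_≤*_ : List ℕ → List ℕ → Set
r ≤* w = All (λ x → All (_≤ x) r) w

-- The first, largest letter is appended to r, and each further letter expels its predecessor from
-- the end of the row. Only the smallest letter remains there.
rowInsW-column : ∀ {r c} → Decr c → r ≤* c →
  rowInsW r c ≡ r ++ firstRowEntry c × bumpedW r c ≡ belowFirstRow c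
rowInsW-column {r} {[]} d p = sym (++-identityʳ r) , refl
rowInsW-column {r} {a ∷ A} d (p ∷ ps) rewrite proj₁ (rowIns-end r p) | proj₂ (rowIns-end r p) = go d ps
  where
  go : ∀ {a A} → Decr (a ∷ A) → r ≤* A →
    rowInsW (r ++ [ a ]) A ≡ r ++ [ bottom a A ] × bumpedW (r ++ [ a ]) A ≡ init a A
  go {A = []} d [] = refl , refl
  go {a} {b ∷ A} ((ba ∷ _) ∷ d) (p ∷ ps) rewrite proj₁ (rowIns-last r p ba) | proj₂ (rowIns-last r p ba) =
    proj₁ (go d ps) , cong (a ∷_) (proj₂ (go d ps))

-- After a column has been inserted, the row ends with its minimum. By ≼ this is at most every entry
-- of the later columns, so each of them again acts only at the end of the row.
rowInsW-tableau : ∀ {r cs} → Tableau cs → All (r ≤*_) cs →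
  rowInsW r (concat cs) ≡ r ++ concat (map firstRowEntry cs) × bumpedW r (concat cs) ≡ concat (map belowFirstRow cs)
rowInsW-tableau {r} {[]} t p = sym (++-identityʳ r) , refl
rowInsW-tableau {r} {c ∷ cs} (tableau (d ∷ ds) (q ∷ qs)) (p ∷ ps)
  rewrite rowInsW-++ r c (concat cs) | bumpedW-++ r c (concat cs)
        | proj₁ (rowInsW-column d p) | proj₂ (rowInsW-column d p)
        | sym (++-assoc r (firstRowEntry c) (concat (map firstRowEntry cs))) =
    proj₁ rec , cong (belowFirstRow c ++_) (proj₂ rec)
  where
  entry : ∀ {c} → Decr c → ∀ {x e} → c ≼ e → x ∈ e → All (_≤ x) (firstRowEntry c)
  entry {[]} d q x∈ = []
  entry {a ∷ A} d {x} q x∈ = cnt-bottom d (≤-trans (cnt-pos x∈ ≤-refl) (≼-cnt q x)) ∷ []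
  bound : ∀ {e} → c ≼ e → r ≤* e → (r ++ firstRowEntry c) ≤* e
  bound q p = All.tabulate λ x∈ → All.++⁺ (All.lookup p x∈) (entry d q x∈)
  rec = rowInsW-tableau (tableau ds qs) (All.zipWith (λ (q , p) → bound q p) (q , ps))

all-empty : ∀ {cs} → AllPairs _≼_ ([] ∷ cs) → All (_≡ []) cs
all-empty (p ∷ _) = All.map []≼ p

firstRow-empty : ∀ {cs} → All (_≡ []) cs → concat (map firstRowEntry cs) ≡ []
firstRow-empty [] = refl
firstRow-empty (refl ∷ ps) = firstRow-empty ps

-- Columns that run empty stay in the list, so that the number of columns is constant. By ≼ the
-- empty ones come last; hence the first row shows how many columns are nonempty.
tableau-rebuild : ∀ {cs ds} → AllPairs _≼_ cs → AllPairs _≼_ ds → length cs ≡ length ds →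
  concat (map firstRowEntry cs) ≡ concat (map firstRowEntry ds) →
  map belowFirstRow cs ≡ map belowFirstRow ds → cs ≡ ds
tableau-rebuild {[]} {[]} p q l e e' = refl
tableau-rebuild {[] ∷ cs} {[] ∷ ds} (_ ∷ p) (_ ∷ q) l e e' =
  cong ([] ∷_) (tableau-rebuild p q (suc-injective l) e (proj₂ (∷-injective e')))
tableau-rebuild {[] ∷ cs} {(b ∷ B) ∷ ds} p q l e e' = contradiction (trans (sym (firstRow-empty (all-empty p))) e) λ ()
tableau-rebuild {(a ∷ A) ∷ cs} {[] ∷ ds} p q l e e' = contradiction (trans e (firstRow-empty (all-empty q))) λ ()
tableau-rebuild {(a ∷ A) ∷ cs} {(b ∷ B) ∷ ds} (_ ∷ p) (_ ∷ q) l e e' with ∷-injective e | ∷-injective e'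
... | e₁ , e₂ | f₁ , f₂ = cong₂ _∷_ (trans (sym (init-bottom a A)) (trans (cong₂ (λ x y → x ++ [ y ]) f₁ e₁) (init-bottom b B)))
      (tableau-rebuild p q (suc-injective l) e₂ f₂)

-- Induction on the height. By `Knuth-row`, started from the empty row, both words produce the same
-- first row and expel equivalent words, which are the column words of the two tableaux below the
-- first row.
tableau-unique : ∀ {cs ds} → Tableau cs → Tableau ds → length cs ≡ length ds → concat cs ≈K concat ds → cs ≡ ds
tableau-unique {cs} {ds} tc td l k =
  go _ tc td (All.map (λ p → ≤-trans p (m≤m+n _ _)) (bound cs)) (All.map (λ p → ≤-trans p (m≤n+m _ _)) (bound ds)) l k
  where
  bound : ∀ cs → All (λ c → length c ≤ length (concat cs)) cs
  bound [] = []
  bound (c ∷ cs) rewrite length-++ c {concat cs} = m≤m+n _ _ ∷ All.map (λ p → ≤-trans p (m≤n+m _ _)) (bound cs)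
  shorter : ∀ {h} cs → All (λ c → length c ≤ suc h) cs → All (λ c → length c ≤ h) (map belowFirstRow cs)
  shorter [] [] = []
  shorter ([] ∷ cs) (p ∷ ps) = z≤n ∷ shorter cs ps
  shorter ((a ∷ A) ∷ cs) (s≤s p ∷ ps) = ≤-trans (≤-reflexive (len a A)) p ∷ shorter cs ps
    where
    len : ∀ a A → length (init a A) ≡ length A
    len a [] = refl
    len a (b ∷ A) = cong suc (len b A)
  start : ∀ (cs : List (List ℕ)) → All ([] ≤*_) cs
  start cs = All.universal (All.universal λ _ → []) cs
  empties : ∀ {cs ds} → All (λ c → length c ≤ 0) cs → All (λ c → length c ≤ 0) ds → length cs ≡ length ds → cs ≡ ds
  empties [] [] l = refl
  empties {[] ∷ _} {[] ∷ _} (z≤n ∷ p) (z≤n ∷ q) l = cong ([] ∷_) (empties p q (suc-injective l))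
  go : ∀ h {cs ds} → Tableau cs → Tableau ds → All (λ c → length c ≤ h) cs → All (λ c → length c ≤ h) ds →
    length cs ≡ length ds → concat cs ≈K concat ds → cs ≡ ds
  go zero tc td p q l k = empties p q l
  go (suc h) {cs} {ds} tc td p q l k = tableau-rebuild (Tableau.rows tc) (Tableau.rows td) l
      (trans (sym (proj₁ rc)) (trans (proj₁ same) (proj₁ rd)))
      (go h (Tableau-below tc) (Tableau-below td) (shorter cs p) (shorter ds q)
        (trans (length-map belowFirstRow cs) (trans l (sym (length-map belowFirstRow ds))))
        (ktrans (≡⇒≈K (sym (proj₂ rc))) (ktrans (proj₂ same) (≡⇒≈K (proj₂ rd)))))
    where
    rc = rowInsW-tableau tc (start cs)
    rd = rowInsW-tableau td (start ds)
    same = Knuth-row k []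

-- Rectification of two columns (column insertion)

≈K-move-right : ∀ {y b B} → Decr (y ∷ B) → y ≤ b → (y ∷ b ∷ B) ≈K (y ∷ B ++ [ b ])
≈K-move-right {B = []} d p = krefl
≈K-move-right {y} {b} {c ∷ B} ((cy ∷ _) ∷ d) p =
  ktrans (ksym (kK2 [] B c y b cy p)) (≈K-∷ y (≈K-move-right d (≤-trans (<⇒≤ cy) p)))

-- Column insertion into a decreasing column b ∷ B when x ≤ b: the smallest entry that is at least x
-- gives way to x. That entry is `slotOut x b B`.
slotCol : ℕ → ℕ → List ℕ → List ℕ
slotCol x b [] = [ x ]
slotCol x b (c ∷ B) with x ≤? c
... | yes _ = b ∷ slotCol x c B
... | no _ = x ∷ c ∷ B

slotOut : ℕ → ℕ → List ℕ → ℕ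
slotOut x b [] = b
slotOut x b (c ∷ B) with x ≤? c
... | yes _ = slotOut x c B
... | no _ = b

slot-≈K : ∀ {x b} B → Decr (b ∷ B) → x ≤ b → (x ∷ b ∷ B) ≈K (slotCol x b B ++ [ slotOut x b B ])
slot-≈K [] d p = krefl
slot-≈K {x} {b} (c ∷ B) ((cb ∷ _) ∷ d@(cs ∷ _)) p with x ≤? c
... | yes q = ktrans (kK1 [] B x c b q cb) (≈K-∷ b (slot-≈K B d q))
... | no q = ≈K-move-right ((≰⇒> q ∷ All.map (λ r → <-trans r (≰⇒> q)) cs) ∷ d) p

slotOut-≥ : ∀ {x b} B → x ≤ b → x ≤ slotOut x b B
slotOut-≥ [] p = p
slotOut-≥ {x} (c ∷ B) p with x ≤? c
... | yes q = slotOut-≥ B q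
... | no q = p

slotOut-∈ : ∀ x b B → slotOut x b B ∈ b ∷ B
slotOut-∈ x b [] = here refl
slotOut-∈ x b (c ∷ B) with x ≤? c
... | yes q = there (slotOut-∈ x c B)
... | no q = here refl

slotCol-∈ : ∀ {x b z} B → z ∈ slotCol x b B → z ≡ x ⊎ z ∈ b ∷ B
slotCol-∈ [] (here e) = inj₁ e
slotCol-∈ {x} (c ∷ B) p with x ≤? c
slotCol-∈ (c ∷ B) (here e) | yes q = inj₂ (here e)
slotCol-∈ (c ∷ B) (there p) | yes q with slotCol-∈ B p
... | inj₁ e = inj₁ e
... | inj₂ r = inj₂ (there r)
slotCol-∈ (c ∷ B) (here e) | no q = inj₁ e
slotCol-∈ (c ∷ B) (there p) | no q = inj₂ (there p)

slotCol-≤ : ∀ {x b z} B → Decr (b ∷ B) → x ≤ b → z ∈ slotCol x b B → z ≤ b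
slotCol-≤ B (bs ∷ _) p z∈ with slotCol-∈ B z∈
... | inj₁ refl = p
... | inj₂ (here refl) = ≤-refl
... | inj₂ (there r) = <⇒≤ (All.lookup bs r)

slotCol-above : ∀ {x b z} B → Decr (b ∷ B) → x ≤ b → z ∈ slotCol x b B → x < z → z ∈ b ∷ B × slotOut x b B < z
slotCol-above [] d p (here refl) q = contradiction q (n≮n _)
slotCol-above {x} (c ∷ B) d p z∈ q with x ≤? c
slotCol-above (c ∷ B) ((cb ∷ bs) ∷ d) p (here refl) q | yes r = here refl , All.lookup (cb ∷ bs) (slotOut-∈ _ c B)
slotCol-above (c ∷ B) (_ ∷ d) p (there z∈) q | yes r with slotCol-above B d r z∈ q
... | z∈' , lt = there z∈' , lt
slotCol-above (c ∷ B) d p (here refl) q | no r = contradiction q (n≮n _)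
slotCol-above (c ∷ B) d p (there (here refl)) q | no r = contradiction (<⇒≤ q) r
slotCol-above (c ∷ B) (_ ∷ (cs ∷ _)) p (there (there z∈)) q | no r = contradiction (<⇒≤ (<-trans q (All.lookup cs z∈))) r

Decr-slotCol : ∀ {x b} B → Decr (b ∷ B) → x ≤ b → Decr (slotCol x b B)
Decr-slotCol [] d p = [] ∷ []
Decr-slotCol {x} (c ∷ B) ((cb ∷ bs) ∷ d@(cs ∷ _)) p with x ≤? c
... | yes q = All.tabulate (λ z∈ → ≤-<-trans (slotCol-≤ B d q z∈) cb) ∷ Decr-slotCol B d q
... | no q = (≰⇒> q ∷ All.map (λ r → <-trans r (≰⇒> q)) cs) ∷ d

slotCol-≼ : ∀ {x b} B → x ≤ b → ∀ v → cnt v (b ∷ B) ≤ cnt v (slotCol x b B)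
slotCol-≼ [] p v = +-monoˡ-≤ 0 (ind-anti v p)
slotCol-≼ {x} {b} (c ∷ B) p v with x ≤? c
... | yes q = +-monoʳ-≤ (ind b v) (slotCol-≼ B q v)
... | no q = +-monoˡ-≤ (cnt v (c ∷ B)) (ind-anti v p)

slotCol-⊆ : ∀ {x b P} B → All (_< x) P → Decr (b ∷ B) → x ≤ b → P ⊆ b ∷ B → x ∷ P ⊆ slotCol x b B
slotCol-⊆ [] (p ∷ _) d q (refl ∷ s) = contradiction p (≤⇒≯ q)
slotCol-⊆ [] ps d q (_ ∷ʳ []) = refl ∷ []
slotCol-⊆ (c ∷ B) (p ∷ _) d q (refl ∷ s) = contradiction p (≤⇒≯ q)
slotCol-⊆ {x} {b} (c ∷ B) ps (_ ∷ d) q (_ ∷ʳ s) with x ≤? c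
... | yes r = b ∷ʳ slotCol-⊆ B ps d r s
... | no r = refl ∷ s

colIns : ℕ → List ℕ → List ℕ
colIns x [] = [ x ]
colIns x (b ∷ B) with x ≤? b
... | yes _ = slotCol x b B
... | no _ = x ∷ b ∷ B

colBump : ℕ → List ℕ → List ℕ
colBump x [] = []
colBump x (b ∷ B) with x ≤? b
... | yes _ = [ slotOut x b B ]
... | no _ = []

colIns-≈K : ∀ x B → Decr B → (x ∷ B) ≈K (colIns x B ++ colBump x B)
colIns-≈K x [] d = krefl
colIns-≈K x (b ∷ B) d with x ≤? b
... | yes q = slot-≈K B d q
... | no q = ≡⇒≈K (sym (++-identityʳ _))

Decr-colIns : ∀ x B → Decr B → Decr (colIns x B)
Decr-colIns x [] d = [] ∷ []
Decr-colIns x (b ∷ B) d@(bs ∷ _) with x ≤? b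
... | yes q = Decr-slotCol B d q
... | no q = (≰⇒> q ∷ All.map (λ r → <-trans r (≰⇒> q)) bs) ∷ d

colIns-above : ∀ {x z} B → Decr B → z ∈ colIns x B → x < z → z ∈ B × All (_< z) (colBump x B)
colIns-above [] d (here refl) q = contradiction q (n≮n _)
colIns-above {x} (b ∷ B) d z∈ q with x ≤? b
... | yes r = proj₁ (slotCol-above B d r z∈ q) , proj₂ (slotCol-above B d r z∈ q) ∷ []
colIns-above (b ∷ B) d (here refl) q | no r = contradiction q (n≮n _)
colIns-above (b ∷ B) d (there z∈) q | no r = z∈ , []

colIns-≼ : ∀ x B v → cnt v B ≤ cnt v (colIns x B)
colIns-≼ x [] v = z≤n
colIns-≼ x (b ∷ B) v with x ≤? b
... | yes q = slotCol-≼ B q v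
... | no q = m≤n+m _ (ind x v)

colIns-⊆ : ∀ {x P} B → All (_< x) P → Decr B → P ⊆ B → x ∷ P ⊆ colIns x B
colIns-⊆ [] ps d [] = refl ∷ []
colIns-⊆ {x} (b ∷ B) ps d s with x ≤? b
... | yes q = slotCol-⊆ B ps d q s
... | no q = refl ∷ s

-- The letters of A are column-inserted into B from the end of A, that is smallest first; `rectʳ`
-- collects the expelled letters.
rectˡ rectʳ : List ℕ → List ℕ → List ℕ
rectˡ [] B = B
rectˡ (a ∷ A) B = colIns a (rectˡ A B)
rectʳ [] B = []
rectʳ (a ∷ A) B = colBump a (rectˡ A B) ++ rectʳ A B

Decr-rectˡ : ∀ A {B} → Decr B → Decr (rectˡ A B)
Decr-rectˡ [] d = d
Decr-rectˡ (a ∷ A) d = Decr-colIns a _ (Decr-rectˡ A d)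

rect-≈K : ∀ A {B} → Decr B → (A ++ B) ≈K (rectˡ A B ++ rectʳ A B)
rect-≈K [] d = ≡⇒≈K (sym (++-identityʳ _))
rect-≈K (a ∷ A) {B} d = ktrans (≈K-∷ a (rect-≈K A d))
  (ktrans (≈K-++ʳ (rectʳ A B) (colIns-≈K a (rectˡ A B) (Decr-rectˡ A d)))
    (≡⇒≈K (++-assoc (colIns a (rectˡ A B)) _ _)))

-- The next letter to be inserted is larger than a and expels an entry at least as large as itself.
-- By this lemma that entry exceeds everything expelled before, so `rectʳ` comes out decreasing.
rectʳ-above : ∀ {a A B} → Decr (a ∷ A) → Decr B → ∀ {z} → z ∈ rectˡ (a ∷ A) B → a < z → All (_< z) (rectʳ (a ∷ A) B)
rectʳ-above {a} {[]} {B} dA dB z∈ q rewrite ++-identityʳ (colBump a B) = proj₂ (colIns-above B dB z∈ q)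
rectʳ-above {a} {b ∷ A} {B} ((ba ∷ _) ∷ dA) dB z∈ q with colIns-above (rectˡ (b ∷ A) B) (Decr-rectˡ (b ∷ A) dB) z∈ q
... | z∈' , lt = All.++⁺ lt (rectʳ-above dA dB z∈' (<-trans ba q))

colBump-out : ∀ x B → All (λ y → x ≤ y × y ∈ B) (colBump x B)
colBump-out x [] = []
colBump-out x (b ∷ B) with x ≤? b
... | yes q = (slotOut-≥ B q , slotOut-∈ x b B) ∷ []
... | no q = []

Decr-colBump : ∀ x B → Decr (colBump x B)
Decr-colBump x [] = []
Decr-colBump x (b ∷ B) with x ≤? b
... | yes q = [] ∷ []
... | no q = []

Decr-rectʳ : ∀ A {B} → Decr A → Decr B → Decr (rectʳ A B)
Decr-rectʳ [] dA dB = []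
Decr-rectʳ (a ∷ []) {B} dA dB rewrite ++-identityʳ (colBump a B) = Decr-colBump a B
Decr-rectʳ (a ∷ b ∷ A) {B} ((ba ∷ _) ∷ dA) dB = AllPairs.++⁺ (Decr-colBump a (rectˡ (b ∷ A) B)) (Decr-rectʳ (b ∷ A) dA dB)
  (All.map (λ (p , y∈) → rectʳ-above dA dB y∈ (<-≤-trans ba p)) (colBump-out a (rectˡ (b ∷ A) B)))

cnt-colBump : ∀ x B v → cnt v (colBump x B) ≤ ind x v
cnt-colBump x [] v = z≤n
cnt-colBump x (b ∷ B) v with x ≤? b
... | yes q rewrite +-identityʳ (ind (slotOut x b B) v) = ind-anti v (slotOut-≥ B q)
... | no q = z≤n

rectʳ-≼ : ∀ A B → A ≼ rectʳ A B
rectʳ-≼ [] B = ≼-intro λ v → z≤n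
rectʳ-≼ (a ∷ A) B = ≼-intro λ v → ≤-trans (≤-reflexive (cnt-++ v (colBump a (rectˡ A B)) _))
  (+-mono-≤ (cnt-colBump a (rectˡ A B) v) (≼-cnt (rectʳ-≼ A B) v))

rectˡ-≼ʳ : ∀ A B → rectˡ A B ≼ B
rectˡ-≼ʳ [] B = ≼-intro λ v → ≤-refl
rectˡ-≼ʳ (a ∷ A) B = ≼-intro λ v → ≤-trans (≼-cnt (rectˡ-≼ʳ A B) v) (colIns-≼ a (rectˡ A B) v)

-- A letter once inserted stays, because the later letters are larger and expel only entries at
-- least as large as themselves.
rectˡ-⊇ : ∀ {A B} → Decr A → Decr B → A ⊆ rectˡ A B
rectˡ-⊇ [] dB = minimum _
rectˡ-⊇ {a ∷ A} {B} (as ∷ dA) dB = colIns-⊆ (rectˡ A B) as (Decr-rectˡ A dB) (rectˡ-⊇ dA dB)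

rect-length : ∀ A {B} → Decr B → length (rectˡ A B) + length (rectʳ A B) ≡ length A + length B
rect-length A {B} d = trans (sym (length-++ (rectˡ A B))) (trans (sym (↭-length (≈K⇒↭ (rect-≈K A d)))) (length-++ A))

-- A is a sublist of rectˡ A B of the same length, hence equal to it; comparing contents, rectʳ A B is then a rearrangement of B.
rect-straight : ∀ {A B} → Decr A → Decr B → length (rectˡ A B) ≤ length A → A ≼ B
rect-straight {A} {B} dA dB le = ≼-intro λ v → subst (_≤ cnt v A) (sym (same v)) (≼-cnt (rectʳ-≼ A B) v)
  where
  A≡ : A ≡ rectˡ A B
  A≡ = Pointwise-≡⇒≡ (toPointwise (≤-antisym (length-mono-≤ (rectˡ-⊇ dA dB)) le) (rectˡ-⊇ dA dB))
  same : ∀ v → cnt v B ≡ cnt v (rectʳ A B)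
  same v = +-cancelˡ-≡ (cnt v A) _ _ (begin
    cnt v A + cnt v B                        ≡⟨ cnt-++ v A B ⟨
    cnt v (A ++ B)                           ≡⟨ cnt-↭ v (≈K⇒↭ (rect-≈K A dB)) ⟩
    cnt v (rectˡ A B ++ rectʳ A B)           ≡⟨ cnt-++ v (rectˡ A B) _ ⟩
    cnt v (rectˡ A B) + cnt v (rectʳ A B)    ≡⟨ cong (λ X → cnt v X + cnt v (rectʳ A B)) A≡ ⟨
    cnt v A + cnt v (rectʳ A B) ∎)
    where open ≡-Reasoning

-- Exchange of a straight pair of columns

-- Reverse column insertion: in a decreasing column D the largest entry that is at most c gives way
-- to c. If there is such an entry, D ++ [ c ] is Knuth equivalent to the expelled entry followed by
-- the new column.
replace : List ℕ → ℕ → List ℕ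
replace [] c = []
replace (d ∷ D) c with d ≤? c
... | yes _ = c ∷ D
... | no _ = d ∷ replace D c

-- junk value c if no entry is ≤ c
replaced : List ℕ → ℕ → ℕ
replaced [] c = c
replaced (d ∷ D) c with d ≤? c
... | yes _ = d
... | no _ = replaced D c

length-replace : ∀ D c → length (replace D c) ≡ length D
length-replace [] c = refl
length-replace (d ∷ D) c with d ≤? c
... | yes _ = refl
... | no _ = cong suc (length-replace D c)

cnt-replace : ∀ D c v → cnt v (replace D c) + ind (replaced D c) v ≡ cnt v D + ind c v
cnt-replace [] c v = refl
cnt-replace (d ∷ D) c v with d ≤? c
... | yes _ = lem (ind c v) (cnt v D) (ind d v)
  where lem : ∀ a b c → a + b + c ≡ c + b + a
        lem = solve-∀
... | no _ = trans (+-assoc (ind d v) _ _) (trans (cong (ind d v +_) (cnt-replace D c v)) (sym (+-assoc (ind d v) _ _)))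

replaced-≤ : ∀ D c → replaced D c ≤ c
replaced-≤ [] c = ≤-refl
replaced-≤ (d ∷ D) c with d ≤? c
... | yes p = p
... | no _ = replaced-≤ D c

replace-∈ : ∀ {z c} D → z ∈ replace D c → z ≡ c ⊎ z ∈ D
replace-∈ {c = c} (d ∷ D) p with d ≤? c
replace-∈ (d ∷ D) (here e) | yes _ = inj₁ e
replace-∈ (d ∷ D) (there p) | yes _ = inj₂ (there p)
replace-∈ (d ∷ D) (here e) | no _ = inj₂ (here e)
replace-∈ (d ∷ D) (there p) | no _ with replace-∈ D p
... | inj₁ e = inj₁ e
... | inj₂ q = inj₂ (there q)

Decr-replace : ∀ {D} c → Decr D → Decr (replace D c)
Decr-replace c [] = []
Decr-replace {d ∷ D} c (ds ∷ dd) with d ≤? c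
... | yes p = All.map (λ q → <-≤-trans q p) ds ∷ dd
... | no p = All.tabulate below ∷ Decr-replace c dd
  where
  below : ∀ {z} → z ∈ replace D c → z < d
  below z∈ with replace-∈ D z∈
  ... | inj₁ refl = ≰⇒> p
  ... | inj₂ q = All.lookup ds q

replaced-largest : ∀ {D c z} → Decr D → z ∈ replace D c → z < c → z < replaced D c
replaced-largest {d ∷ D} {c} (ds ∷ dd) z∈ q with d ≤? c
replaced-largest {d ∷ D} (ds ∷ dd) (here refl) q | yes p = contradiction q (n≮n _)
replaced-largest {d ∷ D} (ds ∷ dd) (there z∈) q | yes p = All.lookup ds z∈
replaced-largest {d ∷ D} (ds ∷ dd) (here refl) q | no p = contradiction (<⇒≤ q) p
replaced-largest {d ∷ D} (ds ∷ dd) (there z∈) q | no p = replaced-largest dd z∈ q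

cnt-gap : ∀ {D c v} → Decr D → replaced D c ≤ v → v ≤ c → cnt c D ≤ cnt v D
cnt-gap [] p q = z≤n
cnt-gap {d ∷ D} {c} {v} (ds ∷ dd) p q with d ≤? c
... | no r = ≤-trans (cnt-gap dd p q) (m≤n+m _ (ind d v))
... | yes r rewrite ind-≤ p = s≤s (≤-trans (cnt≤length c D) (≤-reflexive (sym (cnt-all v (All.map (λ x → ≤-trans (<⇒≤ x) p) ds)))))

replace-head : ∀ {d D c} → 1 ≤ cnt c D → Decr (d ∷ D) → c < d →
  ∃ λ h → ∃ λ E → replace D c ≡ h ∷ E × c ≤ h × h < d
replace-head {d} {e ∷ D} {c} p ((ed ∷ _) ∷ _) q with e ≤? c
... | yes r = c , D , refl , ≤-refl , q
... | no r = e , replace D c , refl , <⇒≤ (≰⇒> r) , ed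

replace-≈K : ∀ {D c} → Decr D → 1 ≤ cnt c D → (D ++ [ c ]) ≈K (replaced D c ∷ replace D c)
replace-≈K {d ∷ D} {c} dd p with d ≤? c
... | yes q = ksym (≈K-move-right dd q)
... | no q rewrite sym (+-identityˡ (cnt c D)) with replace-head p dd (≰⇒> q)
... | h , E , e , ch , hd = ktrans (≈K-∷ d (replace-≈K (AllPairs.tail dd) p))
      (subst (λ X → (d ∷ replaced D c ∷ X) ≈K (replaced D c ∷ d ∷ X)) (sym e)
        (ksym (kK1 [] E (replaced D c) h d (≤-trans (replaced-≤ D c) ch) hd)))

-- The letters of C enter D one by one, largest first, and the expelled letters form the new left
-- column. For D ≼ C this gives an equivalent pair of columns in which the two lengths have changed
-- places.
exchˡ exchʳ : List ℕ → List ℕ → List ℕ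
exchˡ D [] = []
exchˡ D (c ∷ C) = replaced D c ∷ exchˡ (replace D c) C
exchʳ D [] = D
exchʳ D (c ∷ C) = exchʳ (replace D c) C

length-exchˡ : ∀ D C → length (exchˡ D C) ≡ length C
length-exchˡ D [] = refl
length-exchˡ D (c ∷ C) = cong suc (length-exchˡ (replace D c) C)

length-exchʳ : ∀ D C → length (exchʳ D C) ≡ length D
length-exchʳ D [] = refl
length-exchʳ D (c ∷ C) = trans (length-exchʳ (replace D c) C) (length-replace D c)

Decr-exchʳ : ∀ {D} C → Decr D → Decr (exchʳ D C)
Decr-exchʳ [] d = d
Decr-exchʳ (c ∷ C) d = Decr-exchʳ C (Decr-replace c d)

-- The delicate case is `replaced D c` ≤ v < c, where the count of D drops by one. There D has no
-- entry in the interval (v , c], so its count at v is already the one at c, and this is at least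
-- cnt c (c ∷ C) = 1 + cnt c C.
replace-≼ : ∀ {D c C} → Decr D → Decr (c ∷ C) → D ≼ (c ∷ C) → replace D c ≼ C
replace-≼ {D} {c} {C} dD (cs ∷ dC) p = ≼-intro le
  where
  open ≤-Reasoning
  le : ∀ v → cnt v C ≤ cnt v (replace D c)
  le v with c ≤? v
  ... | yes q = +-cancelʳ-≤ 1 _ _ (begin
      cnt v C + 1                                ≡⟨ +-comm _ 1 ⟩
      1 + cnt v C                                ≡⟨ cong (_+ cnt v C) (ind-≤ q) ⟨
      cnt v (c ∷ C)                              ≤⟨ ≼-cnt p v ⟩
      cnt v D                                    ≤⟨ m≤m+n _ (ind c v) ⟩
      cnt v D + ind c v                          ≡⟨ cnt-replace D c v ⟨
      cnt v (replace D c) + ind (replaced D c) v ≤⟨ +-monoʳ-≤ _ (ind≤1 (replaced D c) v) ⟩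
      cnt v (replace D c) + 1 ∎)
  ... | no q with replaced D c ≤? v
  ...   | no r = begin
      cnt v C                                    ≤⟨ m≤n+m _ (ind c v) ⟩
      cnt v (c ∷ C)                              ≤⟨ ≼-cnt p v ⟩
      cnt v D                                    ≤⟨ m≤m+n _ (ind c v) ⟩
      cnt v D + ind c v                          ≡⟨ cnt-replace D c v ⟨
      cnt v (replace D c) + ind (replaced D c) v ≡⟨ cong (cnt v (replace D c) +_) (ind-> (≰⇒> r)) ⟩
      cnt v (replace D c) + 0                    ≡⟨ +-identityʳ _ ⟩
      cnt v (replace D c) ∎
  ...   | yes r = +-cancelʳ-≤ 1 _ _ (begin
      cnt v C + 1                                ≡⟨ +-comm _ 1 ⟩
      1 + cnt v C                                ≤⟨ s≤s (cnt-mono C (<⇒≤ (≰⇒> q))) ⟩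
      1 + cnt c C                                ≡⟨ cong (_+ cnt c C) (ind-≤ (≤-refl {c})) ⟨
      cnt c (c ∷ C)                              ≤⟨ ≼-cnt p c ⟩
      cnt c D                                    ≤⟨ cnt-gap dD r (<⇒≤ (≰⇒> q)) ⟩
      cnt v D                                    ≤⟨ m≤m+n _ (ind c v) ⟩
      cnt v D + ind c v                          ≡⟨ cnt-replace D c v ⟨
      cnt v (replace D c) + ind (replaced D c) v ≤⟨ +-monoʳ-≤ _ (ind≤1 (replaced D c) v) ⟩
      cnt v (replace D c) + 1 ∎)

cnt-exchʳ : ∀ {v} D {C} → All (_≤ v) C → cnt v (exchʳ D C) ≡ cnt v D
cnt-exchʳ D [] = refl
cnt-exchʳ {v} D {c ∷ C} (p ∷ ps) = trans (cnt-exchʳ (replace D c) ps) (+-cancelʳ-≡ 1 _ _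
  (subst₂ (λ x y → cnt v (replace D c) + x ≡ cnt v D + y) (ind-≤ (≤-trans (replaced-≤ D c) p)) (ind-≤ p) (cnt-replace D c v)))

exchʳ-≼ : ∀ {D C} → Decr D → Decr C → D ≼ C → exchʳ D C ≼ C
exchʳ-≼ {C = []} dD dC p = ≼-intro λ v → z≤n
exchʳ-≼ {D} {c ∷ C} dD dC@(cs ∷ dC') p = ≼-intro le
  where
  split : ∀ v → Dec (c ≤ v) → cnt v (c ∷ C) ≤ cnt v (exchʳ D (c ∷ C))
  split v (yes q) = subst (cnt v (c ∷ C) ≤_)
      (sym (cnt-exchʳ D (q ∷ All.map (λ r → ≤-trans (<⇒≤ r) q) cs))) (≼-cnt p v)
  split v (no q) = subst (_≤ cnt v (exchʳ D (c ∷ C))) (sym (cong (_+ cnt v C) (ind-> (≰⇒> q))))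
      (≼-cnt (exchʳ-≼ (Decr-replace c dD) dC' (replace-≼ dD dC p)) v)
  le : ∀ v → cnt v (c ∷ C) ≤ cnt v (exchʳ D (c ∷ C))
  le v = split v (c ≤? v)

exch-≈K : ∀ {D C} → Decr D → Decr C → D ≼ C → (D ++ C) ≈K (exchˡ D C ++ exchʳ D C)
exch-≈K {D} {[]} dD dC p = ≡⇒≈K (++-identityʳ D)
exch-≈K {D} {c ∷ C} dD dC@(cs ∷ dC') p = ktrans (≡⇒≈K (sym (++-assoc D [ c ] C)))
  (ktrans (≈K-++ʳ C (replace-≈K dD (≤-trans (cnt-pos {c} {c} {c ∷ C} (here refl) ≤-refl) (≼-cnt p c))))
    (≈K-∷ (replaced D c) (exch-≈K (Decr-replace c dD) dC' (replace-≼ dD dC p))))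

exchˡ-≤ : ∀ {D c C} → Decr D → Decr (c ∷ C) → All (_≤ c) (exchˡ D (c ∷ C))
exchˡ-≤ {D} {c} {[]} dD dC = replaced-≤ D c ∷ []
exchˡ-≤ {D} {c} {b ∷ C} dD ((bc ∷ _) ∷ dC) = replaced-≤ D c ∷ All.map (λ p → ≤-trans p (<⇒≤ bc)) (exchˡ-≤ (Decr-replace c dD) dC)

replaced-∈ : ∀ {D c} → 1 ≤ cnt c D → replaced D c ∈ D
replaced-∈ {d ∷ D} {c} p with d ≤? c
... | yes q = here refl
... | no q rewrite sym (+-identityˡ (cnt c D)) = there (replaced-∈ p)

-- A letter c of C that has entered D is not expelled again: the later letters of C are smaller than
-- c and expel only entries at most as large as themselves.
exchˡ-∈ : ∀ {D C z} → Decr D → Decr C → D ≼ C → z ∈ exchˡ D C → z ∈ D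
exchˡ-∈ {D} {c ∷ C} dD dC p (here refl) = replaced-∈ (≤-trans (cnt-pos {c} {c} {c ∷ C} (here refl) ≤-refl) (≼-cnt p c))
exchˡ-∈ {D} {c ∷ b ∷ C} dD dC@((bc ∷ _) ∷ dC') p (there z∈)
  with replace-∈ D (exchˡ-∈ {C = b ∷ C} (Decr-replace c dD) dC' (replace-≼ dD dC p) z∈)
... | inj₂ q = q
... | inj₁ refl = contradiction (All.lookup (exchˡ-≤ (Decr-replace c dD) dC') z∈) (<⇒≱ bc)

Decr-exchˡ : ∀ {D C} → Decr D → Decr C → D ≼ C → Decr (exchˡ D C)
Decr-exchˡ {C = []} dD dC p = []
Decr-exchˡ {D} {c ∷ []} dD dC p = [] ∷ []
Decr-exchˡ {D} {c ∷ b ∷ C} dD dC@((bc ∷ _) ∷ dC') p = All.tabulate below ∷ Decr-exchˡ dD' dC' p'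
  where
  dD' = Decr-replace c dD
  p' = replace-≼ dD dC p
  below : ∀ {z} → z ∈ exchˡ (replace D c) (b ∷ C) → z < replaced D c
  below z∈ = replaced-largest dD (exchˡ-∈ {C = b ∷ C} dD' dC' p' z∈)
    (≤-<-trans (All.lookup (exchˡ-≤ dD' dC') z∈) bc)

replace-id : ∀ {D c} → Decr D → c ∈ D → replace D c ≡ D
replace-id {d ∷ D} {c} (ds ∷ dd) c∈ with d ≤? c
replace-id {d ∷ D} (ds ∷ dd) (here refl) | yes p = refl
replace-id {d ∷ D} (ds ∷ dd) (there c∈) | yes p = contradiction (All.lookup ds c∈) (≤⇒≯ p)
replace-id {d ∷ D} (ds ∷ dd) (here refl) | no p = contradiction ≤-refl p
replace-id {d ∷ D} (ds ∷ dd) (there c∈) | no p = cong (d ∷_) (replace-id dd c∈)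

exchʳ-id : ∀ {D C} → Decr D → All (_∈ D) C → exchʳ D C ≡ D
exchʳ-id dD [] = refl
exchʳ-id {D} {c ∷ C} dD (c∈ ∷ cs) rewrite replace-id dD c∈ = exchʳ-id dD cs

-- Straightening a sequence of columns

-- Only rectifications that lengthen the left column are steps; by `rect-straight`, a pair that
-- admits none is already in order.
data Step : List (List ℕ) → List (List ℕ) → Set where
  here : ∀ {A B cs} → length A < length (rectˡ A B) → Step (A ∷ B ∷ cs) (rectˡ A B ∷ rectʳ A B ∷ cs)
  there : ∀ {A cs ds} → Step cs ds → Step (A ∷ cs) (A ∷ ds)

step? : ∀ cs → All Decr cs → Linked _≼_ cs ⊎ ∃ (Step cs)
step? [] [] = inj₁ []
step? (A ∷ []) _ = inj₁ [-]
step? (A ∷ B ∷ cs) (dA ∷ dB ∷ d) with step? (B ∷ cs) (dB ∷ d) | length A <? length (rectˡ A B)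
... | _ | yes p = inj₂ (_ , here p)
... | inj₁ l | no p = inj₁ (rect-straight dA dB (≮⇒≥ p) ∷ l)
... | inj₂ (_ , s) | no p = inj₂ (_ , there s)

step-Decr : ∀ {cs ds} → Step cs ds → All Decr cs → All Decr ds
step-Decr (here {A} {B} _) (dA ∷ dB ∷ d) = Decr-rectˡ A dB ∷ Decr-rectʳ A dA dB ∷ d
step-Decr (there s) (dA ∷ d) = dA ∷ step-Decr s d

step-≈K : ∀ {cs ds} → Step cs ds → All Decr cs → concat cs ≈K concat ds
step-≈K (here {A} {B} {cs} _) (dA ∷ dB ∷ d) = ktrans (≡⇒≈K (sym (++-assoc A B (concat cs))))
  (ktrans (≈K-++ʳ (concat cs) (rect-≈K A dB)) (≡⇒≈K (++-assoc (rectˡ A B) (rectʳ A B) (concat cs))))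
step-≈K (there {A} s) (dA ∷ d) = ≈K-++ˡ A (step-≈K s d)

step-length : ∀ {cs ds} → Step cs ds → length cs ≡ length ds
step-length (here _) = refl
step-length (there s) = cong suc (step-length s)

-- The k-th column, counted from 0, contributes k times its length. A step carries letters one
-- column to the left and so lowers the weight, which makes straightening terminate.
weight : List (List ℕ) → ℕ
weight [] = 0
weight (c ∷ cs) = length (concat cs) + weight cs

step-weight : ∀ {cs ds} → Step cs ds → All Decr cs → weight ds < weight cs
step-weight (here {A} {B} {cs} p) (dA ∷ dB ∷ d)
  rewrite length-++ (rectʳ A B) {concat cs} | length-++ B {concat cs} =
  +-monoˡ-< _ (+-monoˡ-< (length (concat cs)) (+-cancelˡ-< (length A) _ _
    (subst (length A + length (rectʳ A B) <_) (rect-length A dB) (+-monoˡ-< (length (rectʳ A B)) p))))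
step-weight (there s) (dA ∷ d) rewrite ↭-length (≈K⇒↭ (step-≈K s d)) = +-monoʳ-< _ (step-weight s d)

sumSq : List ℕ → ℕ
sumSq [] = 0
sumSq (x ∷ xs) = x * x + sumSq xs

sumSq-↭ : ∀ {xs ys} → xs ↭ ys → sumSq xs ≡ sumSq ys
sumSq-↭ Perm.refl = refl
sumSq-↭ (prep x p) = cong (x * x +_) (sumSq-↭ p)
sumSq-↭ (swap x y p) rewrite sumSq-↭ p = lem (x * x) (y * y) _
  where lem : ∀ a b c → a + (b + c) ≡ b + (a + c)
        lem = solve-∀
sumSq-↭ (Perm.trans p q) = trans (sumSq-↭ p) (sumSq-↭ q)

-- With a = b* + d, a* = a + k and b = b* + k, the sum of squares grows by 2kd.
spread-squares : ∀ {a b a* b*} → a < a* → b ≤ a* → a* + b* ≡ a + b →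
  a * a + b * b ≤ a* * a* + b* * b* × (a* * a* + b* * b* ≤ a * a + b * b → b* ≡ a)
spread-squares {a} {b} {a*} {b*} p q e = growth , equality
  where
  k = a* ∸ a
  a*≡ : a* ≡ a + k
  a*≡ = sym (m+[n∸m]≡n (<⇒≤ p))
  b≡ : b ≡ b* + k
  b≡ = +-cancelˡ-≡ a _ _ (trans (sym e) (trans (cong (_+ b*) a*≡) (lem a k b*)))
    where lem : ∀ a k b* → a + k + b* ≡ a + (b* + k)
          lem = solve-∀
  b*≤a : b* ≤ a
  b*≤a = +-cancelʳ-≤ k _ _ (subst₂ _≤_ b≡ a*≡ q)
  d = a ∸ b*
  a≡ : a ≡ b* + d
  a≡ = sym (m+[n∸m]≡n b*≤a)
  excess : ∀ c d k → (c + d + k) * (c + d + k) + c * c ≡ (c + d) * (c + d) + (c + k) * (c + k) + (k * d + k * d)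
  excess = solve-∀
  squares : a* * a* + b* * b* ≡ a * a + b * b + (k * d + k * d)
  squares = begin
    a* * a* + b* * b*                              ≡⟨ cong (λ x → x * x + b* * b*) a*≡ ⟩
    (a + k) * (a + k) + b* * b*                    ≡⟨ cong (λ x → (x + k) * (x + k) + b* * b*) a≡ ⟩
    (b* + d + k) * (b* + d + k) + b* * b*          ≡⟨ excess b* d k ⟩
    (b* + d) * (b* + d) + (b* + k) * (b* + k) + _  ≡⟨ cong₂ (λ x y → x * x + y * y + (k * d + k * d)) a≡ b≡ ⟨
    a * a + b * b + (k * d + k * d) ∎
    where open ≡-Reasoning
  growth = ≤-trans (m≤m+n _ _) (≤-reflexive (sym squares))
  equality : a* * a* + b* * b* ≤ a * a + b * b → b* ≡ a
  equality le with m*n≡0⇒m≡0∨n≡0 k {d} (n≤0⇒n≡0 (≤-trans (m≤m+n (k * d) (k * d)) (+-cancelˡ-≤ (a * a + b * b) _ _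
      (≤-trans (≤-reflexive (sym squares)) (≤-trans le (≤-reflexive (sym (+-identityʳ _))))))))
  ... | inj₁ k≡0 = contradiction k≡0 (>⇒≢ (m<n⇒0<n∸m p))
  ... | inj₂ d≡0 = ≤-antisym b*≤a (m∸n≡0⇒m≤n d≡0)

Q : List (List ℕ) → ℕ
Q cs = sumSq (map length cs)

sq : List ℕ → ℕ
sq c = length c * length c

Q-pair : ∀ A B cs → sq A + sq B + Q cs ≡ Q (A ∷ B ∷ cs)
Q-pair A B cs = +-assoc (sq A) _ (Q cs)

rect-Q : ∀ A {B} → Decr B → length A < length (rectˡ A B) →
  sq A + sq B ≤ sq (rectˡ A B) + sq (rectʳ A B) ×
  (sq (rectˡ A B) + sq (rectʳ A B) ≤ sq A + sq B → length (rectʳ A B) ≡ length A)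
rect-Q A {B} dB p = spread-squares p (≼-length (rectˡ-≼ʳ A B)) (rect-length A dB)

step-Q : ∀ {cs ds} → Step cs ds → All Decr cs → Q cs ≤ Q ds
step-Q (here {A} {B} {cs} p) (dA ∷ dB ∷ d) = subst₂ _≤_ (Q-pair A B cs) (Q-pair (rectˡ A B) (rectʳ A B) cs)
  (+-monoˡ-≤ (Q cs) (proj₁ (rect-Q A dB p)))
step-Q (there {A} s) (dA ∷ d) = +-monoʳ-≤ (length A * length A) (step-Q s d)

step-swap : ∀ A {B} cs → Decr B → length A < length (rectˡ A B) →
  Q (rectˡ A B ∷ rectʳ A B ∷ cs) ≤ Q (A ∷ B ∷ cs) → length (rectʳ A B) ≡ length A × length (rectˡ A B) ≡ length B
step-swap A {B} cs dB p q = e , +-cancelʳ-≡ (length A) _ _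
    (trans (cong (length (rectˡ A B) +_) (sym e)) (trans (rect-length A dB) (+-comm (length A) _)))
  where e = proj₂ (rect-Q A dB p) (+-cancelʳ-≤ (Q cs) _ _
              (subst₂ _≤_ (sym (Q-pair (rectˡ A B) (rectʳ A B) cs)) (sym (Q-pair A B cs)) q))

step-shorter : ∀ {cs ds c} → Step cs ds → All Decr cs → Q ds ≤ Q cs →
  All (λ X → length X < c) cs → All (λ X → length X < c) ds
step-shorter {c = c} (here {A} {B} {cs} p) (dA ∷ dB ∷ d) q (x ∷ y ∷ r) with step-swap A cs dB p q
... | e , f = subst (_< c) (sym f) y ∷ subst (_< c) (sym e) x ∷ r
step-shorter (there {A} s) (dA ∷ d) q (x ∷ r) = x ∷ step-shorter s d (+-cancelˡ-≤ (length A * length A) _ _ q) r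

-- Invariant that follows the last column of a skew tableau while its columns are sorted by length.
data Marked (C : List ℕ) (c : ℕ) : List (List ℕ) → Set where
  here : ∀ {D cs} → length D ≡ c → D ≼ C → All (λ X → length X < c) cs → Marked C c (D ∷ cs)
  there : ∀ {D cs} → Marked C c cs → Marked C c (D ∷ cs)

step-Marked : ∀ {C c cs ds} → Step cs ds → All Decr cs → Q ds ≤ Q cs → Marked C c cs → Marked C c ds
step-Marked (here {A} {B} {cs} p) (dA ∷ dB ∷ d) q m with step-swap A cs dB p q
-- The marked column is A. The lengths being exchanged, the new left column is as long as B, hence
-- shorter than A; but a step makes it longer than A.
step-Marked (here p) (dA ∷ dB ∷ d) q (here refl le (sh ∷ _)) | e , f = contradiction (<-trans p (subst (_< _) (sym f) sh)) (n≮n _)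
-- The marked column is B. It moves to the left past the shorter A, and becomes `rectˡ A B`, which
-- lies below B.
step-Marked (here {A} {B} p) (dA ∷ dB ∷ d) q (there (here refl le sh)) | e , f =
  here f (≼-trans (rectˡ-≼ʳ A B) le) (subst₂ _<_ (sym e) f p ∷ sh)
step-Marked (here p) (dA ∷ dB ∷ d) q (there (there m)) | e , f = there (there m)
step-Marked (there {A} s) (dA ∷ d) q (here l le sh) = here l le (step-shorter s d (+-cancelˡ-≤ (length A * length A) _ _ q) sh)
step-Marked (there {A} s) (dA ∷ d) q (there m) = there (step-Marked s d (+-cancelˡ-≤ (length A * length A) _ _ q) m)

-- Whether the sum of squares has stayed constant is known only after the result has been
-- identified, so the fate of the mark is recorded conditionally.
record Straightening (cs : List (List ℕ)) : Set where
  field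
    result : List (List ℕ)
    isTableau : Tableau result
    equivalent : concat cs ≈K concat result
    sameLength : length cs ≡ length result
    Q-grows : Q cs ≤ Q result
    marked : ∀ {C c} → Q result ≤ Q cs → Marked C c cs → Marked C c result
open Straightening

straighten : ∀ cs → All Decr cs → Straightening cs
straighten cs d = go (suc (weight cs)) cs d ≤-refl
  where
  go : ∀ f cs → All Decr cs → weight cs < f → Straightening cs
  go (suc f) cs d w with step? cs d
  ... | inj₁ l = record { result = cs ; isTableau = tableau d (Linked.Linked⇒AllPairs ≼-trans l) ; equivalent = krefl
                        ; sameLength = refl ; Q-grows = ≤-refl ; marked = λ _ m → m }
  ... | inj₂ (ds , s) = record { result = result r ; isTableau = isTableau r
        ; equivalent = ktrans (step-≈K s d) (equivalent r) ; sameLength = trans (step-length s) (sameLength r)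
        ; Q-grows = ≤-trans (step-Q s d) (Q-grows r)
        ; marked = λ q m → marked r (≤-trans q (step-Q s d)) (step-Marked s d (≤-trans (Q-grows r) q) m) }
    where r = go f ds (step-Decr s d) (<-≤-trans (step-weight s d) (s≤s⁻¹ w))

-- Columns to the left of the marked one lie below it by ≼, and those to its right are shorter than
-- c.
Marked-tableau : ∀ {C c cs} → AllPairs _≼_ cs → Marked C c cs → All (λ X → length X ≡ c → X ≼ C) cs
Marked-tableau (p ∷ ps) (here l le sh) = (λ _ → le) ∷ All.map (λ lt e → contradiction lt (≤⇒≯ (≤-reflexive (sym e)))) sh
Marked-tableau {C} {c} {D ∷ cs} (p ∷ ps) (there m) = (λ _ → ≼-trans (proj₁ found) (proj₂ found)) ∷ Marked-tableau ps m
  where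
  lookup : ∀ {cs} → All (D ≼_) cs → Marked C c cs → ∃ λ X → D ≼ X × X ≼ C
  lookup (q ∷ _) (here _ le _) = _ , q , le
  lookup (_ ∷ qs) (there m) = lookup qs m
  found = proj₂ (lookup p m)

-- Sorting the column lengths by rectifications keeps the sum of their squares, so every step is a mere exchange.
columns-≼-last : ∀ {C c cs ts} → All Decr cs → Tableau ts → concat cs ≈K concat ts →
  map length cs ↭ map length ts → Marked C c cs → All (λ X → length X ≡ c → X ≼ C) ts
columns-≼-last {cs = cs} {ts} d t k perm m =
  Marked-tableau (Tableau.rows t) (subst (Marked _ _) same (marked r (≤-reflexive (trans (cong Q same) (sym (sumSq-↭ perm)))) m))
  where
  r = straighten cs d
  len : length cs ≡ length ts
  len = trans (sym (length-map length cs)) (trans (↭-length perm) (length-map length ts))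
  same : result r ≡ ts
  same = tableau-unique (isTableau r) t (trans (sym (sameLength r)) len) (ktrans (ksym (equivalent r)) k)

-- Moving a column to the far right

passˡ : List ℕ → List (List ℕ) → List (List ℕ)
passˡ D [] = []
passˡ D (C ∷ Cs) = exchˡ D C ∷ passˡ (exchʳ D C) Cs

passʳ : List ℕ → List (List ℕ) → List ℕ
passʳ D [] = D
passʳ D (C ∷ Cs) = passʳ (exchʳ D C) Cs

-- By `exchʳ-≼` the moving column stays below C, hence below all later columns. It therefore forms a
-- tableau with them again, and the next exchange is possible.
pass-≈K : ∀ {D Cs} → Tableau (D ∷ Cs) → (D ++ concat Cs) ≈K (concat (passˡ D Cs) ++ passʳ D Cs)
pass-≈K {D} {[]} t = ≡⇒≈K (++-identityʳ D)
pass-≈K {D} {C ∷ Cs} (tableau (dD ∷ dC ∷ d) ((p ∷ ps) ∷ (q ∷ qs))) =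
  ktrans (≡⇒≈K (sym (++-assoc D C (concat Cs))))
  (ktrans (≈K-++ʳ (concat Cs) (exch-≈K dD dC p))
  (ktrans (≡⇒≈K (++-assoc (exchˡ D C) (exchʳ D C) (concat Cs)))
  (ktrans (≈K-++ˡ (exchˡ D C) (pass-≈K {exchʳ D C} {Cs}
     (tableau (Decr-exchʳ C dD ∷ d) (All.map (≼-trans (exchʳ-≼ dD dC p)) q ∷ qs))))
  (≡⇒≈K (sym (++-assoc (exchˡ D C) _ _))))))

pass-Decr : ∀ {D Cs} → Tableau (D ∷ Cs) → All Decr (passˡ D Cs) × Decr (passʳ D Cs)
pass-Decr {D} {[]} (tableau (dD ∷ []) _) = [] , dD
pass-Decr {D} {C ∷ Cs} (tableau (dD ∷ dC ∷ d) ((p ∷ ps) ∷ (q ∷ qs)))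
  with pass-Decr {exchʳ D C} {Cs} (tableau (Decr-exchʳ C dD ∷ d) (All.map (≼-trans (exchʳ-≼ dD dC p)) q ∷ qs))
... | d₁ , d₂ = Decr-exchˡ dD dC p ∷ d₁ , d₂

length-passˡ : ∀ D Cs → map length (passˡ D Cs) ≡ map length Cs
length-passˡ D [] = refl
length-passˡ D (C ∷ Cs) = cong₂ _∷_ (length-exchˡ D C) (length-passˡ (exchʳ D C) Cs)

length-passʳ : ∀ D Cs → length (passʳ D Cs) ≡ length D
length-passʳ D [] = refl
length-passʳ D (C ∷ Cs) = trans (length-passʳ (exchʳ D C) Cs) (length-exchʳ D C)

passʳ-preserves : ∀ (Φ : List ℕ → Set) {D Cs} → Tableau (D ∷ Cs) →
  All (λ C → ∀ {D} → Decr D → D ≼ C → Φ D → Φ (exchʳ D C)) Cs → Φ D → Φ (passʳ D Cs)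
passʳ-preserves Φ {D} {[]} t [] φ = φ
passʳ-preserves Φ {D} {C ∷ Cs} (tableau (dD ∷ dC ∷ d) ((p ∷ ps) ∷ (q ∷ qs))) (h ∷ hs) φ =
  passʳ-preserves Φ {exchʳ D C} {Cs} (tableau (Decr-exchʳ C dD ∷ d) (All.map (≼-trans (exchʳ-≼ dD dC p)) q ∷ qs)) hs (h dD p φ)

-- Any sequence of columns is a skew tableau once its columns are moved apart vertically.
spreadOut : List (List ℕ) → List SkewCol
spreadOut [] = []
spreadOut (c ∷ cs) = (length (concat cs) , reverse c) ∷ spreadOut cs

spreadOut-isSkewTab : ∀ {cs} → All Decr cs → All (λ c → 1 ≤ length c) cs → IsSkewTab (spreadOut cs)
spreadOut-isSkewTab {cs} d ne = columnsOK d ne , adjacentOK cs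
  where
  columnsOK : ∀ {cs} → All Decr cs → All (λ c → 1 ≤ length c) cs → All ColOK (spreadOut cs)
  columnsOK [] [] = []
  columnsOK {c ∷ _} (d ∷ ds) (p ∷ ps) =
    (subst (1 ≤_) (sym (length-reverse c)) p , Linked.AllPairs⇒Linked (AllPairs-reverse d)) ∷ columnsOK ds ps
  adjacentOK : ∀ cs → Linked AdjOK (spreadOut cs)
  adjacentOK [] = []
  adjacentOK (c ∷ []) = [-]
  adjacentOK (c ∷ c' ∷ cs) = (≤-trans (m≤m+n _ _) (≤-reflexive (sym offset)) , ≤-trans (≤-reflexive (sym offset)) (m≤m+n _ _) ,
      λ r p q → contradiction (<-≤-trans p q) (≤⇒≯ (≤-reflexive (sym offset)))) ∷ adjacentOK (c' ∷ cs)
    where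
    offset : length (c' ++ concat cs) ≡ length (concat cs) + length (reverse c')
    offset = trans (length-++ c') (trans (+-comm (length c') _) (cong (length (concat cs) +_) (sym (length-reverse c'))))

spreadOut-word : ∀ cs → skewWord (spreadOut cs) ≡ concat cs
spreadOut-word [] = refl
spreadOut-word (c ∷ cs) = cong₂ _++_ (reverse-involutive c) (spreadOut-word cs)

spreadOut-lengths : ∀ cs → map (λ col → length (proj₂ col)) (spreadOut cs) ≡ map length cs
spreadOut-lengths [] = refl
spreadOut-lengths (c ∷ cs) = cong₂ _∷_ (length-reverse c) (spreadOut-lengths cs)

spreadOut-last : ∀ cs C → last (spreadOut (cs ++ [ C ])) ≡ just (0 , reverse C)
spreadOut-last [] C = refl
spreadOut-last (c ∷ []) C = refl
spreadOut-last (c ∷ c' ∷ cs) C = spreadOut-last (c' ∷ cs) C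

Marked-last : ∀ {o C} (s : List SkewCol) → last s ≡ just (o , C) →
  Marked (reverse C) (length C) (map (λ (c : SkewCol) → reverse (proj₂ c)) s)
Marked-last {o} {C} ((o' , C') ∷ []) e with refl ← just-injective e = here (length-reverse C) (≼-intro λ v → ≤-refl) []
Marked-last (c ∷ c' ∷ s) e = there (Marked-last (c' ∷ s) e)

skew-Decr : ∀ {s} → All ColOK s → All Decr (map (λ c → reverse (proj₂ c)) s)
skew-Decr [] = []
skew-Decr ((_ , l) ∷ ps) = AllPairs-reverse (Linked.Linked⇒AllPairs <-trans l) ∷ skew-Decr ps

skew-lengths : ∀ s → map length (map (λ (c : SkewCol) → reverse (proj₂ c)) s) ≡ map (λ col → length (proj₂ col)) s
skew-lengths [] = refl
skew-lengths (c ∷ s) = cong₂ _∷_ (length-reverse (proj₂ c)) (skew-lengths s)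

-- Tuples, Boolean tests and finite counts

T⇒≡ : ∀ {b} → T b → b ≡ true
T⇒≡ = Equivalence.to T-≡

≡⇒T : ∀ {b} → b ≡ true → T b
≡⇒T = Equivalence.from T-≡

¬T⇒≡ : ∀ {b} → ¬ T b → b ≡ false
¬T⇒≡ {false} _ = refl
¬T⇒≡ {true} h = contradiction tt h

at-tab : ∀ n (f : ℕ → ℕ) i → 1 ≤ i → i ≤ n → at (tab n f) i ≡ f i
at-tab (suc n) f (suc zero) p q = refl
at-tab (suc n) f (suc (suc i)) p (s≤s q) = at-tab n (f ∘ suc) (suc i) (s≤s z≤n) q

at-ext : ∀ {n} (u v : Vec ℕ n) → (∀ i → 1 ≤ i → i ≤ n → at u i ≡ at v i) → u ≡ v
at-ext V.[] V.[] h = refl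
at-ext (x V.∷ u) (y V.∷ v) h = cong₂ V._∷_ (h 1 (s≤s z≤n) (s≤s z≤n))
  (at-ext u v λ { (suc i) p q → h (suc (suc i)) (s≤s z≤n) (s≤s q) })

memb⇒∈ : ∀ {v xs} → T (memb v xs) → v ∈ xs
memb⇒∈ {v} {xs} p = Any.map (λ {y} e → sym (≡ᵇ⇒≡ y v e)) (any⁻ (λ y → y ≡ᵇ v) xs p)

∈⇒memb : ∀ {v xs} → v ∈ xs → T (memb v xs)
∈⇒memb {v} p = any⁺ (λ y → y ≡ᵇ v) (Any.map (λ {y} e → ≡⇒≡ᵇ y v (sym e)) p)

filterB-∈⁻ : ∀ p {v} xs → v ∈ filterB p xs → v ∈ xs × T (p v)
filterB-∈⁻ p (x ∷ xs) v∈ with p x in eq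
filterB-∈⁻ p (x ∷ xs) (here refl) | true = here refl , ≡⇒T eq
filterB-∈⁻ p (x ∷ xs) (there v∈) | true with filterB-∈⁻ p xs v∈
... | q , r = there q , r
filterB-∈⁻ p (x ∷ xs) v∈ | false with filterB-∈⁻ p xs v∈
... | q , r = there q , r

filterB-∈⁺ : ∀ p {v} xs → v ∈ xs → T (p v) → v ∈ filterB p xs
filterB-∈⁺ p (x ∷ xs) (here refl) t with p x
... | true = here refl
filterB-∈⁺ p (x ∷ xs) (there v∈) t with p x
... | true = there (filterB-∈⁺ p xs v∈ t)
... | false = filterB-∈⁺ p xs v∈ t

Inc-filterB : ∀ p {xs} → Inc xs → Inc (filterB p xs)
Inc-filterB p [] = []
Inc-filterB p {x ∷ xs} (a ∷ as) with p x
... | true = All.tabulate (λ v∈ → All.lookup a (proj₁ (filterB-∈⁻ p xs v∈))) ∷ Inc-filterB p as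
... | false = Inc-filterB p as

countB-∷ʳ : ∀ p xs x → countB p (xs ++ [ x ]) ≡ (if p x then suc (countB p xs) else countB p xs)
countB-∷ʳ p [] x = refl
countB-∷ʳ p (y ∷ xs) x rewrite countB-∷ʳ p xs x with p y | p x
... | true | true = refl
... | true | false = refl
... | false | true = refl
... | false | false = refl

countB≤ : ∀ p m → countB p (range m) ≤ m
countB≤ p zero = z≤n
countB≤ p (suc m) rewrite countB-∷ʳ p (range m) (suc m) with p (suc m)
... | true = s≤s (countB≤ p m)
... | false = m≤n⇒m≤1+n (countB≤ p m)

-- For the predicate j ≤ λ_i, which passes from i + 1 to i, this says that column j occupies exactly
-- the rows 1, ..., `colLen lam j`.
countB-initial : ∀ p m → (∀ i → 1 ≤ i → i < m → T (p (suc i)) → T (p i)) →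
  ∀ i → 1 ≤ i → i ≤ m → (T (p i) → i ≤ countB p (range m)) × (i ≤ countB p (range m) → T (p i))
countB-initial p zero h (suc i) _ ()
countB-initial p (suc m) h i i≥1 i≤ rewrite countB-∷ʳ p (range m) (suc m) with p (suc m) in eq
... | true = (λ _ → ≤-trans i≤ (s≤s (full m refl))) , λ _ → true-below i i≥1 i≤
  where
  h' : ∀ i → 1 ≤ i → i < m → T (p (suc i)) → T (p i)
  h' i a b = h i a (m≤n⇒m≤1+n b)
  full : ∀ k → k ≡ m → m ≤ countB p (range m)
  full zero refl = z≤n
  full (suc k) refl = proj₁ (countB-initial p m h' m (s≤s z≤n) ≤-refl) (h m (s≤s z≤n) ≤-refl (≡⇒T eq))
  true-below : ∀ i → 1 ≤ i → i ≤ suc m → T (p i)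
  true-below i a b with i ≟ suc m
  ... | yes refl = ≡⇒T eq
  ... | no ne = proj₂ (countB-initial p m h' i a (s≤s⁻¹ (≤∧≢⇒< b ne))) (≤-trans (s≤s⁻¹ (≤∧≢⇒< b ne)) (full m refl))
... | false with i ≟ suc m
...   | yes refl = (λ t → contradiction (trans (sym (T⇒≡ t)) eq) λ ()) , λ le → contradiction (≤-trans le (countB≤ p m)) (n≮n m)
...   | no ne = countB-initial p m (λ i a b → h i a (m≤n⇒m≤1+n b)) i i≥1 (s≤s⁻¹ (≤∧≢⇒< i≤ ne))

-- Carrels

module Carrels {n : ℕ} (lam : Vec ℕ n) where

  R : ℕ → Set
  R q = isR lam q ≡ true

  -- The right ends of the carrels. Every length of a column of λ is one of them.
  Cut : ℕ → Set
  Cut q = R q ⊎ q ≡ n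

  NoCut : ℕ → Set
  NoCut q = isR lam q ≡ false

  ¬R∧NoCut : ∀ {b} → b ≡ true → b ≡ false → ⊥
  ¬R∧NoCut r s = contradiction (trans (sym r) s) λ ()

  topGo-spec : ∀ f c → c + f ≡ n → c ≤ topGo lam f c × topGo lam f c ≤ n × Cut (topGo lam f c) ×
    (∀ k → c ≤ k → k < topGo lam f c → NoCut k)
  topGo-spec zero c e rewrite +-identityʳ c = ≤-refl , ≤-reflexive e , inj₂ e , λ k p q → contradiction p (<⇒≱ q)
  topGo-spec (suc f) c e with isR lam c in eq
  ... | true = ≤-refl , ≤-trans (m≤m+n c (suc f)) (≤-reflexive e) , inj₁ eq , λ k p q → contradiction p (<⇒≱ q)
  ... | false with topGo-spec f (suc c) (trans (sym (+-suc c f)) e)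
  ...   | p , q , r , s = <⇒≤ p , q , r , below
    where
    below : ∀ k → c ≤ k → k < topGo lam f (suc c) → NoCut k
    below k a b with c ≟ k
    ... | yes refl = eq
    ... | no ne = s k (≤∧≢⇒< a ne) b

  botGo-spec : ∀ c → botGo lam c ≤ c × (botGo lam c ≡ 0 ⊎ R (botGo lam c)) × (∀ k → botGo lam c < k → k ≤ c → NoCut k)
  botGo-spec zero = z≤n , inj₁ refl , λ k p q → contradiction q (<⇒≱ p)
  botGo-spec (suc c) with isR lam (suc c) in eq
  ... | true = ≤-refl , inj₂ eq , λ k p q → contradiction q (<⇒≱ p)
  ... | false with botGo-spec c
  ...   | p , q , r = m≤n⇒m≤1+n p , q , above
    where
    above : ∀ k → botGo lam c < k → k ≤ suc c → NoCut k
    above k a b with k ≟ suc c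
    ... | yes refl = eq
    ... | no ne = r k a (s≤s⁻¹ (≤∧≢⇒< b ne))

  module _ {i : ℕ} (i≤n : i ≤ n) where
    private spec = topGo-spec (n ∸ i) i (m+[n∸m]≡n i≤n)
    top-≥ : i ≤ top lam i
    top-≥ = proj₁ spec
    top-≤ : top lam i ≤ n
    top-≤ = proj₁ (proj₂ spec)
    top-Cut : Cut (top lam i)
    top-Cut = proj₁ (proj₂ (proj₂ spec))
    top-NoCut : ∀ k → i ≤ k → k < top lam i → NoCut k
    top-NoCut = proj₂ (proj₂ (proj₂ spec))

  bot-< : ∀ {i} → 1 ≤ i → bot lam i < i
  bot-< {suc i} _ = s≤s (proj₁ (botGo-spec i))

  bot-R : ∀ i → bot lam i ≡ 0 ⊎ R (bot lam i)
  bot-R i = proj₁ (proj₂ (botGo-spec (i ∸ 1)))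

  bot-NoCut : ∀ {i} → 1 ≤ i → ∀ k → bot lam i < k → k < i → NoCut k
  bot-NoCut {suc i} _ k p q = proj₂ (proj₂ (botGo-spec i)) k p (s≤s⁻¹ q)

  R⇒ : ∀ {q} → R q → 1 ≤ q × q < n
  R⇒ {q} r with Equivalence.to T-∧ (≡⇒T r)
  ... | a , b = ≤ᵇ⇒≤ 1 q a , <ᵇ⇒< q n (proj₁ (Equivalence.to T-∧ b))

  top-unique : ∀ {i x} → i ≤ x → x ≤ n → Cut x → (∀ k → i ≤ k → k < x → NoCut k) → top lam i ≡ x
  top-unique {i} {x} p q c none = ≤-antisym (≮⇒≥ λ lt → up lt c) (≮⇒≥ λ lt → down lt (top-Cut i≤n))
    where
    i≤n = ≤-trans p q
    up : x < top lam i → Cut x → ⊥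
    up lt (inj₁ r) = ¬R∧NoCut r (top-NoCut i≤n x p lt)
    up lt (inj₂ refl) = <⇒≱ lt (top-≤ i≤n)
    down : top lam i < x → Cut (top lam i) → ⊥
    down lt (inj₁ r) = ¬R∧NoCut r (none _ (top-≥ i≤n) lt)
    down lt (inj₂ e) = <⇒≱ lt (subst (x ≤_) (sym e) q)

  bot-unique : ∀ {i x} → x < i → x ≡ 0 ⊎ R x → (∀ k → x < k → k < i → NoCut k) → bot lam i ≡ x
  bot-unique {i} {x} p c none = ≤-antisym (≮⇒≥ λ lt → up lt (bot-R i)) (≮⇒≥ λ lt → down lt c)
    where
    i≥1 = ≤-trans (s≤s z≤n) p
    up : x < bot lam i → bot lam i ≡ 0 ⊎ R (bot lam i) → ⊥
    up lt (inj₁ e) = contradiction (≤-trans lt (≤-reflexive e)) λ ()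
    up lt (inj₂ r) = ¬R∧NoCut r (none _ lt (bot-< i≥1))
    down : bot lam i < x → x ≡ 0 ⊎ R x → ⊥
    down lt (inj₁ refl) = contradiction lt λ ()
    down lt (inj₂ r) = ¬R∧NoCut r (bot-NoCut i≥1 x lt p)

  module _ {i : ℕ} (i≥1 : 1 ≤ i) (i≤n : i ≤ n) where
    carrel-NoCut : ∀ k → bot lam i < k → k < top lam i → NoCut k
    carrel-NoCut k p q with k <? i
    ... | yes lt = bot-NoCut i≥1 k p lt
    ... | no ge = top-NoCut i≤n k (≮⇒≥ ge) q

    top-carrel : ∀ {k} → bot lam i < k → k ≤ top lam i → top lam k ≡ top lam i
    top-carrel {k} p q = top-unique q (top-≤ i≤n) (top-Cut i≤n) λ j a b → carrel-NoCut j (<-≤-trans p a) b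

  Cut⇒≤n : ∀ {q} → Cut q → q ≤ n
  Cut⇒≤n (inj₁ r) = <⇒≤ (proj₂ (R⇒ r))
  Cut⇒≤n (inj₂ e) = ≤-reflexive e

  top-of-Cut : ∀ {q} → Cut q → top lam q ≡ q
  top-of-Cut c = top-unique ≤-refl (Cut⇒≤n c) c λ k p q → contradiction p (<⇒≱ q)

  top-≤-Cut : ∀ {i q} → i ≤ q → Cut q → top lam i ≤ q
  top-≤-Cut {i} {q} p c = ≮⇒≥ λ lt → go lt c
    where
    i≤n = ≤-trans p (Cut⇒≤n c)
    go : q < top lam i → Cut q → ⊥
    go lt (inj₁ r) = ¬R∧NoCut r (top-NoCut i≤n q p lt)
    go lt (inj₂ refl) = <⇒≱ lt (top-≤ i≤n)


  NoCut⇒<top : ∀ {i} → i < n → NoCut i → i < top lam i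
  NoCut⇒<top {i} i<n nc = ≤∧≢⇒< (top-≥ (<⇒≤ i<n)) λ e → go (subst Cut (sym e) (top-Cut (<⇒≤ i<n)))
    where
    go : Cut i → ⊥
    go (inj₁ r) = ¬R∧NoCut r nc
    go (inj₂ e) = <⇒≢ i<n e

  -- Critical indices

  module _ (β : Vec ℕ n) where

    -- Within a carrel the critical indices are the strict right-to-left minima of β_z − z.
    IsMin : ℕ → ℕ → Set
    IsMin y x = ∀ z → y < z → z ≤ x → at β y + z < at β z + y

    findDown-just : ∀ p lo k {y} → findDown p lo k ≡ just y → lo < y × y ≤ k × T (p y) × (∀ z → y < z → z ≤ k → ¬ T (p z))
    findDown-just p lo (suc k) e with lo <ᵇ suc k in lt
    ... | true with p (suc k) in pk
    ...   | true with refl ← just-injective e = <ᵇ⇒< lo (suc k) (≡⇒T lt) , ≤-refl , ≡⇒T pk , λ z a b → contradiction b (<⇒≱ a)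
    ...   | false with findDown-just p lo k e
    ...     | a , b , c , d = a , m≤n⇒m≤1+n b , c , below
      where
      below : ∀ z → _ < z → z ≤ suc k → ¬ T (p z)
      below z u w with z ≟ suc k
      ... | yes refl = λ t → contradiction (trans (sym (T⇒≡ t)) pk) λ ()
      ... | no ne = d z u (s≤s⁻¹ (≤∧≢⇒< w ne))

    findDown-nothing : ∀ p lo k → findDown p lo k ≡ nothing → ∀ z → lo < z → z ≤ k → ¬ T (p z)
    findDown-nothing p lo zero e z a b = contradiction b (<⇒≱ (≤-<-trans z≤n a))
    findDown-nothing p lo (suc k) e z a b t with lo <ᵇ suc k in lt
    ... | false = contradiction (trans (sym (T⇒≡ (<⇒<ᵇ (<-≤-trans a b)))) lt) λ ()
    ... | true with p (suc k) in pk
    ...   | false with z ≟ suc k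
    ...     | yes refl = contradiction (trans (sym (T⇒≡ t)) pk) λ ()
    ...     | no ne = findDown-nothing p lo k e z a (s≤s⁻¹ (≤∧≢⇒< b ne)) t

    private
      shuffle : ∀ a b j k → (a + j) + (b + k) ≡ (b + j) + (a + k)
      shuffle = solve-∀
      shuffle' : ∀ b c i j → (b + i) + (c + j) ≡ (b + j) + (c + i)
      shuffle' = solve-∀

    -- Transitivity a - i < b - j ≤ c - k, written without subtraction.
    <-chain : ∀ {a b c i j k} → a + j < b + i → b + k ≤ c + j → a + k < c + i
    <-chain {a} {b} {c} {i} {j} {k} p q = +-cancelˡ-< (b + j) _ _
      (subst₂ _<_ (shuffle a b j k) (shuffle' b c i j) (+-mono-<-≤ p q))

    ≤-chain : ∀ {a b c i j k} → a + j ≤ b + i → b + k < c + j → a + k < c + i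
    ≤-chain {a} {b} {c} {i} {j} {k} p q = +-cancelˡ-< (b + j) _ _
      (subst₂ _<_ (shuffle a b j k) (shuffle' b c i j) (+-mono-≤-< p q))

    -- An index z between two consecutive critical ones was rejected by the search, so β_z - z is at
    -- least the value at the larger of the two, which exceeds the value at y.
    ∈-critsGo⁻ : ∀ lo f x {y} → lo < x → y ∈ critsGo β lo f x → lo < y × y ≤ x × IsMin y x
    ∈-critsGo⁻ lo zero x lt (here refl) = lt , ≤-refl , λ z a b → contradiction b (<⇒≱ a)
    ∈-critsGo⁻ lo (suc f) x lt (here refl) = lt , ≤-refl , λ z a b → contradiction b (<⇒≱ a)
    ∈-critsGo⁻ lo (suc f) (suc x) {y} lt (there y∈) with nextCrit β lo (suc x) in eq
    ... | just y' with findDown-just _ lo x eq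
    ...   | a , b , c , d with ∈-critsGo⁻ lo f y' a y∈
    ...     | a' , b' , m = a' , ≤-trans b' (m≤n⇒m≤1+n b) , min
      where
      y'≺x : at β y' + suc x < at β (suc x) + y'
      y'≺x = <ᵇ⇒< _ _ c
      y≼y' : at β y + y' ≤ at β y' + y
      y≼y' with y ≟ y'
      ... | yes refl = ≤-refl
      ... | no ne = <⇒≤ (m y' (≤∧≢⇒< b' ne) ≤-refl)
      y≺x : at β y + suc x < at β (suc x) + y
      y≺x = ≤-chain {a = at β y} {b = at β y'} y≼y' y'≺x
      min : IsMin y (suc x)
      min z u w with z ≤? y' | z ≟ suc x
      ... | yes p | _ = m z u p
      ... | no p | yes refl = y≺x
      ... | no p | no ne = <-chain {a = at β y} {b = at β (suc x)} y≺x
              (≮⇒≥ λ t → d z (≰⇒> p) (s≤s⁻¹ (≤∧≢⇒< w ne)) (<⇒<ᵇ t))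

    -- A strict right-to-left minimum y < x satisfies the search condition at x. The search thus
    -- stops at y or to the right of it and never skips y.
    ∈-critsGo⁺ : ∀ lo f x {y} → x ≤ f → lo < y → y ≤ x → IsMin y x → y ∈ critsGo β lo f x
    ∈-critsGo⁺ lo zero zero le lt z≤n m = here refl
    ∈-critsGo⁺ lo (suc f) zero le lt z≤n m = here refl
    ∈-critsGo⁺ lo (suc f) (suc x) {y} (s≤s le) lt y≤ m with y ≟ suc x
    ... | yes refl = here refl
    ... | no ne = there (rest (nextCrit β lo (suc x)) refl)
      where
      y≤x = s≤s⁻¹ (≤∧≢⇒< y≤ ne)
      y≺x : T ((at β y + suc x) <ᵇ (at β (suc x) + y))
      y≺x = <⇒<ᵇ (m (suc x) (s≤s y≤x) ≤-refl)
      rest : ∀ o → nextCrit β lo (suc x) ≡ o → y ∈ critsGoM β lo f o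
      rest nothing eq = contradiction y≺x (findDown-nothing _ lo x eq y lt y≤x)
      rest (just y') eq with findDown-just _ lo x eq
      ... | a , b , c , d = ∈-critsGo⁺ lo f y' (≤-trans b le) lt (≮⇒≥ λ t → d y t y≤x y≺x)
              (λ z u w → m z u (≤-trans w (m≤n⇒m≤1+n b)))

    crit⇒IsMin : ∀ {i} → 1 ≤ i → i ≤ n → T (isCrit lam β i) → IsMin i (top lam i)
    crit⇒IsMin {i} a b t = proj₂ (proj₂ (∈-critsGo⁻ (bot lam i) (top lam i) (top lam i)
      (<-≤-trans (bot-< a) (top-≥ b)) (memb⇒∈ t)))

    IsMin⇒crit : ∀ {i} → 1 ≤ i → i ≤ n → IsMin i (top lam i) → T (isCrit lam β i)
    IsMin⇒crit {i} a b m = ∈⇒memb (∈-critsGo⁺ (bot lam i) (top lam i) (top lam i) ≤-refl (bot-< a) (top-≥ b) m)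

    upGo-spec : ∀ (p : ℕ → Bool) f c → T (p (c + f)) → c ≤ upGo p f c × upGo p f c ≤ c + f × T (p (upGo p f c)) ×
      (∀ k → c ≤ k → k < upGo p f c → ¬ T (p k))
    upGo-spec p zero c t rewrite +-identityʳ c = ≤-refl , ≤-refl , t , λ k a b → contradiction a (<⇒≱ b)
    upGo-spec p (suc f) c t with p c in eq
    ... | true = ≤-refl , m≤m+n c _ , ≡⇒T eq , λ k a b → contradiction a (<⇒≱ b)
    ... | false with upGo-spec p f (suc c) (subst (λ z → T (p z)) (+-suc c f) t)
    ...   | a , b , d , e = <⇒≤ a , ≤-trans b (≤-reflexive (sym (+-suc c f))) , d , below
      where
      below : ∀ k → c ≤ k → k < upGo p f (suc c) → ¬ T (p k)
      below k u w with c ≟ k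
      ... | yes refl = λ t → contradiction (trans (sym (T⇒≡ t)) eq) λ ()
      ... | no ne = e k (≤∧≢⇒< u ne) w

    nextCritical : ℕ → ℕ
    nextCritical i = upGo (isCrit lam β) (top lam i ∸ i) i

    at-Delta : ∀ {i} → 1 ≤ i → i ≤ n → at (Delta lam β) i ≡ at β (nextCritical i) ∸ (nextCritical i ∸ i)
    at-Delta {i} a b = at-tab n (λ k → at β (nextCritical k) ∸ (nextCritical k ∸ k)) i a b

    top-critical : ∀ {i} → 1 ≤ i → i ≤ n → T (isCrit lam β (top lam i))
    top-critical {i} a b = IsMin⇒crit (≤-trans a (top-≥ b)) (top-≤ b)
      (subst (IsMin (top lam i)) (sym (top-of-Cut (top-Cut b))) λ z u w → contradiction w (<⇒≱ u))

    module _ {i : ℕ} (i≥1 : 1 ≤ i) (i≤n : i ≤ n) where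
      private
        x = nextCritical i
        spec = upGo-spec (isCrit lam β) (top lam i ∸ i) i
          (subst (λ z → T (isCrit lam β z)) (sym (m+[n∸m]≡n (top-≥ i≤n))) (top-critical i≥1 i≤n))

      nextCritical-≥ : i ≤ nextCritical i
      nextCritical-≥ = proj₁ spec
      nextCritical-≤top : nextCritical i ≤ top lam i
      nextCritical-≤top = ≤-trans (proj₁ (proj₂ spec)) (≤-reflexive (m+[n∸m]≡n (top-≥ i≤n)))
      nextCritical-≤n : nextCritical i ≤ n
      nextCritical-≤n = ≤-trans nextCritical-≤top (top-≤ i≤n)
      nextCritical-critical : T (isCrit lam β (nextCritical i))
      nextCritical-critical = proj₁ (proj₂ (proj₂ spec))
      nextCritical-least : ∀ k → i ≤ k → k < nextCritical i → ¬ T (isCrit lam β k)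
      nextCritical-least = proj₂ (proj₂ (proj₂ spec))

      top-nextCritical : top lam (nextCritical i) ≡ top lam i
      top-nextCritical = top-carrel i≥1 i≤n (<-≤-trans (bot-< i≥1) nextCritical-≥) nextCritical-≤top

      -- Going down from x to i, an index k with β_k - k < β_x - x would be a strict right-to-left
      -- minimum, hence a critical index in [i , x), against the choice of x.
      nextCritical-minimizes : at β (nextCritical i) + i ≤ at β i + nextCritical i
      nextCritical-minimizes with i ≟ x
      ... | yes e = subst (λ z → at β z + i ≤ at β i + z) e ≤-refl
      ... | no ne = go (x ∸ i) i (m+[n∸m]≡n nextCritical-≥) ≤-refl i ≤-refl (≤∧≢⇒< nextCritical-≥ ne)
        where
        min-x : IsMin x (top lam i)
        min-x = subst (IsMin x) top-nextCritical (crit⇒IsMin (≤-trans i≥1 nextCritical-≥) nextCritical-≤n nextCritical-critical)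
        go : ∀ d k → k + d ≡ x → i ≤ k → ∀ y → k ≤ y → y < x → at β x + y ≤ at β y + x
        go zero k e i≤k y a b = contradiction (≤-trans (≤-reflexive (sym (trans (sym (+-identityʳ k)) e))) a) (<⇒≱ b)
        go (suc d) k e i≤k y a b with k ≟ y
        ... | no ne = go d (suc k) (trans (sym (+-suc k d)) e) (m≤n⇒m≤1+n i≤k) y (≤∧≢⇒< a ne) b
        ... | yes refl = ≮⇒≥ λ lt → nextCritical-least k i≤k b (IsMin⇒crit (≤-trans i≥1 i≤k) (≤-trans (<⇒≤ b) nextCritical-≤n)
                (subst (IsMin k) (sym (top-carrel i≥1 i≤n (<-≤-trans (bot-< i≥1) i≤k) (≤-trans (<⇒≤ b) nextCritical-≤top))) (min lt)))
          where
          min : at β k + x < at β x + k → IsMin k (top lam i)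
          min lt z u w with <-cmp z x
          ... | tri< z<x _ _ = <-chain {a = at β k} {b = at β x} lt (go d (suc k) (trans (sym (+-suc k d)) e) (m≤n⇒m≤1+n i≤k) z u z<x)
          ... | tri≈ _ refl _ = lt
          ... | tri> _ _ x<z = ≤-chain {a = at β k} {b = at β x} (<⇒≤ lt) (min-x z x<z w)

    nextCritical-mono : ∀ {i} → 1 ≤ i → suc i ≤ n → nextCritical i ≤ nextCritical (suc i)
    nextCritical-mono {i} i≥1 i<n = ≮⇒≥ λ lt → nextCritical-least i≥1 (<⇒≤ i<n) _ (<⇒≤ (nextCritical-≥ (s≤s z≤n) i<n)) lt
      (nextCritical-critical (s≤s z≤n) i<n)

    nextCritical-step : ∀ {i k} → 1 ≤ i → i ≤ n → i ≤ k → k ≤ nextCritical i → nextCritical k ≡ nextCritical i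
    nextCritical-step {i} {k} i≥1 i≤n p q = ≤-antisym
        (≮⇒≥ λ lt → nextCritical-least k≥1 k≤n _ q lt (nextCritical-critical i≥1 i≤n))
        (≮⇒≥ λ lt → nextCritical-least i≥1 i≤n _ (≤-trans p (nextCritical-≥ k≥1 k≤n)) lt (nextCritical-critical k≥1 k≤n))
      where
      k≥1 = ≤-trans i≥1 p
      k≤n = ≤-trans q (nextCritical-≤n i≥1 i≤n)

AllPairs-∈ : ∀ {A : Set} {S R : A → A → Set} {xs} → AllPairs S xs →
  (∀ {x y} → x ∈ xs → y ∈ xs → S x y → R x y) → AllPairs R xs
AllPairs-∈ [] f = []
AllPairs-∈ (p ∷ ps) f = All.tabulate (λ y∈ → f (here refl) (there y∈) (All.lookup p y∈)) ∷
  AllPairs-∈ ps (λ x∈ y∈ → f (there x∈) (there y∈))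

range-+ : ∀ b k → range (b + k) ≡ range b ++ map (b +_) (range k)
range-+ b zero rewrite +-identityʳ b = sym (++-identityʳ (range b))
range-+ b (suc k) rewrite +-suc b k | range-+ b k | map-++ (b +_) (range k) [ suc k ] | +-suc b k =
  ++-assoc (range b) (map (b +_) (range k)) _

cnt-full : ∀ {v xs} → length xs ≤ cnt v xs → All (_≤ v) xs
cnt-full {v} {[]} p = []
cnt-full {v} {x ∷ xs} p with x ≤? v
... | yes q = q ∷ cnt-full (s≤s⁻¹ p)
... | no q = contradiction (≤-trans p (cnt≤length v xs)) (n≮n _)

cnt-map-range-mono : ∀ v {f g : ℕ → ℕ} {c c'} → c' ≤ c → (∀ i → 1 ≤ i → i ≤ c' → f i ≤ g i) →
  cnt v (map g (range c')) ≤ cnt v (map f (range c))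
cnt-map-range-mono v {f} {g} {c} {c'} le h with c' ≟ c
cnt-map-range-mono v {f} {g} {zero} {zero} le h | yes refl = z≤n
cnt-map-range-mono v {f} {g} {suc c} {suc c} le h | yes refl
  rewrite map-range-suc f c | map-range-suc g c | cnt-++ v (map f (range c)) [ f (suc c) ] | cnt-++ v (map g (range c)) [ g (suc c) ] =
  +-mono-≤ (cnt-map-range-mono v {f} {g} ≤-refl (λ i a b → h i a (m≤n⇒m≤1+n b)))
    (+-monoˡ-≤ 0 (ind-anti v (h (suc c) (s≤s z≤n) ≤-refl)))
cnt-map-range-mono v {f} {g} {zero} {c'} le h | no ne = contradiction (n≤0⇒n≡0 le) ne
cnt-map-range-mono v {f} {g} {suc c} {c'} le h | no ne
  rewrite map-range-suc f c | cnt-++ v (map f (range c)) [ f (suc c) ] =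
  ≤-trans (cnt-map-range-mono v {f} {g} (s≤s⁻¹ (≤∧≢⇒< le ne)) h) (m≤m+n _ _)

-- The sets B_h of a permutation

∈-prefix⁺ : ∀ {n} (π : Vec ℕ n) {a q} → 1 ≤ a → a ≤ q → at π a ∈ prefix π q
∈-prefix⁺ π p q = ∈-map⁺ (at π) (∈-range⁺ p q)

∈-prefix⁻ : ∀ {n} (π : Vec ℕ n) {v} q → v ∈ prefix π q → ∃ λ a → 1 ≤ a × a ≤ q × v ≡ at π a
∈-prefix⁻ π q v∈ with ∈-map⁻ (at π) v∈
... | a , a∈ , e = a , proj₁ (∈-range⁻ {m = q} a∈) , proj₂ (∈-range⁻ {m = q} a∈) , e

prefix-⊆ : ∀ {n} (π : Vec ℕ n) {v q q'} → q ≤ q' → v ∈ prefix π q → v ∈ prefix π q'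
prefix-⊆ π {q = q} le v∈ with ∈-prefix⁻ π q v∈
... | a , p , r , refl = ∈-prefix⁺ π p (≤-trans r le)

cnt-prefix-mono : ∀ {n} (π : Vec ℕ n) v {q q'} → q ≤ q' → cnt v (prefix π q) ≤ cnt v (prefix π q')
cnt-prefix-mono π v le = cnt-map-range-mono v {at π} {at π} le λ i _ _ → ≤-refl

length-prefix : ∀ {n} (π : Vec ℕ n) q → length (prefix π q) ≡ q
length-prefix π q = length-map-range (at π) q

module Sets {n : ℕ} (π : Vec ℕ n) (perm : IsPerm π) where

  P B : ℕ → List ℕ
  P q = prefix π q
  B q = setOf n (prefix π q)

  P-bounds : ∀ {v q} → q ≤ n → v ∈ P q → 1 ≤ v × v ≤ n
  P-bounds {q = q} q≤n v∈ with ∈-prefix⁻ π q v∈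
  ... | a , p , r , refl = proj₁ perm a p (≤-trans r q≤n)

  P-Unique : ∀ {q} → q ≤ n → AllPairs _≢_ (P q)
  P-Unique {q} q≤n = AllPairs.map⁺ (AllPairs-∈ (Inc-range q) λ {x} {y} x∈ y∈ lt →
    proj₂ perm x y (proj₁ (∈-range⁻ {m = q} x∈)) lt (≤-trans (proj₂ (∈-range⁻ {m = q} y∈)) q≤n))

  B⇒P : ∀ {v} q → v ∈ B q → v ∈ P q
  B⇒P q v∈ = memb⇒∈ (proj₂ (filterB-∈⁻ (λ v → memb v (P q)) (range n) v∈))

  P⇒B : ∀ {v q} → q ≤ n → v ∈ P q → v ∈ B q
  P⇒B {q = q} q≤n v∈ = filterB-∈⁺ (λ v → memb v (P q)) (range n)
    (∈-range⁺ (proj₁ (P-bounds q≤n v∈)) (proj₂ (P-bounds q≤n v∈))) (∈⇒memb v∈)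

  Inc-B : ∀ q → Inc (B q)
  Inc-B q = Inc-filterB _ (Inc-range n)

  B-↭ : ∀ {q} → q ≤ n → B q ↭ P q
  B-↭ {q} q≤n = ∼bag⇒↭ (unique∧set⇒bag (Inc⇒Unique (Inc-B q)) (P-Unique q≤n) (mk⇔ (B⇒P q) (P⇒B q≤n)))

  cnt-B : ∀ v {q} → q ≤ n → cnt v (B q) ≡ cnt v (P q)
  cnt-B v q≤n = cnt-↭ v (B-↭ q≤n)

  length-B : ∀ {q} → q ≤ n → length (B q) ≡ q
  length-B {q} q≤n = trans (↭-length (B-↭ q≤n)) (length-prefix π q)

  cnt≤q : ∀ v q → cnt v (P q) ≤ q
  cnt≤q v q = subst (cnt v (P q) ≤_) (length-prefix π q) (cnt≤length v (P q))

  cnt-P-n : ∀ {q} → q ≤ n → cnt n (P q) ≡ q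
  cnt-P-n {q} q≤n = trans (cnt-all n (All.tabulate λ v∈ → proj₂ (P-bounds q≤n v∈))) (length-prefix π q)

  private
    len≤ : ∀ {i q} → q ≤ n → i ≤ q → i ≤ length (B q)
    len≤ q≤n = subst (_ ≤_) (sym (length-B q≤n))

  nth-B-∈ : ∀ {q i} → q ≤ n → 1 ≤ i → i ≤ q → nth (B q) i ∈ P q
  nth-B-∈ {q} {i} q≤n i≥1 i≤q = B⇒P q (nth-∈ (B q) i i≥1 (len≤ q≤n i≤q))

  nth-B-≤ : ∀ {q i v} → q ≤ n → 1 ≤ i → i ≤ cnt v (P q) → nth (B q) i ≤ v
  nth-B-≤ {q} {v = v} q≤n i≥1 p = cnt⇒nth (Inc-B q) i≥1 (subst (_ ≤_) (sym (cnt-B v q≤n)) p)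

  ≤-cnt-P : ∀ {q i v} → q ≤ n → 1 ≤ i → i ≤ q → nth (B q) i ≤ v → i ≤ cnt v (P q)
  ≤-cnt-P {q} {v = v} q≤n i≥1 i≤q p = subst (_ ≤_) (cnt-B v q≤n) (nth⇒cnt (Inc-B q) i≥1 (len≤ q≤n i≤q) p)

  cnt-P-nth : ∀ {q i} → q ≤ n → 1 ≤ i → i ≤ q → cnt (nth (B q) i) (P q) ≡ i
  cnt-P-nth {q} q≤n i≥1 i≤q = trans (sym (cnt-B _ q≤n)) (cnt-nth (Inc-B q) i≥1 (len≤ q≤n i≤q))

  nth-B-mono : ∀ {q i j} → q ≤ n → 1 ≤ i → i < j → j ≤ q → nth (B q) i < nth (B q) j
  nth-B-mono {q} q≤n i≥1 i<j j≤q = nth-mono (Inc-B q) i≥1 i<j (len≤ q≤n j≤q)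

  nth-B-anti : ∀ {q q' i} → q ≤ q' → q' ≤ n → 1 ≤ i → i ≤ q → nth (B q') i ≤ nth (B q) i
  nth-B-anti le q'≤n i≥1 i≤q = nth-B-≤ q'≤n i≥1
    (≤-trans (≤-cnt-P (≤-trans le q'≤n) i≥1 i≤q ≤-refl) (cnt-prefix-mono π _ le))

  cnt-P≤ : ∀ v {q} → q ≤ n → cnt v (P q) ≤ v
  cnt-P≤ v {q} q≤n = subst (λ z → cnt v (P q) ≤ z + v)
    (cnt-none 0 (All.tabulate λ v∈ → proj₁ (P-bounds q≤n v∈))) (cnt-Lip (P-Unique q≤n) z≤n)

  nth-B-≥ : ∀ {q i} → q ≤ n → 1 ≤ i → i ≤ q → i ≤ nth (B q) i
  nth-B-≥ {q} q≤n i≥1 i≤q = ≤-trans (≤-reflexive (sym (cnt-P-nth q≤n i≥1 i≤q))) (cnt-P≤ _ q≤n)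

  nth-B-full : ∀ {i} → 1 ≤ i → i ≤ n → nth (B n) i ≡ i
  nth-B-full {i} i≥1 i≤n = ≤-antisym (nth-B-≤ ≤-refl i≥1 (+-cancelʳ-≤ (n ∸ i) _ _
      (subst₂ _≤_ (trans (cnt-P-n ≤-refl) (sym (m+[n∸m]≡n i≤n))) refl (cnt-Lip (P-Unique ≤-refl) i≤n))))
    (nth-B-≥ ≤-refl i≥1 i≤n)

  P-full : ∀ {v} → 1 ≤ v → v ≤ n → v ∈ P n
  P-full v≥1 v≤n = subst (_∈ P n) (nth-B-full v≥1 v≤n) (nth-B-∈ ≤-refl v≥1 v≤n)

-- Filling of gaps

-- B arises from A by adding elements > max A and by filling up an interval that ends at max A.
record Fill (A B : List ℕ) : Set where
  constructor fill
  field
    start : ℕ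
    below : ∀ v → v < start → cnt v B ≤ cnt v A
    above : ∀ w m → start ≤ w → w ≤ m → m ∈ A → w ∈ B
open Fill public

-- The smaller of the two thresholds serves: either C is already filled up to the elements of B,
-- among them those of A, or the filling present in B persists in C.
Fill-trans : ∀ {A B C} → (∀ {v} → v ∈ A → v ∈ B) → (∀ {v} → v ∈ B → v ∈ C) → Fill A B → Fill B C → Fill A C
Fill-trans ⊆₁ ⊆₂ (fill x lo hi) (fill y lo' hi') with y ≤? x
... | yes p = fill y (λ v q → ≤-trans (lo' v q) (lo v (<-≤-trans q p))) (λ w m a b c → hi' w m a b (⊆₁ c))
... | no p = fill x (λ v q → ≤-trans (lo' v (<-trans q (≰⇒> p))) (lo v q)) (λ w m a b c → ⊆₂ (hi w m a b c))

Fill-refl : ∀ {A} → Fill A A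
Fill-refl {A} with upperBound A
... | u , ps = fill (suc u) (λ v _ → ≤-refl) (λ w m a b c → contradiction (≤-trans a (≤-trans b (All.lookup ps c))) (n≮n u))

Fill-cnt : ∀ {A B v m} (f : Fill A B) → start f ≤ v → v ≤ m → m ∈ A → cnt v B + (m ∸ v) ≤ cnt m B
Fill-cnt f p q m∈ = cnt-interval q λ w a b → above f w _ (≤-trans p (<⇒≤ a)) b m∈

module Avoiding {n : ℕ} (lam : Vec ℕ n) (π : Vec ℕ n) (av : S312 lam π) where
  open Carrels lam
  perm : IsPerm π
  perm = proj₁ (proj₁ av)
  open Sets π perm public

  carrel-increasing : ∀ {b i j} → (∀ k → b < k → k < j → NoCut k) → b < i → i ≤ j → j ≤ n → at π i ≤ at π j
  carrel-increasing {b} {i} {j} none b<i i≤j j≤n = go (j ∸ i) j (m+[n∸m]≡n i≤j) ≤-refl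
    where
    go : ∀ d k → i + d ≡ k → k ≤ j → at π i ≤ at π k
    go zero k e k≤j rewrite +-identityʳ i | e = ≤-refl
    go (suc d) k e k≤j with trans (sym (+-suc i d)) e
    ... | refl = ≤-trans (go d (i + d) refl (<⇒≤ k≤j)) (<⇒≤ (proj₂ (proj₁ av) (i + d) (≤-trans (≤-trans (s≤s z≤n) b<i) (m≤m+n i d))
            (<-≤-trans k≤j j≤n) (none (i + d) (<-≤-trans b<i (m≤m+n i d)) k≤j)))

  module Next {b q : ℕ} (Rb : R b) (top≡ : top lam (suc b) ≡ q) where
    b<n : b < n
    b<n = proj₂ (R⇒ Rb)
    b<q : b < q
    b<q = subst (b <_) top≡ (top-≥ b<n)
    q≤n : q ≤ n
    q≤n = subst (_≤ n) top≡ (top-≤ b<n)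

    new-element : ∀ {v} → at π (suc b) ≤ v → b ≤ cnt v (P b) → b < cnt v (P q)
    new-element {v} p full = <-≤-trans (s≤s full) (≤-trans (≤-reflexive (trans (+-comm 1 _)
        (trans (cong (cnt v (P b) +_) (sym (trans (+-identityʳ _) (ind-≤ p))))
          (trans (sym (cnt-++ v (P b) [ at π (suc b) ])) (cong (cnt v) (sym (map-range-suc (at π) b)))))))
      (cnt-prefix-mono π v b<q))

    -- The threshold is π_{b+1}, the smallest of the elements added in this carrel. A value missing
    -- from B_q between π_{b+1} and some π_a with a ≤ b is π_c for some c > q, and then a, b + 1, c
    -- form a forbidden pattern.
    Fill-next : Fill (P b) (P q)
    Fill-next = fill (at π (suc b)) lo hi
      where
      lo : ∀ v → v < at π (suc b) → cnt v (P q) ≤ cnt v (P b)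
      lo v lt = subst (λ z → cnt v (P z) ≤ cnt v (P b)) (m+[n∸m]≡n (<⇒≤ b<q))
          (≤-reflexive (trans (cong (cnt v) split) (trans (cnt-++ v (P b) _)
            (trans (cong (cnt v (P b) +_) (cnt-none v (All.tabulate late))) (+-identityʳ _)))))
        where
        split : P (b + (q ∸ b)) ≡ P b ++ map (at π) (map (b +_) (range (q ∸ b)))
        split = trans (cong (map (at π)) (range-+ b (q ∸ b))) (map-++ (at π) (range b) _)
        late : ∀ {x} → x ∈ map (at π) (map (b +_) (range (q ∸ b))) → v < x
        late x∈ with ∈-map⁻ (at π) x∈
        ... | a , a∈ , refl with ∈-map⁻ (b +_) a∈
        ... | k , k∈ , refl with ∈-range⁻ {m = q ∸ b} k∈
        ... | k≥1 , k≤ = <-≤-trans lt (carrel-increasing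
              (λ l r s → top-NoCut b<n l r (<-≤-trans s (≤-trans b+k≤q (≤-reflexive (sym top≡))))) (n<1+n b)
              (≤-trans (≤-reflexive (+-comm 1 b)) (+-monoʳ-≤ b k≥1)) (≤-trans b+k≤q q≤n))
          where b+k≤q = ≤-trans (+-monoʳ-≤ b k≤) (≤-reflexive (m+[n∸m]≡n (<⇒≤ b<q)))
      hi : ∀ w m → at π (suc b) ≤ w → w ≤ m → m ∈ P b → w ∈ P q
      hi w m p r m∈ with w ∈? P q
      ... | yes w∈ = w∈
      ... | no w∉ with P-full (≤-trans (proj₁ (P-bounds b<n (∈-prefix⁺ π (s≤s z≤n) ≤-refl))) p) (≤-trans r (proj₂ (P-bounds (<⇒≤ b<n) m∈)))
      ... | w∈n with ∈-prefix⁻ π n w∈n | ∈-prefix⁻ π b m∈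
      ... | c , c≥1 , c≤n , refl | a , a≥1 , a≤b , refl = contradiction
            (≤∧≢⇒< r (λ e → w∉ (subst (_∈ P q) (sym e) (∈-prefix⁺ π a≥1 (≤-trans a≤b (<⇒≤ b<q))))) ,
             ≤∧≢⇒< p (λ e → w∉ (subst (_∈ P q) e (∈-prefix⁺ π (s≤s z≤n) b<q))))
            (proj₂ av b a (suc b) c (≡⇒T Rb) (≡⇒T (subst R (sym top≡) (Rq (subst Cut top≡ (top-Cut b<n))))) a≥1 a≤b ≤-refl
              (subst (b <_) (sym top≡) b<q) (subst (_< c) (sym top≡) q<c) c≤n)
        where
        q<c : q < c
        q<c = ≰⇒> λ c≤q → w∉ (∈-prefix⁺ π c≥1 c≤q)
        -- The pattern is forbidden only for q in R_λ; if q = n, there is no position c after q.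
        Rq : Cut q → R q
        Rq (inj₁ x) = x
        Rq (inj₂ e) = contradiction (<-≤-trans q<c c≤n) (λ lt → n≮n n (subst (_< n) e lt))

  Fill-Cut : ∀ {q q'} → R q → q ≤ q' → Cut q' → Fill (P q) (P q')
  Fill-Cut {q} {q'} Rq = go q' ≤-refl
    where
    go : ∀ f {q'} → q' ≤ f → q ≤ q' → Cut q' → Fill (P q) (P q')
    go f {q'} q'≤f le c with q ≟ q'
    ... | yes refl = Fill-refl
    go zero {q'} q'≤f le c | no ne = contradiction (trans (n≤0⇒n≡0 (≤-trans le q'≤f)) (sym (n≤0⇒n≡0 q'≤f))) ne
    go (suc f) {q'} q'≤f le c | no ne with bot-R q'
    ... | inj₁ e = contradiction (bot-NoCut q'≥1 q (subst (_< q) (sym e) (proj₁ (R⇒ Rq))) q<q') (¬R∧NoCut Rq)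
      where
      q<q' = ≤∧≢⇒< le ne
      q'≥1 = ≤-trans (s≤s z≤n) q<q'
    ... | inj₂ Rb = Fill-trans (prefix-⊆ π q≤b) (prefix-⊆ π (<⇒≤ b<q')) (go f (s≤s⁻¹ (<-≤-trans b<q' q'≤f)) q≤b (inj₁ Rb))
          (Next.Fill-next Rb top≡)
      where
      q<q' = ≤∧≢⇒< le ne
      q'≥1 = ≤-trans (s≤s z≤n) q<q'
      b<q' = bot-< q'≥1
      q≤b : q ≤ bot lam q'
      q≤b = ≮⇒≥ λ lt → ¬R∧NoCut Rq (bot-NoCut q'≥1 q lt q<q')
      top≡ : top lam (suc (bot lam q')) ≡ q'
      top≡ = trans (top-carrel q'≥1 (Cut⇒≤n c) (n<1+n _) (≤-trans b<q' (≤-reflexive (sym (top-of-Cut c))))) (top-of-Cut c)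

  -- Ψ_λ(π)_i counted from the other end: the i-th smallest element of B_q, where q is the right end
  -- of the carrel of i.
  γ : ℕ → ℕ
  γ i = nth (B (top lam i)) i

  at-Psi : ∀ {i} → 1 ≤ i → i ≤ n → at (Psi lam π) i ≡ γ i
  at-Psi {i} i≥1 i≤n = trans (at-tab n (λ k → kthLargest (suc (top lam k ∸ k)) (B (top lam k))) i i≥1 i≤n)
    (nth-reverse (B (top lam i)) i (suc (top lam i ∸ i)) i≥1
      (trans (+-suc i _) (cong suc (trans (m+[n∸m]≡n (top-≥ i≤n)) (sym (length-B (top-≤ i≤n)))))) (s≤s z≤n))

  -- Row bounds from earlier carrels come from smaller sets B, so they are weaker than the bound B_q
  -- wanted here. Let b be the left end of the last carrel and K = cnt v (P q). If K > b, row K lies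
  -- in the last carrel, where γ is taken from B_q itself. If K ≤ b and v is below the threshold of
  -- the filling, B_q has nothing new up to v and induction applies. Otherwise v < m = max B_b, the
  -- interval (v , m] lies in B_q, and the inequality descends from m to v.
  Gale : ∀ (f : ℕ → ℕ) {q} → Cut q → (∀ i → 1 ≤ i → i < q → f i < f (suc i)) →
    (∀ i → 1 ≤ i → i ≤ q → f i ≤ γ i) → ∀ v → cnt v (P q) ≤ cnt v (map f (range q))
  Gale f {p} = go p ≤-refl
    where
    go : ∀ k {q} → q ≤ k → Cut q → (∀ i → 1 ≤ i → i < q → f i < f (suc i)) →
      (∀ i → 1 ≤ i → i ≤ q → f i ≤ γ i) → ∀ v → cnt v (P q) ≤ cnt v (map f (range q))
    go zero {zero} z≤n c inc le v = z≤n
    go (suc k) {zero} q≤k c inc le v = z≤n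
    go (suc k) {suc q₀} q≤k c inc le v = cases (b <? cnt v (P q)) (bot-R q)
      where
      q = suc q₀
      b = bot lam q
      q≤n = Cut⇒≤n c
      b<q : b < q
      b<q = bot-< (s≤s z≤n)
      F = map f (range q)
      Inc-F : Inc F
      Inc-F = Inc-map-range f q inc
      high : ∀ {v} → b < cnt v (P q) → cnt v (P q) ≤ cnt v F
      high {v} lt = nth⇒cnt Inc-F K≥1 (subst (K ≤_) (sym (length-map-range f q)) K≤q)
          (≤-trans (≤-reflexive (nth-map-range f q K K≥1 K≤q)) (≤-trans (le K K≥1 K≤q)
            (subst (λ z → nth (B z) K ≤ v) (sym topK) (nth-B-≤ q≤n K≥1 ≤-refl))))
        where
        K = cnt v (P q)
        K≥1 = ≤-trans (s≤s z≤n) lt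
        K≤q = cnt≤q v q
        topK : top lam K ≡ q
        topK = trans (top-carrel (s≤s z≤n) q≤n lt (subst (K ≤_) (sym (top-of-Cut c)) K≤q)) (top-of-Cut c)
      cases : Dec (b < cnt v (P q)) → b ≡ 0 ⊎ R b → cnt v (P q) ≤ cnt v F
      cases (yes lt) _ = high lt
      cases (no ge) (inj₁ e) = subst (_≤ cnt v F) (sym (n≤0⇒n≡0 (≤-trans (≮⇒≥ ge) (≤-reflexive e)))) z≤n
      cases (no ge) (inj₂ Rb) = split (start φ ≤? v)
        where
        b≥1 = proj₁ (R⇒ Rb)
        b≤n = <⇒≤ (proj₂ (R⇒ Rb))
        IH = go k (s≤s⁻¹ (<-≤-trans b<q q≤k)) (inj₁ Rb) (λ i p r → inc i p (<-trans r b<q)) (λ i p r → le i p (≤-trans r (<⇒≤ b<q)))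
        top≡ : top lam (suc b) ≡ q
        top≡ = trans (top-carrel (s≤s z≤n) q≤n (n<1+n _) (≤-trans b<q (≤-reflexive (sym (top-of-Cut c))))) (top-of-Cut c)
        open Next {b} {q} Rb top≡ using (new-element) renaming (Fill-next to φ)
        m = nth (B b) b
        m∈ : m ∈ P b
        m∈ = nth-B-∈ b≤n b≥1 ≤-refl
        split : Dec (start φ ≤ v) → cnt v (P q) ≤ cnt v F
        split (no p) = ≤-trans (below φ v (≰⇒> p)) (≤-trans (IH v) (cnt-map-range-mono v {f} {f} (<⇒≤ b<q) λ _ _ _ → ≤-refl))
        split (yes p) with m ≤? v
        ... | yes m≤v = contradiction (new-element p (≤-cnt-P b≤n b≥1 ≤-refl m≤v)) ge
        ... | no m≰v = +-cancelʳ-≤ (m ∸ v) _ _ (≤-trans (Fill-cnt φ p v≤m m∈)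
              (≤-trans (high (new-element (≤-trans p v≤m) (≤-cnt-P b≤n b≥1 ≤-refl ≤-refl))) (cnt-Lip (Inc⇒Unique Inc-F) v≤m)))
          where v≤m = <⇒≤ (≰⇒> m≰v)

last-All : ∀ {A : Set} {P : A → Set} {xs x} → All P xs → last xs ≡ just x → P x
last-All {xs = x ∷ []} (p ∷ []) e with refl ← just-injective e = p
last-All {xs = x ∷ y ∷ xs} (p ∷ ps) e = last-All {xs = y ∷ xs} ps e

AllPairs-++ʳ : ∀ {A : Set} {S : A → A → Set} xs {ys} → AllPairs S (xs ++ ys) → AllPairs S ys
AllPairs-++ʳ [] p = p
AllPairs-++ʳ (x ∷ xs) (_ ∷ p) = AllPairs-++ʳ xs p

-- Columns of the shape and of semistandard tableaux

module Shape {n : ℕ} (n≥1 : 1 ≤ n) (lam : Vec ℕ n) (part : IsPartition lam) where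
  open Carrels lam

  lam-anti : ∀ {i j} → 1 ≤ i → i ≤ j → j ≤ n → at lam j ≤ at lam i
  lam-anti {i} {j} i≥1 i≤j = go (j ∸ i) (m+[n∸m]≡n i≤j)
    where
    go : ∀ d {j} → i + d ≡ j → j ≤ n → at lam j ≤ at lam i
    go zero refl j≤n rewrite +-identityʳ i = ≤-refl
    go (suc d) refl j≤n rewrite +-suc i d = ≤-trans (part (i + d) (≤-trans i≥1 (m≤m+n i d)) j≤n) (go d refl (<⇒≤ j≤n))

  private
    c : ℕ → ℕ
    c = colLen lam
    initial = λ j → countB-initial (λ i → j ≤ᵇ at lam i) n
      (λ i a b t → ≤⇒≤ᵇ (≤-trans (≤ᵇ⇒≤ j _ t) (part i a b)))

  colLen≤n : ∀ j → c j ≤ n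
  colLen≤n j = countB≤ (λ i → j ≤ᵇ at lam i) n

  InShape⇒≤colLen : ∀ {j i} → InShape lam j i → i ≤ c j
  InShape⇒≤colLen {j} {i} (a , b , d , e) = proj₁ (initial j i a b) (≤⇒≤ᵇ e)

  ≤colLen⇒InShape : ∀ {j i} → 1 ≤ j → 1 ≤ i → i ≤ c j → InShape lam j i
  ≤colLen⇒InShape {j} {i} j≥1 i≥1 p = i≥1 , i≤n , j≥1 , ≤ᵇ⇒≤ j _ (proj₂ (initial j i i≥1 i≤n) p)
    where i≤n = ≤-trans p (colLen≤n j)

  InShape⇒≤lam₁ : ∀ {j i} → InShape lam j i → j ≤ lam₁ lam
  InShape⇒≤lam₁ (a , b , d , e) = ≤-trans e (lam-anti (s≤s z≤n) a b)

  colLen≥1 : ∀ {j} → 1 ≤ j → j ≤ lam₁ lam → 1 ≤ c j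
  colLen≥1 j≥1 p = InShape⇒≤colLen (s≤s z≤n , n≥1 , j≥1 , p)

  colLen-anti : ∀ {j k} → 1 ≤ j → j ≤ k → c k ≤ c j
  colLen-anti {j} {k} j≥1 j≤k with c k in e
  ... | zero = z≤n
  ... | suc i with ≤colLen⇒InShape {k} {suc i} (≤-trans j≥1 j≤k) (s≤s z≤n) (≤-reflexive (sym e))
  ... | a , b , d , f = InShape⇒≤colLen (a , b , j≥1 , ≤-trans j≤k f)

  colLen-Cut : ∀ {j} → 1 ≤ j → j ≤ lam₁ lam → Cut (c j)
  colLen-Cut {j} j≥1 p with c j ≟ n
  ... | yes e = inj₂ e
  ... | no ne = inj₁ (T⇒≡ (Equivalence.from T-∧ (≤⇒≤ᵇ (colLen≥1 j≥1 p) , Equivalence.from T-∧ (<⇒<ᵇ (≤∧≢⇒< (colLen≤n j) ne) ,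
      any⁺ (λ k → c k ≡ᵇ c j) (Any.map (λ {k} e → ≡⇒≡ᵇ (c k) (c j) (cong c (sym e))) (∈-range⁺ j≥1 p))))))

  column : Tab → ℕ → List ℕ
  column t j = map (t j) (reverse (range (c j)))

  columns : Tab → List (List ℕ)
  columns t = map (column t) (range (lam₁ lam))

  column-reverse : ∀ t j → column t j ≡ reverse (map (t j) (range (c j)))
  column-reverse t j = reverse-map (t j) (range (c j))

  cnt-column : ∀ v t j → cnt v (column t j) ≡ cnt v (map (t j) (range (c j)))
  cnt-column v t j rewrite column-reverse t j = cnt-reverse v (map (t j) (range (c j)))

  length-column : ∀ t j → length (column t j) ≡ c j
  length-column t j rewrite column-reverse t j = trans (length-reverse (map (t j) (range (c j)))) (length-map-range (t j) (c j))

  lengths-columns : ∀ t → map length (columns t) ≡ colLens lam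
  lengths-columns t = trans (sym (map-∘ (range (lam₁ lam)))) (map-cong (length-column t) (range (lam₁ lam)))

  module SSYT {t : Tab} (ssyt : IsSSYT lam t) where

    column-step : ∀ {j} → 1 ≤ j → ∀ i → 1 ≤ i → i < c j → t j i < t j (suc i)
    column-step j≥1 i a b = proj₂ (proj₂ ssyt) _ i (≤colLen⇒InShape j≥1 a (<⇒≤ b)) (≤colLen⇒InShape j≥1 (s≤s z≤n) b)

    column-slope : ∀ {j i x} → 1 ≤ j → 1 ≤ i → i ≤ x → x ≤ c j → t j i + (x ∸ i) ≤ t j x
    column-slope {j} {i} {x} j≥1 i≥1 i≤x x≤ = subst (λ z → t j i + (x ∸ i) ≤ t j z) (m+[n∸m]≡n i≤x)
        (go (x ∸ i) (≤-trans (≤-reflexive (m+[n∸m]≡n i≤x)) x≤))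
      where
      go : ∀ d → i + d ≤ c j → t j i + d ≤ t j (i + d)
      go zero p rewrite +-identityʳ i | +-identityʳ (t j i) = ≤-refl
      go (suc d) p rewrite +-suc i d | +-suc (t j i) d = ≤-<-trans (go d (<⇒≤ p)) (column-step j≥1 (i + d) (≤-trans i≥1 (m≤m+n i d)) p)

    Inc-column : ∀ {j} → 1 ≤ j → Inc (map (t j) (range (c j)))
    Inc-column {j} j≥1 = Inc-map-range (t j) (c j) (column-step j≥1)

    Decr-column : ∀ {j} → 1 ≤ j → Decr (column t j)
    Decr-column {j} j≥1 rewrite column-reverse t j = AllPairs-reverse (Inc-column j≥1)

    column-≼-suc : ∀ {j} → 1 ≤ j → column t j ≼ column t (suc j)
    column-≼-suc {j} j≥1 = ≼-intro λ v → subst₂ _≤_ (sym (cnt-column v t (suc j))) (sym (cnt-column v t j))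
      (cnt-map-range-mono v {t j} {t (suc j)} c≤ λ i a b →
        proj₁ (proj₂ ssyt) j i (≤colLen⇒InShape j≥1 a (≤-trans b c≤)) (≤colLen⇒InShape (s≤s z≤n) a b))
      where c≤ = colLen-anti j≥1 (n≤1+n j)

    column-≼ : ∀ {j k} → 1 ≤ j → j < k → column t j ≼ column t k
    column-≼ {j} {k} j≥1 j<k = subst (λ z → column t j ≼ column t z) (trans (+-suc j (k ∸ suc j)) (m+[n∸m]≡n j<k)) (go (k ∸ suc j))
      where
      go : ∀ d → column t j ≼ column t (j + suc d)
      go zero rewrite +-comm j 1 = column-≼-suc j≥1
      go (suc d) = ≼-trans (go d) (subst (λ z → column t (j + suc d) ≼ column t z) (sym (+-suc j (suc d)))
        (column-≼-suc (≤-trans j≥1 (m≤m+n j (suc d)))))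

    columns-Tableau : ∀ {ks} → Inc ks → All (1 ≤_) ks → Tableau (map (column t) ks)
    columns-Tableau {ks} inc pos = tableau (All.map⁺ (All.map Decr-column pos))
      (AllPairs.map⁺ (AllPairs-∈ inc λ x∈ y∈ lt → column-≼ (All.lookup pos x∈) lt))

    range-pos : All (1 ≤_) (range (lam₁ lam))
    range-pos = All.tabulate λ k∈ → proj₁ (∈-range⁻ {m = lam₁ lam} k∈)

    tableau-columns : Tableau (columns t)
    tableau-columns = columns-Tableau (Inc-range (lam₁ lam)) range-pos

    ≤-rightKey : ∀ {j C} → RightKeyCol lam t (c j) C → ∀ {i} → InShape lam j i → t j i ≤ nth C i
    ≤-rightKey {j} {C} (s , (colsOK , _) , perm , word , (o , last≡) , len) {i} sh@(i≥1 , i≤n , j≥1 , _) =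
        subst (_≤ v) (nth-map-range (t j) (c j) i i≥1 i≤c)
          (cnt⇒nth (Inc-column j≥1) i≥1 (≤-trans (nth⇒cnt incC i≥1 (subst (i ≤_) (sym len) i≤c) ≤-refl)
            (subst₂ _≤_ (cnt-reverse v C) (cnt-column v t j) (≼-cnt dominated v))))
      where
      v = nth C i
      i≤c = InShape⇒≤colLen sh
      incC : Inc C
      incC = Linked.Linked⇒AllPairs <-trans (proj₂ (last-All colsOK last≡))
      dominated : column t j ≼ reverse C
      dominated = All.lookup (columns-≼-last (skew-Decr colsOK) tableau-columns word
          (↭-trans (↭-reflexive (skew-lengths s)) (↭-trans perm (↭-reflexive (sym (lengths-columns t)))))
          (Marked-last s last≡))
        (∈-map⁺ (column t) (∈-range⁺ j≥1 (InShape⇒≤lam₁ sh))) (trans (length-column t j) (sym len))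

    -- Φ is an invariant of column j while it is pushed to the far right.
    rightKey-column : ∀ (Φ : List ℕ → Set) {j} → 1 ≤ j → j ≤ lam₁ lam → Φ (column t j) →
      (∀ k → j < k → k ≤ lam₁ lam → ∀ {D} → Decr D → D ≼ column t k → Φ D → Φ (exchʳ D (column t k))) →
      ∃ λ E → Decr E × length E ≡ c j × Φ E × RightKeyCol lam t (c j) (reverse E)
    rightKey-column Φ {j} j≥1 j≤ φ step with ∈-∃++ (∈-range⁺ j≥1 j≤)
    ... | ys , zs , e = E , dE , lenE , passʳ-preserves Φ tail (All.map⁺ (All.tabulate λ {k} k∈ →
            step k (later k∈) (bounded k∈))) φ ,
          spreadOut new , spreadOut-isSkewTab dNew nonempty , ↭-trans (↭-reflexive (spreadOut-lengths new)) lengths ,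
          ktrans (≡⇒≈K (spreadOut-word new)) word , (0 , lastNew) , trans (length-reverse E) lenE
      where
      D = column t j
      Cs = map (column t) zs
      pre = map (column t) ys
      E = passʳ D Cs
      new = (pre ++ passˡ D Cs) ++ [ E ]
      split : columns t ≡ pre ++ D ∷ Cs
      split = trans (cong (map (column t)) e) (map-++ (column t) ys (j ∷ zs))
      incTail : Inc (j ∷ zs)
      incTail = AllPairs-++ʳ ys (subst Inc e (Inc-range (lam₁ lam)))
      later : ∀ {k} → k ∈ zs → j < k
      later k∈ = All.lookup (AllPairs.head incTail) k∈
      bounded : ∀ {k} → k ∈ zs → k ≤ lam₁ lam
      bounded k∈ = proj₂ (∈-range⁻ {m = lam₁ lam} (subst (_ ∈_) (sym e) (∈-++⁺ʳ ys (there k∈))))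
      tail : Tableau (D ∷ Cs)
      tail = columns-Tableau incTail (All.++⁻ʳ ys (subst (All (1 ≤_)) e range-pos))
      dE = proj₂ (pass-Decr tail)
      lenE = trans (length-passʳ D Cs) (length-column t j)
      dNew : All Decr new
      dNew = All.++⁺ (All.++⁺ (All.++⁻ˡ pre (subst (All Decr) split (Tableau.columns tableau-columns))) (proj₁ (pass-Decr tail))) (dE ∷ [])
      lengths : map length new ↭ colLens lam
      lengths = ↭-trans (↭-reflexive (begin
          map length ((pre ++ passˡ D Cs) ++ [ E ])                    ≡⟨ cong (map length) (++-assoc pre _ _) ⟩
          map length (pre ++ (passˡ D Cs ++ [ E ]))                    ≡⟨ map-++ length pre _ ⟩
          map length pre ++ map length (passˡ D Cs ++ [ E ])           ≡⟨ cong (map length pre ++_) (map-++ length (passˡ D Cs) _) ⟩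
          map length pre ++ (map length (passˡ D Cs) ++ [ length E ])  
            ≡⟨ cong₂ (λ x y → map length pre ++ (x ++ [ y ])) (length-passˡ D Cs) (length-passʳ D Cs) ⟩
          map length pre ++ (map length Cs ++ [ length D ])            ∎))
        (↭-trans (++⁺ˡ (map length pre) (↭-sym (∷↭∷ʳ (length D) (map length Cs))))
          (↭-reflexive (trans (sym (map-++ length pre (D ∷ Cs))) (trans (cong (map length) (sym split)) (lengths-columns t)))))
        where open ≡-Reasoning
      nonempty : All (λ x → 1 ≤ length x) new
      nonempty = All.map⁻ (All-resp-↭ {P = 1 ≤_} (↭-sym lengths) (All.map⁺ (All.tabulate λ k∈ →
        colLen≥1 (proj₁ (∈-range⁻ {m = lam₁ lam} k∈)) (proj₂ (∈-range⁻ {m = lam₁ lam} k∈)))))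
      word : concat new ≈K colWord lam t
      word = ktrans (≡⇒≈K (begin
          concat ((pre ++ passˡ D Cs) ++ [ E ])            ≡⟨ sym (concat-++ (pre ++ passˡ D Cs) [ E ]) ⟩
          concat (pre ++ passˡ D Cs) ++ (E ++ [])          ≡⟨ cong₂ _++_ (sym (concat-++ pre (passˡ D Cs))) (++-identityʳ E) ⟩
          (concat pre ++ concat (passˡ D Cs)) ++ E         ≡⟨ ++-assoc (concat pre) _ _ ⟩
          concat pre ++ (concat (passˡ D Cs) ++ E)         ∎))
        (ktrans (≈K-++ˡ (concat pre) (ksym (pass-≈K tail)))
          (≡⇒≈K (trans (concat-++ pre (D ∷ Cs)) (cong concat (sym split)))))
        where open ≡-Reasoning
      lastNew : last (spreadOut new) ≡ just (0 , reverse E)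
      lastNew = spreadOut-last (pre ++ passˡ D Cs) E

SameSet-sym : ∀ {A B} → SameSet A B → SameSet B A
SameSet-sym s t = proj₂ (s t) , proj₁ (s t)

SameSet-trans : ∀ {A B C} → SameSet A B → SameSet B C → SameSet A C
SameSet-trans s s' t = proj₁ (s' t) ∘ proj₁ (s t) , proj₂ (s t) ∘ proj₂ (s' t)

-- Row bounds, keys and the tableau sets they define

module Flags {n : ℕ} (n≥1 : 1 ≤ n) (lam : Vec ℕ n) (part : IsPartition lam) where
  open Carrels lam
  open Shape n≥1 lam part

  private
    c : ℕ → ℕ
    c = colLen lam

  -- A column that meets row i also meets every row x ≥ i of the same carrel, since its length is
  -- the end of a carrel. Columns increase strictly, so the bound in row x forces T_j(i) ≤ β_x - (x
  -- - i).
  Sset-⊆ : ∀ (β β' : Vec ℕ n) → (∀ i → 1 ≤ i → i ≤ n → ∃ λ x → i ≤ x × x ≤ top lam i × at β x + i ≤ at β' i + x) →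
    ∀ t → Sset lam β t → Sset lam β' t
  Sset-⊆ β β' h t (ssyt , le) = ssyt , le'
    where
    le' : ∀ j i → InShape lam j i → t j i ≤ at β' i
    le' j i sh@(i≥1 , i≤n , j≥1 , _) with h i i≥1 i≤n
    ... | x , i≤x , x≤top , p = +-cancelʳ-≤ x _ _ (begin
        t j i + x              ≡⟨ cong (t j i +_) (m∸n+n≡m i≤x) ⟨
        t j i + (x ∸ i + i)    ≡⟨ +-assoc (t j i) _ _ ⟨
        t j i + (x ∸ i) + i    ≤⟨ +-monoˡ-≤ i (SSYT.column-slope ssyt j≥1 i≥1 i≤x x≤c) ⟩
        t j x + i              ≤⟨ +-monoˡ-≤ i (le j x (≤colLen⇒InShape j≥1 (≤-trans i≥1 i≤x) x≤c)) ⟩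
        at β x + i             ≤⟨ p ⟩
        at β' i + x            ∎)
      where
      open ≤-Reasoning
      x≤c : x ≤ c j
      x≤c = ≤-trans x≤top (top-≤-Cut (InShape⇒≤colLen sh) (colLen-Cut j≥1 (InShape⇒≤lam₁ sh)))

  Sset-mono : ∀ (β β' : Vec ℕ n) → (∀ i → 1 ≤ i → i ≤ n → at β i ≤ at β' i) → ∀ t → Sset lam β t → Sset lam β' t
  Sset-mono β β' h t (ssyt , le) = ssyt , λ j i sh → ≤-trans (le j i sh) (h i (proj₁ sh) (proj₁ (proj₂ sh)))

  Delta-≤ : ∀ β {i} → 1 ≤ i → i ≤ n → at (Delta lam β) i ≤ at β i
  Delta-≤ β {i} a b rewrite at-Delta β a b = m≤n+o⇒m∸n≤o (at β x) (x ∸ i) (+-cancelʳ-≤ i _ _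
      (≤-trans (nextCritical-minimizes β a b) (≤-reflexive (begin
        at β i + x               ≡⟨ cong (at β i +_) (m∸n+n≡m (nextCritical-≥ β a b)) ⟨
        at β i + (x ∸ i + i)     ≡⟨ +-assoc (at β i) _ _ ⟨
        at β i + (x ∸ i) + i     ≡⟨ cong (_+ i) (+-comm (at β i) _) ⟩
        x ∸ i + at β i + i ∎))))
    where
    open ≡-Reasoning
    x = nextCritical β i

  Sset-Delta : ∀ β → SameSet (Sset lam β) (Sset lam (Delta lam β))
  Sset-Delta β t = Sset-⊆ β (Delta lam β) slope t , Sset-mono (Delta lam β) β (λ i a b → Delta-≤ β a b) t
    where
    slope : ∀ i → 1 ≤ i → i ≤ n → ∃ λ x → i ≤ x × x ≤ top lam i × at β x + i ≤ at (Delta lam β) i + x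
    slope i a b = x , nextCritical-≥ β a b , nextCritical-≤top β a b , (begin
        at β x + i                         ≤⟨ +-monoˡ-≤ i (m≤n+m∸n (at β x) (x ∸ i)) ⟩
        x ∸ i + (at β x ∸ (x ∸ i)) + i     ≡⟨ cong (_+ i) (+-comm (x ∸ i) _) ⟩
        at β x ∸ (x ∸ i) + (x ∸ i) + i     ≡⟨ +-assoc (at β x ∸ (x ∸ i)) _ _ ⟩
        at β x ∸ (x ∸ i) + (x ∸ i + i)     ≡⟨ cong₂ _+_ (sym (at-Delta β a b)) (m∸n+n≡m (nextCritical-≥ β a b)) ⟩
        at (Delta lam β) i + x ∎)
      where
      open ≤-Reasoning
      x = nextCritical β i

  module Key (π : Vec ℕ n) (perm : IsPerm π) where
    open Sets π perm

    Y : Tab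
    Y = Ykey lam π

    -- In a column of length n the key has the entry i, which is the i-th smallest element of B_n =
    -- [n]; one formula covers both cases of `Ykey`.
    Y-nth : ∀ {j i} → InShape lam j i → Y j i ≡ nth (B (c j)) i
    Y-nth {j} {i} sh@(i≥1 , i≤n , _) with c j ≡ᵇ n in e
    ... | false = refl
    ... | true = sym (trans (cong (λ q → nth (B q) i) (≡ᵇ⇒≡ (c j) n (≡⇒T e))) (nth-B-full i≥1 i≤n))

    Dset⇒≤Y : ∀ {t} → Dset lam π t → ∀ {j i} → InShape lam j i → t j i ≤ Y j i
    Dset⇒≤Y (ssyt , h) {j} {i} sh@(i≥1 , i≤n , j≥1 , _) with h j j≥1 (InShape⇒≤lam₁ sh)
    ... | C , rk , le = ≤-trans (SSYT.≤-rightKey ssyt {C = C} rk sh) (le i i≥1 (InShape⇒≤colLen sh))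

    Y-SSYT : IsSSYT lam Y
    Y-SSYT = bounds , rows , cols
      where
      bounds : ∀ j i → InShape lam j i → 1 ≤ Y j i × Y j i ≤ n
      bounds j i sh rewrite Y-nth sh = P-bounds (colLen≤n j) (nth-B-∈ (colLen≤n j) (proj₁ sh) (InShape⇒≤colLen sh))
      rows : ∀ j i → InShape lam j i → InShape lam (suc j) i → Y j i ≤ Y (suc j) i
      rows j i sh sh' rewrite Y-nth sh | Y-nth sh' =
        nth-B-anti (colLen-anti (proj₁ (proj₂ (proj₂ sh))) (n≤1+n j)) (colLen≤n j) (proj₁ sh) (InShape⇒≤colLen sh')
      cols : ∀ j i → InShape lam j i → InShape lam j (suc i) → Y j i < Y j (suc i)
      cols j i sh sh' rewrite Y-nth sh | Y-nth sh' = nth-B-mono (colLen≤n j) (proj₁ sh) ≤-refl (InShape⇒≤colLen sh')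

    ∈-column⁻ : ∀ {j v} → 1 ≤ j → v ∈ column Y j → v ∈ P (c j)
    ∈-column⁻ {j} j≥1 v∈ rewrite column-reverse Y j with ∈-map⁻ (Y j) (∈-resp-↭ (↭-reverse (map (Y j) (range (c j)))) v∈)
    ... | i , i∈ , refl with ∈-range⁻ {m = c j} i∈
    ... | i≥1 , i≤c rewrite Y-nth (≤colLen⇒InShape j≥1 i≥1 i≤c) = nth-B-∈ (colLen≤n j) i≥1 i≤c

    ∈-column⁺ : ∀ {j v} → 1 ≤ j → v ∈ P (c j) → v ∈ column Y j
    ∈-column⁺ {j} j≥1 v∈ rewrite column-reverse Y j with ∈-nth (P⇒B (colLen≤n j) v∈)
    ... | i , i≥1 , i≤l , refl = ∈-resp-↭ (↭-sym (↭-reverse (map (Y j) (range (c j)))))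
          (subst (_∈ map (Y j) (range (c j))) (Y-nth (≤colLen⇒InShape j≥1 i≥1 i≤c)) (∈-map⁺ (Y j) (∈-range⁺ i≥1 i≤c)))
      where i≤c = subst (i ≤_) (length-B (colLen≤n j)) i≤l

    -- The columns of a key are nested: each contains all later ones. Every exchange then leaves the
    -- moving column as it is, so Y displays its own columns as right key columns.
    Y-Dset : Dset lam π Y
    Y-Dset = Y-SSYT , λ j j≥1 j≤ → keyColumn j j≥1 j≤
      where
      keyColumn : ∀ j → 1 ≤ j → j ≤ lam₁ lam → Σ (List ℕ) λ C → RightKeyCol lam Y (c j) C ×
        (∀ i → 1 ≤ i → i ≤ c j → nth C i ≤ Y j i)
      keyColumn j j≥1 j≤ with SSYT.rightKey-column Y-SSYT (_≡ column Y j) j≥1 j≤ refl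
        (λ k j<k k≤ {D} dD _ D≡ → trans (exchʳ-id dD (All.tabulate λ v∈ → subst (_ ∈_) (sym D≡)
           (∈-column⁺ j≥1 (prefix-⊆ π (colLen-anti j≥1 (<⇒≤ j<k)) (∈-column⁻ (≤-trans j≥1 (<⇒≤ j<k)) v∈))))) D≡)
      ... | E , _ , _ , refl , rk = reverse E , rk , λ i i≥1 i≤c → ≤-reflexive
        (trans (cong (λ xs → nth (reverse xs) i) (column-reverse Y j))
          (trans (cong (λ xs → nth xs i) (reverse-involutive (map (Y j) (range (c j)))))
          (nth-map-range (Y j) (c j) i i≥1 i≤c)))

  module AvoidingFlags (π : Vec ℕ n) (av : S312 lam π) where
    open Avoiding lam π av
    open Key π perm

    -- Three ranges of v. Below the threshold of the filling, B_q has no more elements up to v than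
    -- B_q', and the new column lies below C. From m = max B_q' on, counts do not change, since all
    -- letters of C are at most m. In between, (v , m] is contained in B_q and the inequality
    -- descends from m.
    exchange-keeps-bound : ∀ {C D q q'} → Cut q → Cut q' → 1 ≤ q' → q' ≤ q → Decr C → length C ≡ q' →
      (∀ v → cnt v (P q') ≤ cnt v C) → Decr D → D ≼ C → (∀ v → cnt v (P q) ≤ cnt v D) →
      ∀ v → cnt v (P q) ≤ cnt v (exchʳ D C)
    exchange-keeps-bound {C} {D} {q} {q'} cq cq' q'≥1 q'≤q dC lenC bC dD D≼C bD v = split (start φ ≤? v)
      where
      q'≤n = Cut⇒≤n cq'
      φ : Fill (P q') (P q)
      φ = fillFrom cq'
        where
        fillFrom : Cut q' → Fill (P q') (P q)
        fillFrom (inj₁ r) = Fill-Cut r q'≤q cq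
        fillFrom (inj₂ e) = subst (λ z → Fill (P q') (P z)) (≤-antisym q'≤q (≤-trans (Cut⇒≤n cq) (≤-reflexive (sym e)))) Fill-refl
      m = nth (B q') q'
      m∈ : m ∈ P q'
      m∈ = nth-B-∈ q'≤n q'≥1 ≤-refl
      C≤m : All (_≤ m) C
      C≤m = cnt-full (subst (_≤ cnt m C) (sym lenC) (≤-trans (≤-reflexive (sym (cnt-P-nth q'≤n q'≥1 ≤-refl))) (bC m)))
      split : Dec (start φ ≤ v) → cnt v (P q) ≤ cnt v (exchʳ D C)
      split (no p) = ≤-trans (below φ v (≰⇒> p)) (≤-trans (bC v) (≼-cnt (exchʳ-≼ dD dC D≼C) v))
      split (yes p) with m ≤? v
      ... | yes m≤v = ≤-trans (bD v) (≤-reflexive (sym (cnt-exchʳ D (All.map (λ r → ≤-trans r m≤v) C≤m))))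
      ... | no m≰v = +-cancelʳ-≤ (m ∸ v) _ _ (begin
            cnt v (P q) + (m ∸ v)         ≤⟨ Fill-cnt φ p v≤m m∈ ⟩
            cnt m (P q)                   ≤⟨ bD m ⟩
            cnt m D                       ≡⟨ cnt-exchʳ D C≤m ⟨
            cnt m (exchʳ D C)             ≤⟨ cnt-Lip (Decr⇒Unique (Decr-exchʳ C dD)) v≤m ⟩
            cnt v (exchʳ D C) + (m ∸ v)   ∎)
        where
        open ≤-Reasoning
        v≤m = <⇒≤ (≰⇒> m≰v)

    Sset⇒Dset : ∀ t → Sset lam (Psi lam π) t → Dset lam π t
    Sset⇒Dset t (ssyt , le) = ssyt , rightKey
      where
      open SSYT ssyt
      bound : ∀ {j} → 1 ≤ j → j ≤ lam₁ lam → ∀ v → cnt v (P (c j)) ≤ cnt v (column t j)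
      bound {j} j≥1 j≤ v = subst (cnt v (P (c j)) ≤_) (sym (cnt-column v t j)) (Gale (t j) (colLen-Cut j≥1 j≤) (column-step j≥1)
        (λ i a b → ≤-trans (le j i (≤colLen⇒InShape j≥1 a b)) (≤-reflexive (at-Psi a (≤-trans b (colLen≤n j))))) v)
      rightKey : ∀ j → 1 ≤ j → j ≤ lam₁ lam → Σ (List ℕ) λ C → RightKeyCol lam t (c j) C ×
        (∀ i → 1 ≤ i → i ≤ c j → nth C i ≤ Y j i)
      rightKey j j≥1 j≤ with rightKey-column (λ D → ∀ v → cnt v (P (c j)) ≤ cnt v D) j≥1 j≤ (bound j≥1 j≤)
        (λ k j<k k≤ → let k≥1 = ≤-trans j≥1 (<⇒≤ j<k) in exchange-keeps-bound (colLen-Cut j≥1 j≤) (colLen-Cut k≥1 k≤)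
            (colLen≥1 k≥1 k≤) (colLen-anti j≥1 (<⇒≤ j<k)) (Decr-column k≥1) (length-column t k) (bound k≥1 k≤))
      ... | E , dE , lenE , φ , rk = reverse E , rk , λ i i≥1 i≤c → cnt⇒nth (AllPairs-reverse dE) i≥1
            (subst₂ _≤_ (cnt-P-nth (colLen≤n j) i≥1 i≤c)
              (trans (cong (λ z → cnt z E) (sym (Y-nth (≤colLen⇒InShape j≥1 i≥1 i≤c)))) (sym (cnt-reverse (Y j i) E)))
              (φ (nth (B (c j)) i)))

    -- Among the sets B_q with q the length of a column that meets row i, the one with q = top i is
    -- contained in all others if it occurs; in any case its i-th smallest element is at least
    -- theirs.
    Dset⇒Sset : ∀ t → Dset lam π t → Sset lam (Psi lam π) t
    Dset⇒Sset t d = proj₁ d , λ j i sh@(i≥1 , i≤n , j≥1 , _) → ≤-trans (Dset⇒≤Y d sh)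
      (subst₂ _≤_ (sym (Y-nth sh)) (sym (at-Psi i≥1 i≤n))
        (nth-B-anti (top-≤-Cut (InShape⇒≤colLen sh) (colLen-Cut j≥1 (InShape⇒≤lam₁ sh))) (colLen≤n j) i≥1 (top-≥ i≤n)))

    Sset-Psi : SameSet (Sset lam (Psi lam π)) (Dset lam π)
    Sset-Psi t = Sset⇒Dset t , Dset⇒Sset t

    γ-bounds : ∀ {i} → 1 ≤ i → i ≤ n → 1 ≤ γ i × γ i ≤ n
    γ-bounds i≥1 i≤n = P-bounds (top-≤ i≤n) (nth-B-∈ (top-≤ i≤n) i≥1 (top-≥ i≤n))

    γ-Upper : Upper (Psi lam π)
    γ-Upper = (λ i a b → subst (λ z → 1 ≤ z × z ≤ n) (sym (at-Psi a b)) (γ-bounds a b)) ,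
      λ i a b → subst (i ≤_) (sym (at-Psi a b)) (nth-B-≥ (top-≤ b) a (top-≥ b))

    γ-increasing : ∀ {i x} → 1 ≤ i → i < x → x ≤ top lam i → i ≤ n → γ i < γ x
    γ-increasing {i} {x} i≥1 i<x x≤ i≤n = subst (λ z → γ i < nth (B z) x)
      (sym (top-carrel i≥1 i≤n (<-trans (bot-< i≥1) i<x) x≤)) (nth-B-mono (top-≤ i≤n) i≥1 i<x x≤)

    γ-UI : UI lam (Psi lam π)
    γ-UI = γ-Upper , λ i i≥1 i<n nc → subst₂ _<_ (sym (at-Psi i≥1 (<⇒≤ i<n))) (sym (at-Psi (s≤s z≤n) i<n))
      (γ-increasing i≥1 ≤-refl (NoCut⇒<top i<n nc) (<⇒≤ i<n))

    -- Suppose γ_j < γ_i with i in an earlier carrel and j critical. In B_q, where q ends the carrel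
    -- of j, γ_j has rank j > b, so it is not below the threshold of the filling. Hence γ_j + 1 ∈
    -- B_q and γ_{j+1} ≤ γ_j + 1, while criticality of j demands a larger jump.
    γ-UGC : UGC lam (Psi lam π)
    γ-UGC = γ-Upper , λ i j i≥1 i<j j≤n _ critj → subst₂ _≤_ (sym (at-Psi i≥1 (≤-trans (<⇒≤ i<j) j≤n)))
        (sym (at-Psi (≤-trans i≥1 (<⇒≤ i<j)) j≤n)) (mono i≥1 i<j j≤n critj)
      where
      mono : ∀ {i j} → 1 ≤ i → i < j → j ≤ n → T (isCrit lam (Psi lam π) j) → γ i ≤ γ j
      mono {i} {j} i≥1 i<j j≤n critj with bot lam j <? i
      ... | yes p = <⇒≤ (γ-increasing i≥1 i<j (≤-trans (top-≥ j≤n) (≤-reflexive (sym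
              (top-carrel (≤-trans i≥1 (<⇒≤ i<j)) j≤n p (≤-trans (<⇒≤ i<j) (top-≥ j≤n)))))) (≤-trans (<⇒≤ i<j) j≤n))
      ... | no p with bot-R j
      ...   | inj₁ e = contradiction (≤-trans i≥1 (≤-trans (≮⇒≥ p) (≤-reflexive e))) λ ()
      ...   | inj₂ Rb = ≮⇒≥ λ lt → contradict lt
        where
        j≥1 = ≤-trans i≥1 (<⇒≤ i<j)
        i≤n = ≤-trans (<⇒≤ i<j) j≤n
        b = bot lam j
        q = top lam j
        q≤n = top-≤ j≤n
        m∈ : γ i ∈ P b
        m∈ = prefix-⊆ π (top-≤-Cut (≮⇒≥ p) (inj₁ Rb)) (nth-B-∈ (top-≤ i≤n) i≥1 (top-≥ i≤n))
        open Next {b} {q} Rb (top-carrel j≥1 j≤n (n<1+n b) (≤-trans (bot-< j≥1) (top-≥ j≤n))) using (Fill-next)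
        γj-cnt : cnt (γ j) (P q) ≡ j
        γj-cnt = cnt-P-nth q≤n j≥1 (top-≥ j≤n)
        contradict : γ j < γ i → ⊥
        contradict lt = <⇒≱ (subst₂ (λ x y → x + suc j < y + j) (at-Psi j≥1 j≤n) (at-Psi (s≤s z≤n) (≤-trans j<q q≤n))
              (crit⇒IsMin (Psi lam π) j≥1 j≤n critj (suc j) ≤-refl j<q))
            (subst (γ (suc j) + j ≤_) (sym (+-suc (γ j) j)) (+-monoˡ-≤ j γ-suc))
          where
          x≤γj : start Fill-next ≤ γ j
          x≤γj = ≮⇒≥ λ s → <⇒≱ (bot-< j≥1) (subst (_≤ b) γj-cnt (≤-trans (below Fill-next (γ j) s) (cnt≤q (γ j) b)))
          w∈ : suc (γ j) ∈ P q
          w∈ = above Fill-next (suc (γ j)) (γ i) (m≤n⇒m≤1+n x≤γj) lt m∈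
          rank : suc j ≤ cnt (suc (γ j)) (P q)
          rank = subst (λ z → suc z ≤ cnt (suc (γ j)) (P q)) γj-cnt (cnt-jump w∈)
          j<q : j < q
          j<q = ≤-trans rank (cnt≤q _ q)
          γ-suc : γ (suc j) ≤ suc (γ j)
          γ-suc = subst (λ z → nth (B z) (suc j) ≤ suc (γ j)) (sym (top-carrel j≥1 j≤n (<-trans (bot-< j≥1) (n<1+n j)) j<q))
            (nth-B-≤ q≤n (s≤s z≤n) rank)

    private
      ψ = Psi lam π
      x[_] : ℕ → ℕ
      x[ i ] = nextCritical ψ i

    -- Every entry is raised to the entry at the next critical index. The result is weakly
    -- increasing because the critical entries are, and the tableau set is unchanged because the
    -- bounds at the critical indices imply all original ones.
    monotoneFlag : Vec ℕ n
    monotoneFlag = tab n λ i → at ψ x[ i ]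

    at-monotoneFlag : ∀ {i} → 1 ≤ i → i ≤ n → at monotoneFlag i ≡ at ψ x[ i ]
    at-monotoneFlag {i} a b = at-tab n (λ i → at ψ x[ i ]) i a b

    monotoneFlag-UF : UF lam monotoneFlag
    monotoneFlag-UF = ((λ i a b → subst (λ z → 1 ≤ z × z ≤ n) (sym (at-monotoneFlag a b)) (proj₁ γ-Upper _ (x≥1 a b) (x≤n a b))) ,
        λ i a b → subst (i ≤_) (sym (at-monotoneFlag a b)) (≤-trans (nextCritical-≥ ψ a b) (proj₂ γ-Upper _ (x≥1 a b) (x≤n a b)))) ,
        λ i a b → subst₂ _≤_ (sym (at-monotoneFlag a (<⇒≤ b))) (sym (at-monotoneFlag (s≤s z≤n) b)) (mono a b)
      where
      x≤n : ∀ {i} → 1 ≤ i → i ≤ n → x[ i ] ≤ n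
      x≤n = nextCritical-≤n ψ
      x≥1 : ∀ {i} → 1 ≤ i → i ≤ n → 1 ≤ x[ i ]
      x≥1 a b = ≤-trans a (nextCritical-≥ ψ a b)
      mono : ∀ {i} → 1 ≤ i → i < n → at ψ x[ i ] ≤ at ψ x[ suc i ]
      mono {i} a b with x[ i ] ≟ x[ suc i ]
      ... | yes e = ≤-reflexive (cong (at ψ) e)
      ... | no ne = proj₂ γ-UGC _ _ (x≥1 a (<⇒≤ b)) (≤∧≢⇒< (nextCritical-mono ψ a b) ne) (x≤n (s≤s z≤n) b)
            (nextCritical-critical ψ a (<⇒≤ b)) (nextCritical-critical ψ (s≤s z≤n) b)

    Sset-monotoneFlag : SameSet (Sset lam ψ) (Sset lam monotoneFlag)
    Sset-monotoneFlag t = Sset-mono ψ monotoneFlag raise t , Sset-⊆ monotoneFlag ψ slope t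
      where
      raise : ∀ i → 1 ≤ i → i ≤ n → at ψ i ≤ at monotoneFlag i
      raise i a b rewrite at-monotoneFlag a b with i ≟ x[ i ]
      ... | yes e = ≤-reflexive (cong (at ψ) e)
      ... | no ne = subst₂ _≤_ (sym (at-Psi a b)) (sym (at-Psi (≤-trans a (nextCritical-≥ ψ a b)) (nextCritical-≤n ψ a b)))
            (<⇒≤ (γ-increasing a (≤∧≢⇒< (nextCritical-≥ ψ a b) ne) (nextCritical-≤top ψ a b) b))
      slope : ∀ i → 1 ≤ i → i ≤ n → ∃ λ x → i ≤ x × x ≤ top lam i × at monotoneFlag x + i ≤ at ψ i + x
      slope i a b = x[ i ] , nextCritical-≥ ψ a b , nextCritical-≤top ψ a b ,
        subst (λ z → z + i ≤ at ψ i + x[ i ]) (sym (trans (at-monotoneFlag (≤-trans a (nextCritical-≥ ψ a b)) (nextCritical-≤n ψ a b))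
          (cong (at ψ) (nextCritical-step ψ a b (nextCritical-≥ ψ a b) ≤-refl)))) (nextCritical-minimizes ψ a b)

-- Recovering a permutation from its Demazure set

cnt-dominated : ∀ {xs ys} → Inc xs → Inc ys → length xs ≡ length ys →
  (∀ i → 1 ≤ i → i ≤ length xs → nth ys i ≤ nth xs i) → ∀ v → cnt v xs ≤ cnt v ys
cnt-dominated {xs} {ys} incX incY len h v with cnt v xs in e
... | zero = z≤n
... | suc k = nth⇒cnt incY (s≤s z≤n) (subst (suc k ≤_) len k≤) (≤-trans (h (suc k) (s≤s z≤n) k≤)
      (cnt⇒nth incX (s≤s z≤n) (≤-reflexive (sym e))))
  where k≤ = ≤-trans (≤-reflexive (sym e)) (cnt≤length v xs)

module KeyUniqueness {n : ℕ} (n≥1 : 1 ≤ n) (lam : Vec ℕ n) (part : IsPartition lam) where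
  open Carrels lam
  open Shape n≥1 lam part
  open Flags n≥1 lam part

  R⇒colLen : ∀ {q} → R q → ∃ λ j → 1 ≤ j × j ≤ lam₁ lam × colLen lam j ≡ q
  R⇒colLen {q} r with find (any⁻ (λ j → colLen lam j ≡ᵇ q) (range (lam₁ lam))
      (proj₂ (Equivalence.to (T-∧ {q <ᵇ n}) (proj₂ (Equivalence.to (T-∧ {1 ≤ᵇ q}) (≡⇒T r))))))
  ... | j , j∈ , e = j , proj₁ (∈-range⁻ {m = lam₁ lam} j∈) , proj₂ (∈-range⁻ {m = lam₁ lam} j∈) , ≡ᵇ⇒≡ _ q e

  cnt-Cut-≤ : ∀ (π π' : Vec ℕ n) → IsPerm π → IsPerm π' → (∀ {j i} → InShape lam j i → Ykey lam π' j i ≤ Ykey lam π j i) →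
    ∀ {q} → Cut q → ∀ v → cnt v (prefix π q) ≤ cnt v (prefix π' q)
  cnt-Cut-≤ π π' perm perm' Y≤ {q} cq v = subst₂ _≤_ (S.cnt-B v q≤n) (S'.cnt-B v q≤n)
      (cnt-dominated (S.Inc-B q) (S'.Inc-B q) (trans (S.length-B q≤n) (sym (S'.length-B q≤n)))
        (λ i i≥1 i≤ → entry cq i i≥1 (subst (i ≤_) (S.length-B q≤n) i≤)) v)
    where
    module S = Sets π perm
    module S' = Sets π' perm'
    q≤n = Cut⇒≤n cq
    entry : ∀ {q} → Cut q → ∀ i → 1 ≤ i → i ≤ q → nth (S'.B q) i ≤ nth (S.B q) i
    entry (inj₂ refl) i i≥1 i≤q = ≤-reflexive (trans (S'.nth-B-full i≥1 i≤q) (sym (S.nth-B-full i≥1 i≤q)))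
    entry {q} (inj₁ r) i i≥1 i≤q with R⇒colLen {q} r
    ... | j , j≥1 , j≤ , refl = subst₂ _≤_ (Key.Y-nth π' perm' sh) (Key.Y-nth π perm sh) (Y≤ sh)
      where sh = ≤colLen⇒InShape j≥1 i≥1 i≤q

  -- The counts of the entries in one carrel are differences of counts of two successive sets B_h,
  -- so they agree for π and π'. Within a carrel a permutation is increasing, and hence determined
  -- by these counts.
  entry-≤ : ∀ (π π' : Vec ℕ n) → Sλ lam π → Sλ lam π' → (∀ {q} → Cut q → ∀ v → cnt v (prefix π q) ≡ cnt v (prefix π' q)) →
    ∀ i → 1 ≤ i → i ≤ n → at π' i ≤ at π i
  entry-≤ π π' πS π'S same i i≥1 i≤n = subst (_≤ v) (nth-seg π')
      (cnt⇒nth (Inc-seg {π'} π'S) k≥1 (subst (k ≤_) seg-same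
        (nth⇒cnt (Inc-seg {π} πS) k≥1 (subst (k ≤_) (sym (length-map-range _ l)) k≤l) (≤-reflexive (nth-seg π)))))
    where
    b = bot lam i
    q = top lam i
    l = q ∸ b
    k = i ∸ b
    v = at π i
    b<i = bot-< i≥1
    b≤q : b ≤ q
    b≤q = ≤-trans (<⇒≤ b<i) (top-≥ i≤n)
    k≥1 : 1 ≤ k
    k≥1 = m<n⇒0<n∸m b<i
    k≤l : k ≤ l
    k≤l = ∸-monoˡ-≤ b (top-≥ i≤n)
    seg : Vec ℕ n → List ℕ
    seg ρ = map (λ j → at ρ (b + j)) (range l)
    nth-seg : ∀ ρ → nth (seg ρ) k ≡ at ρ i
    nth-seg ρ = trans (nth-map-range _ l k k≥1 k≤l) (cong (at ρ) (m+[n∸m]≡n (<⇒≤ b<i)))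
    Inc-seg : ∀ {ρ} → Sλ lam ρ → Inc (seg ρ)
    Inc-seg {ρ} ρS = Inc-map-range (λ j → at ρ (b + j)) l λ j a c → subst (λ z → at ρ (b + j) < at ρ z) (sym (+-suc b j))
      (proj₂ ρS (b + j) (≤-trans a (m≤n+m j b)) (<-≤-trans (b+j<q c) (top-≤ i≤n))
        (carrel-NoCut i≥1 i≤n (b + j) (≤-trans (≤-reflexive (+-comm 1 b)) (+-monoʳ-≤ b a)) (b+j<q c)))
      where
      b+j<q : ∀ {j} → j < l → b + j < q
      b+j<q c = <-≤-trans (+-monoʳ-< b c) (≤-reflexive (m+[n∸m]≡n b≤q))
    split : ∀ ρ → cnt v (prefix ρ q) ≡ cnt v (prefix ρ b) + cnt v (seg ρ)
    split ρ = trans (cong (λ z → cnt v (prefix ρ z)) (sym (m+[n∸m]≡n b≤q)))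
      (trans (cong (cnt v) (trans (cong (map (at ρ)) (range-+ b l)) (trans (map-++ (at ρ) (range b) (map (b +_) (range l)))
        (cong (prefix ρ b ++_) (sym (map-∘ (range l))))))) (cnt-++ v (prefix ρ b) (seg ρ)))
    same-b : b ≡ 0 ⊎ R b → cnt v (prefix π b) ≡ cnt v (prefix π' b)
    same-b (inj₁ e) = subst (λ z → cnt v (prefix π z) ≡ cnt v (prefix π' z)) (sym e) refl
    same-b (inj₂ r) = same {b} (inj₁ r) v
    seg-same : cnt v (seg π) ≡ cnt v (seg π')
    seg-same = +-cancelˡ-≡ (cnt v (prefix π b)) _ _ (trans (sym (split π)) (trans (same (top-Cut i≤n) v)
      (trans (split π') (cong (_+ cnt v (seg π')) (sym (same-b (bot-R i)))))))

  -- Each key belongs to its own Demazure set, hence to the other one, and so lies below the other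
  -- key. The keys thus agree, and with them all sets B_h.
  Dset-injective : ∀ (π π' : Vec ℕ n) → Sλ lam π → Sλ lam π' → SameSet (Dset lam π) (Dset lam π') → π ≡ π'
  Dset-injective π π' πS π'S eq = at-ext π π' λ i a b → ≤-antisym
      (entry-≤ π' π π'S πS (λ c v → sym (same c v)) i a b) (entry-≤ π π' πS π'S same i a b)
    where
    Y≤Y' : ∀ {j i} → InShape lam j i → Ykey lam π j i ≤ Ykey lam π' j i
    Y≤Y' = Key.Dset⇒≤Y π' (proj₁ π'S) (proj₁ (eq _) (Key.Y-Dset π (proj₁ πS)))
    Y'≤Y : ∀ {j i} → InShape lam j i → Ykey lam π' j i ≤ Ykey lam π j i
    Y'≤Y = Key.Dset⇒≤Y π (proj₁ πS) (proj₂ (eq _) (Key.Y-Dset π' (proj₁ π'S)))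
    same : ∀ {q} → Cut q → ∀ v → cnt v (prefix π q) ≡ cnt v (prefix π' q)
    same c v = ≤-antisym (cnt-Cut-≤ π π' (proj₁ πS) (proj₁ π'S) Y'≤Y c v) (cnt-Cut-≤ π' π (proj₁ π'S) (proj₁ πS) Y≤Y' c v)

-- The entries of Π_λ(γ), carrel by carrel

at-0 : ∀ {n} (v : Vec ℕ n) → at v 0 ≡ 0
at-0 V.[] = refl
at-0 (x V.∷ v) = refl

take-++ : ∀ (xs ys : List ℕ) → take (length xs) (xs ++ ys) ≡ xs
take-++ [] ys = refl
take-++ (x ∷ xs) ys = cong (x ∷_) (take-++ xs ys)

take-prefix : ∀ {n} (π : Vec ℕ n) {b k} → b ≤ k → take b (prefix π k) ≡ prefix π b
take-prefix π {b} {k} b≤k = trans (cong₂ take (sym (length-prefix π b)) (trans (cong (prefix π) (sym (m+[n∸m]≡n b≤k)))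
  (trans (cong (map (at π)) (range-+ b (k ∸ b))) (map-++ (at π) (range b) _)))) (take-++ (prefix π b) _)

module PiEntries {n : ℕ} (lam g : Vec ℕ n) where
  open Carrels lam

  π : Vec ℕ n
  π = Pi lam g

  length-piList : ∀ k → length (piList lam g k) ≡ k
  length-piList zero = refl
  length-piList (suc k) = trans (length-++ (piList lam g k)) (trans (+-comm _ 1) (cong suc (length-piList k)))

  nth-piList : ∀ d k i → i ≤ k → nth (piList lam g (k + d)) i ≡ nth (piList lam g k) i
  nth-piList zero k i p rewrite +-identityʳ k = refl
  nth-piList (suc d) k i p rewrite +-suc k d = trans
    (nth-++ˡ (piList lam g (k + d)) _ i (subst (i ≤_) (sym (length-piList (k + d))) (≤-trans p (m≤m+n k d)))) (nth-piList d k i p)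

  at-Pi : ∀ {i} → 1 ≤ i → i ≤ n → at π i ≡ piEntry lam g (piList lam g (i ∸ 1)) i
  at-Pi {suc i} i≥1 i≤n = begin
      at π (suc i)                          ≡⟨ at-tab n (λ k → nth (piList lam g n) k) (suc i) i≥1 i≤n ⟩
      nth (piList lam g n) (suc i)          ≡⟨ cong (λ z → nth (piList lam g z) (suc i)) (sym (m+[n∸m]≡n i≤n)) ⟩
      nth (piList lam g (suc i + (n ∸ suc i))) (suc i) ≡⟨ nth-piList (n ∸ suc i) (suc i) (suc i) ≤-refl ⟩
      nth (piList lam g (suc i)) (suc i)    ≡⟨ cong (λ z → nth (piList lam g (suc i)) (suc z)) (sym (length-piList i)) ⟩
      nth (piList lam g i ++ [ e ]) (suc (length (piList lam g i))) ≡⟨ nth-∷ʳ (piList lam g i) e ⟩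
      e ∎
    where
    open ≡-Reasoning
    e = piEntry lam g (piList lam g i) (suc i)

  piList≡prefix : ∀ {k} → k ≤ n → piList lam g k ≡ prefix π k
  piList≡prefix {zero} p = refl
  piList≡prefix {suc k} p = sym (trans (map-range-suc (at π) k)
    (cong₂ (λ x y → x ++ [ y ]) (sym (piList≡prefix (<⇒≤ p))) (at-Pi (s≤s z≤n) p)))

  shift : ℕ → ℕ
  shift b = if at g (suc b) ≤ᵇ at g b then suc (at g b ∸ at g (suc b)) else 0

  filledIn : ℕ → List ℕ → ℕ → ℕ
  filledIn b pre i = kthLargest (suc (b + shift b ∸ i)) (filterB (λ v → not (memb v (take b pre))) (range (at g b)))

  entryFrom : ℕ → List ℕ → ℕ → ℕ
  entryFrom b pre i = if b ≡ᵇ 0 then at g i else (if i ≤ᵇ b + shift b then filledIn b pre i else at g i)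

  missing : ℕ → List ℕ
  missing b = filterB (λ v → not (memb v (prefix π b))) (range (at g b))

  private
    entry≡ : ∀ {b i} → 1 ≤ i → i ≤ n → bot lam i ≡ b → at π i ≡ entryFrom b (piList lam g (i ∸ 1)) i
    entry≡ {b} {i} a c e = trans (at-Pi a c) (cong (λ z → entryFrom z (piList lam g (i ∸ 1)) i) e)

  at-Pi-high : ∀ {b i} → bot lam i ≡ b → b + shift b < i → i ≤ n → at π i ≡ at g i
  at-Pi-high {b} {i} e lt i≤n = trans (entry≡ (≤-trans (s≤s z≤n) lt) i≤n e) (go (b ≡ᵇ 0))
    where
    go : ∀ z → (if z then at g i else (if i ≤ᵇ b + shift b then filledIn b (piList lam g (i ∸ 1)) i else at g i)) ≡ at g i
    go true = refl
    go false rewrite ¬T⇒≡ {i ≤ᵇ b + shift b} (λ t → <⇒≱ lt (≤ᵇ⇒≤ i _ t)) = refl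

  at-Pi-low : ∀ {b i} → 1 ≤ b → bot lam i ≡ b → b < i → i ≤ b + shift b → i ≤ n →
    at π i ≡ kthLargest (suc (b + shift b ∸ i)) (missing b)
  at-Pi-low {suc b} {suc i} b≥1 e b<i le i≤n = trans (entry≡ (≤-trans (s≤s z≤n) b<i) i≤n e)
      (trans (cong (λ z → if z then filledIn (suc b) (piList lam g i) (suc i) else at g (suc i)) (T⇒≡ (≤⇒≤ᵇ le)))
        (cong (λ xs → kthLargest (suc (suc b + shift (suc b) ∸ suc i)) (filterB (λ v → not (memb v xs)) (range (at g (suc b)))))
          (trans (cong (take (suc b)) (piList≡prefix (<⇒≤ i≤n))) (take-prefix π (s≤s⁻¹ b<i)))))

-- The properties of Δ_λ(η), η ∈ UGC_λ(n), that the construction of Π_λ uses.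
record Gapless {n : ℕ} (lam g : Vec ℕ n) : Set where
  open Carrels lam
  field
    upper : Upper g
    increasing : ∀ {i x} → 1 ≤ i → i < x → x ≤ top lam i → i ≤ n → at g i < at g x
    ramp : ∀ {b} → R b → ∃ λ x → b < x × x ≤ top lam (suc b) × at g b ≤ at g x ×
      (∀ i → b < i → i ≤ x → at g i + (x ∸ i) ≡ at g x)

module PiGapless {n : ℕ} (lam g : Vec ℕ n) (gapless : Gapless lam g) where
  open Carrels lam
  open PiEntries lam g
  open Gapless gapless

  -- One pass of the construction: (b , q] is a carrel, and `old` is what the passes before it have
  -- established.
  module Carrel {b q : ℕ} (b-cut : b ≡ 0 ⊎ R b) (b<n : b < n) (top≡ : top lam (suc b) ≡ q)
      (old : ∀ {v} → v ∈ prefix π b → 1 ≤ v × v ≤ at g b) where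

    private
      s = shift b
      gb = at g b

    b<q : b < q
    b<q = subst (b <_) top≡ (top-≥ b<n)
    q≤n : q ≤ n
    q≤n = subst (_≤ n) top≡ (top-≤ b<n)

    bot≡ : ∀ {i} → b < i → i ≤ q → bot lam i ≡ b
    bot≡ {i} b<i i≤q = bot-unique b<i b-cut λ k p r → top-NoCut b<n k p (<-≤-trans r (subst (i ≤_) (sym top≡) i≤q))

    top-in : ∀ {i} → b < i → i ≤ q → top lam i ≡ q
    top-in {i} b<i i≤q = trans (top-unique (subst (i ≤_) (sym top≡) i≤q) (top-≤ b<n) (top-Cut b<n)
      (λ k p r → top-NoCut b<n k (≤-trans b<i p) r)) top≡

    g-increasing : ∀ {i x} → b < i → i < x → x ≤ q → at g i < at g x
    g-increasing {i} {x} b<i i<x x≤q = increasing (≤-trans (s≤s z≤n) b<i) i<x (subst (x ≤_) (sym (top-in b<i (≤-trans (<⇒≤ i<x) x≤q))) x≤q)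
      (≤-trans (≤-trans (<⇒≤ i<x) x≤q) q≤n)

    -- If the shift is positive, γ climbs with slope 1 through the first positions of the carrel and
    -- reaches γ_b exactly at the last position that is filled in. The argument s of `some` is the
    -- shift minus one.
    data ShiftView : ℕ → Set where
      none : gb < at g (suc b) → ShiftView 0
      some : 1 ≤ b → ∀ s → b + suc s ≤ q → at g (suc b) + s ≡ gb →
        (∀ i → b < i → i ≤ b + suc s → at g i + (b + suc s ∸ i) ≡ gb) → ShiftView (suc s)

    shiftView : ShiftView s
    shiftView with at g (suc b) ≤ᵇ gb in e
    ... | false = none (≰⇒> λ le → contradiction (trans (sym (T⇒≡ (≤⇒≤ᵇ le))) e) λ ())
    ... | true = view b-cut
      where
      le : at g (suc b) ≤ gb
      le = ≤ᵇ⇒≤ _ _ (≡⇒T e)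
      view : b ≡ 0 ⊎ R b → ShiftView (suc (gb ∸ at g (suc b)))
      -- In the first carrel b = 0, and γ_b is the default value 0 of `at`, below every entry of γ.
      view (inj₁ refl) = contradiction (≤-trans (proj₁ (proj₁ upper 1 ≤-refl b<n)) (≤-trans le (≤-reflexive (at-0 g)))) λ ()
      view (inj₂ r) with ramp r
      ... | x , b<x , x≤top , gb≤gx , slope = some (proj₁ (R⇒ r)) d (≤-trans bd≤x (subst (x ≤_) top≡ x≤top)) (m+[n∸m]≡n le) line
        where
        d = gb ∸ at g (suc b)
        d≤ : d ≤ x ∸ suc b
        d≤ = +-cancelˡ-≤ (at g (suc b)) _ _ (≤-trans (≤-reflexive (m+[n∸m]≡n le))
          (≤-trans gb≤gx (≤-reflexive (sym (slope (suc b) ≤-refl b<x)))))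
        bd≤x : b + suc d ≤ x
        bd≤x = ≤-trans (≤-reflexive (+-suc b d)) (≤-trans (+-monoʳ-≤ (suc b) d≤) (≤-reflexive (m+[n∸m]≡n b<x)))
        swap-last : ∀ a b c → a + b + c ≡ a + c + b
        swap-last = solve-∀
        -- both lines have slope 1 and pass through (x , g x)
        meets : gb + (x ∸ (b + suc d)) ≡ at g x
        meets = begin
          gb + (x ∸ (b + suc d))                     ≡⟨ cong (_+ (x ∸ (b + suc d))) (sym (m+[n∸m]≡n le)) ⟩
          at g (suc b) + d + (x ∸ (b + suc d))       ≡⟨ +-assoc (at g (suc b)) d _ ⟩
          at g (suc b) + (d + (x ∸ (b + suc d)))     ≡⟨ cong (λ z → at g (suc b) + (d + (x ∸ z))) (+-suc b d) ⟩
          at g (suc b) + (d + (x ∸ (suc b + d)))     ≡⟨ cong (λ z → at g (suc b) + (d + z)) (sym (∸-+-assoc x (suc b) d)) ⟩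
          at g (suc b) + (d + (x ∸ suc b ∸ d))       ≡⟨ cong (at g (suc b) +_) (m+[n∸m]≡n d≤) ⟩
          at g (suc b) + (x ∸ suc b)                 ≡⟨ slope (suc b) ≤-refl b<x ⟩
          at g x ∎
          where open ≡-Reasoning
        line : ∀ i → b < i → i ≤ b + suc d → at g i + (b + suc d ∸ i) ≡ gb
        line i b<i i≤ = +-cancelʳ-≡ (x ∸ (b + suc d)) _ _ (begin
          at g i + (b + suc d ∸ i) + (x ∸ (b + suc d))     ≡⟨ +-assoc (at g i) _ _ ⟩
          at g i + ((b + suc d ∸ i) + (x ∸ (b + suc d)))   ≡⟨ cong (at g i +_) (+-cancelʳ-≡ i _ _ (begin
              (b + suc d ∸ i) + (x ∸ (b + suc d)) + i      ≡⟨ swap-last (b + suc d ∸ i) _ i ⟩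
              (b + suc d ∸ i) + i + (x ∸ (b + suc d))      ≡⟨ cong (_+ (x ∸ (b + suc d))) (m∸n+n≡m i≤) ⟩
              b + suc d + (x ∸ (b + suc d))                ≡⟨ m+[n∸m]≡n bd≤x ⟩
              x                                            ≡⟨ m∸n+n≡m (≤-trans i≤ bd≤x) ⟨
              x ∸ i + i ∎)) ⟩
          at g i + (x ∸ i)                                 ≡⟨ slope i b<i (≤-trans i≤ bd≤x) ⟩
          at g x                                           ≡⟨ meets ⟨
          gb + (x ∸ (b + suc d)) ∎)
          where open ≡-Reasoning

    b+s≤q : b + s ≤ q
    b+s≤q with s | shiftView
    ... | _ | none _ = ≤-trans (≤-reflexive (+-identityʳ b)) (<⇒≤ b<q)
    ... | _ | some _ _ le _ _ = le

    g-above : ∀ {i} → b + s < i → i ≤ q → gb < at g i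
    g-above {i} lt i≤q with s | shiftView
    ... | _ | none p with i ≟ suc b
    ...   | yes refl = p
    ...   | no ne = <-trans p (g-increasing ≤-refl (≤∧≢⇒< (subst (_< i) (+-identityʳ b) lt) (ne ∘ sym)) i≤q)
    g-above {i} lt i≤q | _ | some _ d le e line = subst (_< at g i)
      (trans (sym (trans (cong (at g (b + suc d) +_) (n∸n≡0 (b + suc d))) (+-identityʳ _)))
        (line (b + suc d) (≤-trans (s≤s (m≤m+n b d)) (≤-reflexive (sym (+-suc b d)))) ≤-refl))
      (g-increasing (≤-trans (s≤s (m≤m+n b d)) (≤-reflexive (sym (+-suc b d)))) lt i≤q)

    comp : List ℕ
    comp = missing b

    Inc-comp : Inc comp
    Inc-comp = Inc-filterB _ (Inc-range gb)

    comp-bounds : ∀ {v} → v ∈ comp → 1 ≤ v × v ≤ gb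
    comp-bounds v∈ = ∈-range⁻ {m = gb} (proj₁ (filterB-∈⁻ _ (range gb) v∈))

    comp-new : ∀ {v} → v ∈ comp → v ∉ prefix π b
    comp-new {v} v∈ v∈P with proj₂ (filterB-∈⁻ (λ v → not (memb v (prefix π b))) (range gb) v∈)
    ... | t rewrite T⇒≡ (∈⇒memb v∈P) = t

    comp-∈ : ∀ {v} → 1 ≤ v → v ≤ gb → v ∉ prefix π b → v ∈ comp
    comp-∈ {v} p r v∉ = filterB-∈⁺ (λ v → not (memb v (prefix π b))) (range gb) (∈-range⁺ p r) t
      where
      t : T (not (memb v (prefix π b)))
      t rewrite ¬T⇒≡ {memb v (prefix π b)} (v∉ ∘ memb⇒∈) = _

    private L = length comp

    gb≤ : gb ≤ L + b
    gb≤ = subst₂ _≤_ (cong (_+ gb) (cnt-none 0 (All.tabulate pos)))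
        (trans (length-++ comp) (cong (L +_) (length-prefix π b)))
        (≤-trans (cnt-interval {0} {gb} {comp ++ prefix π b} z≤n covers) (cnt≤length gb (comp ++ prefix π b)))
      where
      pos : ∀ {v} → v ∈ comp ++ prefix π b → 0 < v
      pos v∈ with ∈-++⁻ comp v∈
      ... | inj₁ x = proj₁ (comp-bounds x)
      ... | inj₂ y = proj₁ (old y)
      covers : ∀ w → 0 < w → w ≤ gb → w ∈ comp ++ prefix π b
      covers w p r with w ∈? prefix π b
      ... | yes w∈ = ∈-++⁺ʳ comp w∈
      ... | no w∉ = ∈-++⁺ˡ (comp-∈ p r w∉)

    -- There are enough missing numbers because γ is upper: at most b of the numbers 1, ..., γ_b are
    -- used, while γ_{b+1} ≥ b + 1 gives γ_b ≥ b + s.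
    s≤L : s ≤ L
    s≤L with s | shiftView
    ... | _ | none _ = z≤n
    ... | _ | some _ d _ e _ = +-cancelʳ-≤ b _ _ (≤-trans (≤-reflexive (+-comm (suc d) b))
          (≤-trans (≤-reflexive (+-suc b d)) (≤-trans (+-monoˡ-≤ d (proj₂ upper (suc b) (s≤s z≤n) b<n)) (≤-trans (≤-reflexive e) gb≤))))

    -- The number of missing elements that are passed over: the carrel receives the s largest ones,
    -- those at the places o + 1, ..., o + s of the sorted list.
    o = L ∸ s

    o+s≡L : o + s ≡ L
    o+s≡L = m∸n+n≡m s≤L

    b≥1 : 1 ≤ s → 1 ≤ b
    b≥1 with s | shiftView
    ... | _ | none _ = λ ()
    ... | _ | some p _ _ _ _ = λ _ → p

    π-low : ∀ {k} → 1 ≤ k → k ≤ s → at π (b + k) ≡ nth comp (o + k)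
    π-low {k} k≥1 k≤s = trans (at-Pi-low (b≥1 (≤-trans k≥1 k≤s)) (bot≡ b<bk bk≤q) b<bk (+-monoʳ-≤ b k≤s) (≤-trans bk≤q q≤n))
        (trans (cong (λ z → kthLargest (suc z) comp) ([m+n]∸[m+o]≡n∸o b s k))
          (nth-reverse comp (o + k) (suc (s ∸ k)) (≤-trans k≥1 (m≤n+m k o)) index (s≤s z≤n)))
      where
      b<bk : b < b + k
      b<bk = ≤-trans (≤-reflexive (+-comm 1 b)) (+-monoʳ-≤ b k≥1)
      bk≤q = ≤-trans (+-monoʳ-≤ b k≤s) b+s≤q
      index : o + k + suc (s ∸ k) ≡ suc L
      index = trans (+-suc (o + k) _) (cong suc (trans (+-assoc o k _) (trans (cong (o +_) (m+[n∸m]≡n k≤s)) o+s≡L)))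

    π-low-∈ : ∀ {k} → 1 ≤ k → k ≤ s → at π (b + k) ∈ comp
    π-low-∈ {k} k≥1 k≤s = subst (_∈ comp) (sym (π-low k≥1 k≤s)) (nth-∈ comp (o + k) (≤-trans k≥1 (m≤n+m k o))
      (≤-trans (+-monoʳ-≤ o k≤s) (≤-reflexive o+s≡L)))

    π-high : ∀ {i} → b + s < i → i ≤ q → at π i ≡ at g i
    π-high lt i≤q = at-Pi-high (bot≡ (≤-<-trans (m≤m+n b s) lt) i≤q) lt (≤-trans i≤q q≤n)

    low-or-high : ∀ {i} → b < i → (∃ λ k → 1 ≤ k × k ≤ s × i ≡ b + k) ⊎ b + s < i
    low-or-high {i} b<i with i ≤? b + s
    ... | no p = inj₂ (≰⇒> p)
    ... | yes p = inj₁ (i ∸ b , m<n⇒0<n∸m b<i , ≤-trans (∸-monoˡ-≤ b p) (≤-reflexive (m+n∸m≡n b s)) , sym (m+[n∸m]≡n (<⇒≤ b<i)))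

    π-new : ∀ {i} → b < i → i ≤ q → at π i ∈ comp ⊎ gb < at π i
    π-new {i} b<i i≤q with low-or-high b<i
    ... | inj₁ (k , k≥1 , k≤s , refl) = inj₁ (π-low-∈ k≥1 k≤s)
    ... | inj₂ lt = inj₂ (subst (gb <_) (sym (π-high lt i≤q)) (g-above lt i≤q))

    π-increasing : ∀ {i} → b < i → i < q → at π i < at π (suc i)
    π-increasing {i} b<i i<q with low-or-high b<i | low-or-high {suc i} (m≤n⇒m≤1+n b<i)
    ... | inj₁ (k , k≥1 , k≤s , refl) | inj₁ (k' , k'≥1 , k'≤s , e) =
          subst₂ _<_ (sym (π-low k≥1 k≤s)) (sym (trans (cong (at π) e) (π-low k'≥1 k'≤s)))
          (nth-mono Inc-comp (≤-trans k≥1 (m≤n+m k o)) (+-monoʳ-< o (≤-reflexive (+-cancelˡ-≡ b _ _ (trans (+-suc b k) e))))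
            (≤-trans (+-monoʳ-≤ o k'≤s) (≤-reflexive o+s≡L)))
    ... | inj₁ (k , k≥1 , k≤s , refl) | inj₂ lt = ≤-<-trans (proj₂ (comp-bounds (π-low-∈ k≥1 k≤s)))
          (subst (gb <_) (sym (π-high lt i<q)) (g-above lt i<q))
    ... | inj₂ lt | _ = subst₂ _<_ (sym (π-high lt (<⇒≤ i<q))) (sym (π-high (m≤n⇒m≤1+n lt) i<q)) (g-increasing b<i ≤-refl i<q)

    -- A number up to γ_b was either used before or is missing. The missing ones from π_{b+1} on are
    -- precisely the s largest, all of which have been filled in.
    π-fills : ∀ {w} → at π (suc b) ≤ w → w ≤ gb → w ∈ prefix π q
    π-fills {w} p r with low-or-high {suc b} (n<1+n b)
    ... | inj₂ lt = contradiction (≤-trans p r) (<⇒≱ (subst (gb <_) (sym (π-high lt b<q)) (g-above lt b<q)))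
    ... | inj₁ (k₀ , k₀≥1 , k₀≤s , e₀) with w ∈? prefix π b
    ...   | yes w∈ = prefix-⊆ π (<⇒≤ b<q) w∈
    ...   | no w∉ with ∈-nth (comp-∈ (≤-trans (proj₁ (comp-bounds first∈)) p) r w∉)
      where
      first∈ : at π (suc b) ∈ comp
      first∈ = subst (λ z → at π z ∈ comp) (sym e₀) (π-low-∈ k₀≥1 k₀≤s)
    ...     | j , j≥1 , j≤L , refl = subst (_∈ prefix π q) (trans (π-low k≥1 k≤s) (cong (nth comp) (m+[n∸m]≡n (<⇒≤ o<j))))
              (∈-prefix⁺ π (≤-trans k≥1 (m≤n+m _ b)) (≤-trans (+-monoʳ-≤ b k≤s) b+s≤q))
      where
      first≡ : at π (suc b) ≡ nth comp (o + 1)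
      first≡ = trans (cong (at π) (+-comm 1 b)) (π-low ≤-refl (≤-trans k₀≥1 k₀≤s))
      o<j : o < j
      o<j = ≰⇒> λ j≤o → <⇒≱ (nth-mono Inc-comp j≥1 (<-≤-trans (s≤s j≤o) (≤-reflexive (+-comm 1 o)))
              (≤-trans (+-monoʳ-≤ o (≤-trans k₀≥1 k₀≤s)) (≤-reflexive o+s≡L))) (subst (_≤ nth comp j) first≡ p)
      k≥1 : 1 ≤ j ∸ o
      k≥1 = m<n⇒0<n∸m o<j
      k≤s : j ∸ o ≤ s
      k≤s = ≤-trans (∸-monoˡ-≤ o j≤L) (≤-reflexive (trans (cong (_∸ o) (sym o+s≡L)) (m+n∸m≡n o s)))

    seg : List ℕ
    seg = map (λ j → at π (b + j)) (range (q ∸ b))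

    b+j≤q : ∀ {j} → j ≤ q ∸ b → b + j ≤ q
    b+j≤q le = ≤-trans (+-monoʳ-≤ b le) (≤-reflexive (m+[n∸m]≡n (<⇒≤ b<q)))

    Inc-seg : Inc seg
    Inc-seg = Inc-map-range (λ j → at π (b + j)) (q ∸ b) λ j a c → subst (λ z → at π (b + j) < at π z) (sym (+-suc b j))
      (π-increasing (≤-trans (≤-reflexive (+-comm 1 b)) (+-monoʳ-≤ b a)) (≤-trans (≤-reflexive (sym (+-suc b j))) (b+j≤q c)))

    length-seg : length seg ≡ q ∸ b
    length-seg = length-map-range _ (q ∸ b)

    nth-seg : ∀ {j} → 1 ≤ j → j ≤ q ∸ b → nth seg j ≡ at π (b + j)
    nth-seg {j} a c = nth-map-range (λ j → at π (b + j)) (q ∸ b) j a c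

    prefix-split : prefix π q ≡ prefix π b ++ seg
    prefix-split = trans (cong (prefix π) (sym (m+[n∸m]≡n (<⇒≤ b<q)))) (trans (cong (map (at π)) (range-+ b (q ∸ b)))
      (trans (map-++ (at π) (range b) (map (b +_) (range (q ∸ b)))) (cong (prefix π b ++_) (sym (map-∘ (range (q ∸ b)))))))

    cnt-split : ∀ {v} → gb ≤ v → cnt v (prefix π q) ≡ b + cnt v seg
    cnt-split {v} le = trans (cong (cnt v) prefix-split) (trans (cnt-++ v (prefix π b) seg)
      (cong (_+ cnt v seg) (trans (cnt-all v (All.tabulate λ v∈ → ≤-trans (proj₂ (old v∈)) le)) (length-prefix π b))))

    -- The s numbers filled in are distinct and at most γ_b, so the smallest of them is at most γ_b
    -- - s + 1. In counts: at least L - (s - 1) = o + 1 missing numbers are at most γ_b - (s - 1).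
    first-low : 1 ≤ s → at π (suc b) + s ≤ suc gb
    first-low s≥1 = subst (λ z → z + s ≤ suc gb) (sym (trans (cong (at π) (+-comm 1 b)) (π-low ≤-refl s≥1))) (bound s refl s≥1)
      where
      bound : ∀ s' → s ≡ s' → 1 ≤ s' → nth comp (o + 1) + s ≤ suc gb
      bound (suc d) e _ = subst (λ z → nth comp (o + 1) + z ≤ suc gb) (sym e) (subst (_≤ suc gb) (sym (+-suc _ d)) (s≤s
          (subst (nth comp (o + 1) + d ≤_) (m∸n+n≡m d≤gb) (+-monoˡ-≤ d (cnt⇒nth Inc-comp (m≤n+m 1 o)
            (+-cancelʳ-≤ d _ _ (≤-trans (≤-reflexive (trans (+-assoc o 1 d) (trans (cong (o +_) (sym e)) o+s≡L)))
              (≤-trans (≤-reflexive (sym (cnt-all gb (All.tabulate λ v∈ → proj₂ (comp-bounds v∈)))))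
                (≤-trans (cnt-Lip (Inc⇒Unique Inc-comp) (m∸n≤m gb d)) (≤-reflexive (cong (cnt (gb ∸ d) comp +_) (m∸[m∸n]≡n d≤gb)))))))))))
        )
        where
        L≤gb : L ≤ gb
        L≤gb = subst₂ _≤_ (cnt-all gb (All.tabulate λ v∈ → proj₂ (comp-bounds v∈)))
          (cong (_+ gb) (cnt-none 0 (All.tabulate λ v∈ → proj₁ (comp-bounds v∈))))
          (cnt-Lip (Inc⇒Unique Inc-comp) (z≤n {gb}))
        d≤gb : d ≤ gb
        d≤gb = ≤-trans (n≤1+n d) (≤-trans (≤-reflexive (sym e)) (≤-trans s≤L L≤gb))

    cnt-gb : cnt gb (prefix π q) ≡ b + s
    cnt-gb = trans (cnt-split ≤-refl) (cong (b +_) (≤-antisym (≮⇒≥ high) low))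
      where
      s≤q∸b : s ≤ q ∸ b
      s≤q∸b = ≤-trans (≤-reflexive (sym (m+n∸m≡n b s))) (∸-monoˡ-≤ b b+s≤q)
      low : s ≤ cnt gb seg
      low = go s ≤-refl
        where
        go : ∀ s' → s' ≤ s → s' ≤ cnt gb seg
        go zero _ = z≤n
        go (suc d) le = nth⇒cnt Inc-seg (s≤s z≤n) (subst (suc d ≤_) (sym length-seg) (≤-trans le s≤q∸b))
          (subst (_≤ gb) (sym (nth-seg (s≤s z≤n) (≤-trans le s≤q∸b))) (proj₂ (comp-bounds (π-low-∈ (s≤s z≤n) le))))
      high : s < cnt gb seg → ⊥
      high lt = <⇒≱ (subst (gb <_) (sym (π-high beyond bs≤q)) (g-above beyond bs≤q))
          (subst (_≤ gb) (nth-seg (s≤s z≤n) s<l) (cnt⇒nth Inc-seg (s≤s z≤n) lt))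
        where
        s<l : suc s ≤ q ∸ b
        s<l = subst (suc s ≤_) length-seg (≤-trans lt (cnt≤length gb seg))
        bs≤q = b+j≤q s<l
        beyond : b + s < b + suc s
        beyond = +-monoʳ-< b (n<1+n s)

    g-ramp : ∀ {k} → 1 ≤ k → k ≤ s → at g (b + k) + (s ∸ k) ≡ gb
    g-ramp {k} k≥1 k≤s = trans (cong (at g (b + k) +_) (sym ([m+n]∸[m+o]≡n∸o b s k))) (line s refl shiftView)
      where
      line : ∀ s' → s ≡ s' → ShiftView s' → at g (b + k) + (b + s ∸ (b + k)) ≡ gb
      line .0 e (none _) = contradiction (≤-trans k≥1 (≤-trans k≤s (≤-reflexive e))) λ ()
      line .(suc d) e (some _ d _ _ f) = subst (λ z → at g (b + k) + (b + z ∸ (b + k)) ≡ gb) (sym e)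
        (f (b + k) (≤-trans (≤-reflexive (+-comm 1 b)) (+-monoʳ-≤ b k≥1)) (+-monoʳ-≤ b (≤-trans k≤s (≤-reflexive e))))

    gb≤gq : gb ≤ at g q
    gb≤gq with low-or-high b<q
    ... | inj₂ lt = <⇒≤ (g-above lt ≤-refl)
    ... | inj₁ (k , k≥1 , k≤s , e) = ≤-reflexive (trans (sym (g-ramp k≥1 k≤s)) (trans (cong (at g (b + k) +_) (m≤n⇒m∸n≡0 s≤k))
          (trans (+-identityʳ _) (cong (at g) (sym e)))))
      where
      s≤k : s ≤ k
      s≤k = +-cancelˡ-≤ b _ _ (≤-trans b+s≤q (≤-reflexive e))

    seg-new : ∀ {v} → v ∈ seg → v ∈ comp ⊎ gb < v
    seg-new v∈ with ∈-map⁻ (λ j → at π (b + j)) v∈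
    ... | j , j∈ , refl with ∈-range⁻ {m = q ∸ b} j∈
    ... | j≥1 , j≤ = π-new (≤-trans (≤-reflexive (+-comm 1 b)) (+-monoʳ-≤ b j≥1)) (b+j≤q j≤)

    Unique-step : AllPairs _≢_ (prefix π b) → AllPairs _≢_ (prefix π q)
    Unique-step un = subst (AllPairs _≢_) (sym prefix-split) (AllPairs.++⁺ un (Inc⇒Unique Inc-seg)
        (All.tabulate λ x∈ → All.tabulate λ y∈ → distinct x∈ (seg-new y∈)))
      where
      distinct : ∀ {x y} → x ∈ prefix π b → y ∈ comp ⊎ gb < y → x ≢ y
      distinct x∈ (inj₁ y∈) refl = comp-new y∈ x∈
      distinct x∈ (inj₂ lt) refl = <⇒≱ lt (proj₂ (old x∈))

    bounds-step : ∀ {v} → v ∈ prefix π q → 1 ≤ v × v ≤ at g q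
    bounds-step {v} v∈ with ∈-prefix⁻ π q v∈
    ... | a , a≥1 , a≤q , refl with a ≤? b
    ...   | yes p = proj₁ (old a∈) , ≤-trans (proj₂ (old a∈)) gb≤gq
      where a∈ = ∈-prefix⁺ π a≥1 p
    ...   | no p with low-or-high (≰⇒> p)
    ...     | inj₁ (k , k≥1 , k≤s , refl) = proj₁ (comp-bounds (π-low-∈ k≥1 k≤s)) , ≤-trans (proj₂ (comp-bounds (π-low-∈ k≥1 k≤s))) gb≤gq
    ...     | inj₂ lt rewrite π-high lt a≤q = proj₁ (proj₁ upper a a≥1 (≤-trans a≤q q≤n)) , last-max (a ≟ q)
      where
      last-max : Dec (a ≡ q) → at g a ≤ at g q
      last-max (yes e) = ≤-reflexive (cong (at g) e)
      last-max (no ne) = <⇒≤ (g-increasing (≰⇒> p) (≤∧≢⇒< a≤q ne) ≤-refl)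

    π-from-first : ∀ {i} → b < i → i ≤ q → at π (suc b) ≤ at π i
    π-from-first {i} b<i i≤q with i ≟ suc b
    ... | yes refl = ≤-refl
    ... | no ne = subst₂ _≤_ (trans (nth-seg ≤-refl (≤-trans k≥1 k≤)) (cong (at π) (+-comm b 1)))
          (trans (nth-seg k≥1 k≤) (cong (at π) (m+[n∸m]≡n (<⇒≤ b<i))))
          (<⇒≤ (nth-mono Inc-seg ≤-refl (≤∧≢⇒< k≥1 λ e → ne (trans (sym (m+[n∸m]≡n (<⇒≤ b<i))) (trans (cong (b +_) (sym e)) (+-comm b 1))))
            (subst (i ∸ b ≤_) (sym length-seg) k≤)))
      where
      k≥1 = m<n⇒0<n∸m b<i
      k≤ = ∸-monoˡ-≤ b i≤q

    -- Thus γ_i is the i-th smallest element of B_q, which is why Ψ_λ undoes Π_λ. In the upper part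
    -- of the carrel γ_i = π_i. In the filled part, the interval from γ_{b+k} to γ_b lies in B_q and
    -- has slope 1, so the rank of γ_{b+k} follows from that of γ_b, which is b + s.
    rank : AllPairs _≢_ (prefix π q) → ∀ {i} → b < i → i ≤ q → cnt (at g i) (prefix π q) ≡ i × at g i ∈ prefix π q
    rank un {i} b<i i≤q with low-or-high b<i
    ... | inj₂ lt = trans (cnt-split (<⇒≤ (g-above lt i≤q))) (trans (cong (b +_) (trans (cong (λ z → cnt z seg)
            (sym (trans (nth-seg j≥1 j≤) (trans (cong (at π) (m+[n∸m]≡n (<⇒≤ b<i))) (π-high lt i≤q)))))
            (cnt-nth Inc-seg j≥1 (subst (i ∸ b ≤_) (sym length-seg) j≤)))) (m+[n∸m]≡n (<⇒≤ b<i))) ,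
          subst (_∈ prefix π q) (π-high lt i≤q) (∈-prefix⁺ π (≤-trans (s≤s z≤n) b<i) i≤q)
      where
      j≥1 = m<n⇒0<n∸m b<i
      j≤ = ∸-monoˡ-≤ b i≤q
    ... | inj₁ (k , k≥1 , k≤s , refl) = ≤-antisym
          (+-cancelʳ-≤ (s ∸ k) _ _ (subst (λ z → cnt w (prefix π q) + z ≤ b + k + (s ∸ k)) gb∸w
            (≤-trans (cnt-interval w≤gb (λ u a c → π-fills (≤-trans first≤w (<⇒≤ a)) c)) (≤-reflexive (trans cnt-gb total)))))
          (+-cancelʳ-≤ (s ∸ k) _ _ (subst (λ z → b + k + (s ∸ k) ≤ cnt w (prefix π q) + z) gb∸w
            (≤-trans (≤-reflexive (trans (sym total) (sym cnt-gb))) (cnt-Lip un w≤gb)))) ,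
        π-fills first≤w w≤gb
      where
      w = at g (b + k)
      total : b + s ≡ b + k + (s ∸ k)
      total = trans (cong (b +_) (sym (m+[n∸m]≡n k≤s))) (sym (+-assoc b k _))
      w+≡gb = g-ramp k≥1 k≤s
      w≤gb : w ≤ gb
      w≤gb = ≤-trans (m≤m+n w _) (≤-reflexive w+≡gb)
      gb∸w : gb ∸ w ≡ s ∸ k
      gb∸w = trans (cong (_∸ w) (sym w+≡gb)) (m+n∸m≡n w _)
      first≤w : at π (suc b) ≤ w
      first≤w = +-cancelʳ-≤ (s ∸ k) _ _ (≤-trans (s≤s⁻¹ (≤-trans (≤-trans (≤-reflexive (sym (+-suc _ (s ∸ k))))
        (+-monoʳ-≤ (at π (suc b)) (∸-monoʳ-< {s} {k} {0} k≥1 k≤s))) (first-low (≤-trans k≥1 k≤s)))) (≤-reflexive (sym w+≡gb)))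

nth-AllPairs : ∀ {S : ℕ → ℕ → Set} {xs} → AllPairs S xs → ∀ {i j} → 1 ≤ i → i < j → j ≤ length xs → S (nth xs i) (nth xs j)
nth-AllPairs {xs = x ∷ xs} (p ∷ ps) {suc zero} {suc (suc j)} _ _ (s≤s q) = All.lookup p (nth-∈ xs (suc j) (s≤s z≤n) q)
nth-AllPairs {xs = x ∷ xs} (p ∷ ps) {suc (suc i)} {suc (suc j)} _ (s≤s lt) (s≤s q) = nth-AllPairs ps (s≤s z≤n) lt q
nth-AllPairs {xs = x ∷ xs} (p ∷ ps) {suc _} {suc zero} _ (s≤s ()) _

-- Π_λ(γ) is a λ-312-avoiding permutation with Ψ_λ(Π_λ(γ)) = γ

module PiAvoiding {n : ℕ} (lam g : Vec ℕ n) (gapless : Gapless lam g) where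
  open Carrels lam
  open PiEntries lam g using (π)
  open PiGapless lam g gapless
  open Gapless gapless

  top-suc-bot : ∀ {i} → 1 ≤ i → i ≤ n → top lam (suc (bot lam i)) ≡ top lam i
  top-suc-bot i≥1 i≤n = top-carrel i≥1 i≤n (n<1+n _) (≤-trans (bot-< i≥1) (top-≥ i≤n))

  Good : ℕ → Set
  Good q = (∀ {v} → v ∈ prefix π q → 1 ≤ v × v ≤ at g q) × AllPairs _≢_ (prefix π q)

  good : ∀ q → q ≡ 0 ⊎ Cut q → Good q
  good q c = go q ≤-refl c
    where
    go : ∀ f {q} → q ≤ f → q ≡ 0 ⊎ Cut q → Good q
    go f q≤f (inj₁ refl) = (λ ()) , []
    go f {zero} q≤f (inj₂ c) = (λ ()) , []
    go (suc f) {suc q} q≤f (inj₂ c) = bounds-step , Unique-step (proj₂ IH)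
      where
      q≥1 : 1 ≤ suc q
      q≥1 = s≤s z≤n
      b = bot lam (suc q)
      cut : b ≡ 0 ⊎ R b → b ≡ 0 ⊎ Cut b
      cut (inj₁ e) = inj₁ e
      cut (inj₂ r) = inj₂ (inj₁ r)
      IH : Good b
      IH = go f (s≤s⁻¹ (<-≤-trans (bot-< q≥1) q≤f)) (cut (bot-R (suc q)))
      open Carrel {b} {suc q} (bot-R (suc q)) (<-≤-trans (bot-< q≥1) (Cut⇒≤n c))
        (trans (top-suc-bot q≥1 (Cut⇒≤n c)) (top-of-Cut c)) (proj₁ IH)

  good-bot : ∀ i → Good (bot lam i)
  good-bot i = good _ (cut (bot-R i))
    where
    cut : ∀ {b} → b ≡ 0 ⊎ R b → b ≡ 0 ⊎ Cut b
    cut (inj₁ e) = inj₁ e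
    cut (inj₂ r) = inj₂ (inj₁ r)

  module CarrelOf {i : ℕ} (i≥1 : 1 ≤ i) (i≤n : i ≤ n) = Carrel {bot lam i} {top lam i} (bot-R i)
    (<-≤-trans (bot-< i≥1) i≤n) (top-suc-bot i≥1 i≤n) (proj₁ (good-bot i))

  Pi-perm : IsPerm π
  Pi-perm = bounds , distinct
    where
    bounds : IsTuple π
    bounds i i≥1 i≤n with proj₁ (good (top lam i) (inj₂ (top-Cut i≤n))) (∈-prefix⁺ π i≥1 (top-≥ i≤n))
    ... | p , q = p , ≤-trans q (proj₂ (proj₁ upper _ (≤-trans i≥1 (top-≥ i≤n)) (top-≤ i≤n)))
    distinct : ∀ i j → 1 ≤ i → i < j → j ≤ n → at π i ≢ at π j
    distinct i j i≥1 i<j j≤n = subst₂ _≢_ (nth-map-range (at π) n i i≥1 (≤-trans (<⇒≤ i<j) j≤n))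
      (nth-map-range (at π) n j (≤-trans i≥1 (<⇒≤ i<j)) j≤n)
      (nth-AllPairs (proj₂ (good n (inj₂ (inj₂ refl)))) i≥1 i<j (subst (j ≤_) (sym (length-prefix π n)) j≤n))

  -- In a forbidden pattern the value π_c lies between the first entry of the carrel of b and π_a ≤
  -- γ_q. By `π-fills` such a value has been used by the end of that carrel, hence not again at the
  -- later position c.
  Pi-S312 : S312 lam π
  Pi-S312 = (Pi-perm , λ i i≥1 i<n nc → CarrelOf.π-increasing i≥1 (<⇒≤ i<n) (bot-< i≥1) (NoCut⇒<top i<n nc)) , avoids
    where
    avoids : ∀ q a b c → T (isR lam q) → T (isR lam (top lam (suc q))) →
      1 ≤ a → a ≤ q → q < b → b ≤ top lam (suc q) → top lam (suc q) < c → c ≤ n →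
      ¬ ((at π c < at π a) × (at π b < at π c))
    avoids q a b c Rq _ a≥1 a≤q q<b b≤Q Q<c c≤n (ca , bc) with ∈-prefix⁻ π (top lam (suc q))
        (π-fills (≤-trans (π-from-first q<b b≤Q) (<⇒≤ bc)) (≤-trans (<⇒≤ ca) (proj₂ (old (∈-prefix⁺ π a≥1 a≤q)))))
      where
      old = proj₁ (good q (inj₂ (inj₁ (T⇒≡ Rq))))
      open Carrel {q} {top lam (suc q)} (inj₂ (T⇒≡ Rq)) (proj₂ (R⇒ (T⇒≡ Rq))) refl old using (π-fills; π-from-first)
    ... | d , d≥1 , d≤Q , e = proj₂ Pi-perm d c d≥1 (≤-<-trans d≤Q Q<c) c≤n (sym e)

  Psi-Pi : Psi lam π ≡ g
  Psi-Pi = at-ext (Psi lam π) g λ i a b → trans (at-Psi a b) (entry a b)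
    where
    open Avoiding lam π Pi-S312
    entry : ∀ {i} → 1 ≤ i → i ≤ n → γ i ≡ at g i
    entry {i} a b with CarrelOf.rank a b (proj₂ (good (top lam i) (inj₂ (top-Cut b)))) (bot-< a) (top-≥ b)
    ... | r , g∈ = trans (cong (nth (B (top lam i))) (sym (trans (cnt-B (at g i) (top-≤ b)) r)))
          (nth-cnt (Inc-B (top lam i)) (P⇒B (top-≤ b) g∈))

-- Δ_λ(η) satisfies the requirements of Π_λ

module DeltaGapless {n : ℕ} (lam η : Vec ℕ n) (ugc : UGC lam η) where
  open Carrels lam

  private
    Δ = Delta lam η
    x[_] : ℕ → ℕ
    x[ i ] = nextCritical η i

  -- As η is upper, η_x ≥ x ≥ x - i, so the truncated subtraction in the definition of Δ_λ is exact.
  Delta-shifted : ∀ {i} → 1 ≤ i → i ≤ n → at Δ i + (x[ i ] ∸ i) ≡ at η x[ i ]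
  Delta-shifted {i} a b = trans (cong (_+ (x[ i ] ∸ i)) (at-Delta η a b)) (m∸n+n≡m (≤-trans (m∸n≤m x[ i ] i)
    (proj₂ (proj₁ ugc) x[ i ] (≤-trans a (nextCritical-≥ η a b)) (nextCritical-≤n η a b))))

  Delta-line : ∀ {i} → 1 ≤ i → i ≤ n → at Δ i + x[ i ] ≡ at η x[ i ] + i
  Delta-line {i} a b = begin
      at Δ i + x[ i ]              ≡⟨ cong (at Δ i +_) (m∸n+n≡m (nextCritical-≥ η a b)) ⟨
      at Δ i + (x[ i ] ∸ i + i)    ≡⟨ +-assoc (at Δ i) _ _ ⟨
      at Δ i + (x[ i ] ∸ i) + i    ≡⟨ cong (_+ i) (Delta-shifted a b) ⟩
      at η x[ i ] + i ∎
    where open ≡-Reasoning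

  at-Delta-critical : ∀ {i} → 1 ≤ i → i ≤ n → x[ i ] ≡ i → at Δ i ≡ at η i
  at-Delta-critical {i} a b e = +-cancelʳ-≡ i _ _ (subst (λ z → at Δ i + z ≡ at η z + i) e (Delta-line a b))

  Delta-Upper : Upper Δ
  Delta-Upper = (λ i a b → ≤-trans a (upper a b) , ≤-trans (≤-trans (m≤m+n _ _) (≤-reflexive (Delta-shifted a b)))
      (proj₂ (proj₁ (proj₁ ugc) _ (≤-trans a (nextCritical-≥ η a b)) (nextCritical-≤n η a b)))) , λ i → upper
    where
    upper : ∀ {i} → 1 ≤ i → i ≤ n → i ≤ at Δ i
    upper {i} a b = +-cancelʳ-≤ x[ i ] _ _ (≤-trans (≤-reflexive (+-comm i _)) (≤-trans
      (+-monoˡ-≤ i (proj₂ (proj₁ ugc) x[ i ] (≤-trans a (nextCritical-≥ η a b)) (nextCritical-≤n η a b)))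
      (≤-reflexive (sym (Delta-line a b)))))

  -- Here Δ_i - i = η_X - X for the next critical index X, and likewise Y for y. Either X = Y, or X
  -- < y ≤ Y and X is a strict right-to-left minimum of η_z - z. Strict increase on the carrel
  -- follows.
  Delta-slope : ∀ {i y} → 1 ≤ i → i < y → y ≤ top lam i → i ≤ n → at Δ i + y ≤ at Δ y + i
  Delta-slope {i} {y} a i<y y≤ b = +-cancelʳ-≤ (X + Y) _ _ (begin
      at Δ i + y + (X + Y)      ≡⟨ shuffle₁ (at Δ i) y X Y ⟩
      (at Δ i + X) + (y + Y)    ≡⟨ cong (_+ (y + Y)) (Delta-line a b) ⟩
      (at η X + i) + (y + Y)    ≡⟨ shuffle₂ (at η X) i y Y ⟩
      (at η X + Y) + (y + i)    ≤⟨ +-monoˡ-≤ (y + i) critical-slope ⟩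
      (at η Y + X) + (y + i)    ≡⟨ shuffle₃ (at η Y) X y i ⟩
      (at η Y + y) + (X + i)    ≡⟨ cong (_+ (X + i)) (Delta-line y≥1 y≤n) ⟨
      (at Δ y + Y) + (X + i)    ≡⟨ shuffle₄ (at Δ y) Y X i ⟩
      at Δ y + i + (X + Y) ∎)
    where
    open ≤-Reasoning
    X = x[ i ]
    Y = x[ y ]
    y≥1 = ≤-trans a (<⇒≤ i<y)
    y≤n = ≤-trans y≤ (top-≤ b)
    shuffle₁ : ∀ p q r s → p + q + (r + s) ≡ (p + r) + (q + s)
    shuffle₁ = solve-∀
    shuffle₂ : ∀ p q r s → (p + q) + (r + s) ≡ (p + s) + (r + q)
    shuffle₂ = solve-∀
    shuffle₃ : ∀ p q r s → (p + q) + (r + s) ≡ (p + r) + (q + s)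
    shuffle₃ = solve-∀
    shuffle₄ : ∀ p q r s → (p + q) + (r + s) ≡ p + s + (r + q)
    shuffle₄ = solve-∀
    critical-slope : at η X + Y ≤ at η Y + X
    critical-slope with y ≤? X
    ... | yes p = ≤-reflexive (cong₂ (λ u v → at η u + v) (sym Y≡X) Y≡X)
      where Y≡X = nextCritical-step η a b (<⇒≤ i<y) p
    ... | no p = <⇒≤ (crit⇒IsMin η (≤-trans a (nextCritical-≥ η a b)) (nextCritical-≤n η a b) (nextCritical-critical η a b)
            Y (<-≤-trans (≰⇒> p) (nextCritical-≥ η y≥1 y≤n)) (subst (Y ≤_) (sym (top-nextCritical η a b)) Y≤top))
      where
      Y≤top : Y ≤ top lam i
      Y≤top = ≤-trans (nextCritical-≤top η y≥1 y≤n) (≤-reflexive (top-carrel a b (<-trans (bot-< a) i<y) y≤))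

  -- The witness x is the first critical index of the next carrel; up to x, Δ has slope 1 by
  -- construction. The end b of a carrel is critical itself, so the condition on critical entries
  -- yields η_b ≤ η_x.
  Delta-ramp : ∀ {b} → R b → ∃ λ x → b < x × x ≤ top lam (suc b) × at Δ b ≤ at Δ x ×
    (∀ i → b < i → i ≤ x → at Δ i + (x ∸ i) ≡ at Δ x)
  Delta-ramp {b} r = x , b<x , nextCritical-≤top η (s≤s z≤n) b<n , subst₂ _≤_ (sym (at-Delta-critical b≥1 (<⇒≤ b<n) b-fixed))
      (sym Δx) (proj₂ ugc b x b≥1 b<x x≤n (subst (λ z → T (isCrit lam η z))
        (top-of-Cut {b} (inj₁ r)) (top-critical η b≥1 (<⇒≤ b<n)))
        (nextCritical-critical η (s≤s z≤n) b<n)) ,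
      λ i b<i i≤x → let same = nextCritical-step η (s≤s z≤n) b<n b<i i≤x in
        trans (subst (λ z → at Δ i + (z ∸ i) ≡ at η z) same (Delta-shifted (≤-trans (s≤s z≤n) b<i) (≤-trans i≤x x≤n))) (sym Δx)
    where
    b≥1 = proj₁ (R⇒ r)
    b<n = proj₂ (R⇒ r)
    x = x[ suc b ]
    b<x = nextCritical-≥ η (s≤s z≤n) b<n
    x≤n = nextCritical-≤n η (s≤s z≤n) b<n
    b-fixed : x[ b ] ≡ b
    b-fixed = ≤-antisym (≤-trans (nextCritical-≤top η b≥1 (<⇒≤ b<n)) (≤-reflexive (top-of-Cut {b} (inj₁ r))))
      (nextCritical-≥ η b≥1 (<⇒≤ b<n))
    Δx : at Δ x ≡ at η x
    Δx = at-Delta-critical (≤-trans b≥1 (<⇒≤ b<x)) x≤n (nextCritical-step η (s≤s z≤n) b<n b<x ≤-refl)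

  Delta-Gapless : Gapless lam Δ
  Delta-Gapless = record
    { upper = Delta-Upper
    ; increasing = λ {i} {y} a i<y y≤ b → +-cancelʳ-≤ i _ _ (≤-trans
        (≤-trans (≤-reflexive (sym (+-suc (at Δ i) i))) (+-monoʳ-≤ (at Δ i) i<y)) (Delta-slope a i<y y≤ b))
    ; ramp = Delta-ramp
    }

theorem10p2 : (n : ℕ) → 1 ≤ n → (lam : Vec ℕ n) → IsPartition lam →
    ((η : Vec ℕ n) → UGC lam η →
    S312 lam (Pi lam (Delta lam η)) ×
    SameSet (Sset lam η) (Dset lam (Pi lam (Delta lam η))))
    × ((π : Vec ℕ n) → S312 lam π →
    UG lam (Psi lam π) × SameSet (Dset lam π) (Sset lam (Psi lam π)))
    × ((φ : Vec ℕ n) → UF lam φ →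
    Σ (Vec ℕ n) (λ π → Sλ lam π × SameSet (Sset lam φ) (Dset lam π) ×
    ((π' : Vec ℕ n) → Sλ lam π' → SameSet (Sset lam φ) (Dset lam π') → π' ≡ π)))
    × ((π : Vec ℕ n) → S312 lam π →
    Σ (Vec ℕ n) (λ φ → UF lam φ × SameSet (Dset lam π) (Sset lam φ)))
theorem10p2 n n≥1 lam part = flag⇒Demazure , Demazure⇒flag , UF⇒Demazure , Demazure⇒UF
  where
  open Flags n≥1 lam part
  open KeyUniqueness n≥1 lam part

  flag⇒Demazure : (η : Vec ℕ n) → UGC lam η →
    S312 lam (Pi lam (Delta lam η)) × SameSet (Sset lam η) (Dset lam (Pi lam (Delta lam η)))
  flag⇒Demazure η ugc = Pi-S312 , SameSet-trans {Sset lam η} {Sset lam (Delta lam η)} {Dset lam π} (Sset-Delta η)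
      (subst (λ ψ → SameSet (Sset lam ψ) (Dset lam π)) Psi-Pi (AvoidingFlags.Sset-Psi π Pi-S312))
    where
    π = Pi lam (Delta lam η)
    open PiAvoiding lam (Delta lam η) (DeltaGapless.Delta-Gapless lam η ugc)

  Demazure⇒flag : (π : Vec ℕ n) → S312 lam π → UG lam (Psi lam π) × SameSet (Dset lam π) (Sset lam (Psi lam π))
  Demazure⇒flag π av = (γ-UGC , γ-UI) , SameSet-sym {Sset lam (Psi lam π)} {Dset lam π} Sset-Psi
    where open AvoidingFlags π av

  UF⇒UGC : ∀ {φ} → UF lam φ → UGC lam φ
  UF⇒UGC {φ} (upper , mono) = upper , λ i j i≥1 i<j j≤n _ _ → go i≥1 (j ∸ i) (m+[n∸m]≡n (<⇒≤ i<j)) j≤n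
    where
    go : ∀ {i} → 1 ≤ i → ∀ d {j} → i + d ≡ j → j ≤ n → at φ i ≤ at φ j
    go {i} i≥1 zero refl j≤n rewrite +-identityʳ i = ≤-refl
    go {i} i≥1 (suc d) refl j≤n rewrite +-suc i d = ≤-trans (go i≥1 d refl (<⇒≤ j≤n)) (mono (i + d) (≤-trans i≥1 (m≤m+n i d)) j≤n)

  UF⇒Demazure : (φ : Vec ℕ n) → UF lam φ →
    Σ (Vec ℕ n) (λ π → Sλ lam π × SameSet (Sset lam φ) (Dset lam π) ×
      ((π' : Vec ℕ n) → Sλ lam π' → SameSet (Sset lam φ) (Dset lam π') → π' ≡ π))
  UF⇒Demazure φ uf = π , proj₁ av , same , λ π' π'S same' → Dset-injective π' π π'S (proj₁ av)
      (SameSet-trans {Dset lam π'} {Sset lam φ} {Dset lam π} (SameSet-sym {Sset lam φ} {Dset lam π'} same') same)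
    where
    π = Pi lam (Delta lam φ)
    av = proj₁ (flag⇒Demazure φ (UF⇒UGC uf))
    same = proj₂ (flag⇒Demazure φ (UF⇒UGC uf))

  Demazure⇒UF : (π : Vec ℕ n) → S312 lam π → Σ (Vec ℕ n) (λ φ → UF lam φ × SameSet (Dset lam π) (Sset lam φ))
  Demazure⇒UF π av = monotoneFlag , monotoneFlag-UF , 
      SameSet-trans {Dset lam π} {Sset lam (Psi lam π)} {Sset lam monotoneFlag}
        (SameSet-sym {Sset lam (Psi lam π)} {Dset lam π} Sset-Psi) Sset-monotoneFlag
    where open AvoidingFlags π av
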